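{- For $d\ge1$ let $\mathrm{St}_d\subset\mathbb{R}^d$ be the convex hull of $$\{\pm e_i : 1\le i\le d\}\cup\{e_i+\cdots+e_j : 1\le i<j\le d\}$$ (the dual polytope of the Stasheff polytope, or associahedron), and let $H_{\mathrm{St}_d}$ be its Ehrhart polynomial, with $H_{\mathrm{St}_0}=1$. Then $$H_{\mathrm{St}_d}(m)=\frac{2d+1}{d(d+2)}(2m+1)H_{\mathrm{St}_{d-1}}(m)+\frac{(d-1)(d+1)}{d(d+2)}H_{\mathrm{St}_{d-2}}(m)\quad\text{for all } d\ge2.$$ Moreover, for every $d\ge1$, $H_{\mathrm{St}_d}$ has all its complex roots on the line $R=\{z\in\mathbb{C}:\operatorname{Re}(z)=-\tfrac12\}$, and $H_{\mathrm{St}_{d+1}}$ is $R$-interlaced by $H_{\mathrm{St}_d}$.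
   Context: Here $e_1,\dots,e_d$ is the standard basis of $\mathbb{R}^d$. The Ehrhart polynomial $H_P$ of a lattice polytope $P\subset\mathbb{R}^d$ is the polynomial with $H_P(s)=|sP\cap\mathbb{Z}^d|$ for all integers $s\ge0$. It is a known result (recalled, not part of the claim) that $H_{\mathrm{St}_d}(m)=\sum_{k=0}^d\frac{1}{d+1}\binom{d+1}{k+1}\binom{d+1}{k}\binom{m+d-k}{d}$. Interlacing: let $L=\alpha+\mathbb{R}\beta$ be a line in $\mathbb{C}$ ($\alpha,\beta\in\mathbb{C}$, $\beta\ne0$), and let $f,g\in\mathbb{C}[x]$ with $m=\deg f=\deg g+1$ have all their zeros on $L$. Let $\alpha+t_1\beta,\dots,\alpha+t_m\beta$ and $\alpha+s_1\beta,\dots,\alpha+s_{m-1}\beta$ ($t_i,s_j\in\mathbb{R}$) be the zeros of $f$ and $g$, listed with multiplicity. Then $f$ is $L$-interlaced by $g$ if, after relabeling, $t_1\le s_1\le t_2\le\cdots\le t_{m-1}\le s_{m-1}\le t_m$. -}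

module Defs where

open import Data.Bool using (if_then_else_; _∧_)
open import Data.Fin using (Fin; zero; suc; inject₁; _≟_; _≤?_) renaming (_<_ to _<ᶠ_)
open import Data.Integer as ℤ using (ℤ)
open import Data.List using (List; []; _∷_; length; map)
open import Data.List.Membership.Propositional using (_∈_)
open import Data.List.Relation.Unary.Unique.Propositional using (Unique)
open import Data.Nat as ℕ using (ℕ; zero; suc)
import Data.Nat.Properties as ℕ
open import Data.Product using (Σ; ∃; ∃-syntax; _×_; _,_; proj₁; proj₂)
open import Data.Rational as ℚ using (ℚ; 0ℚ; 1ℚ; ½)
import Data.Rational.Properties as ℚ
open import Data.Rational.Solver using (module +-*-Solver)
open import Data.Sum using (_⊎_)
open import Data.Vec using (Vec; lookup)
open import Data.Vec.Functional using (Vector; foldr)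
open import Function using (_⇔_; mk⇔; case_of_)
open import Relation.Binary.PropositionalEquality
  using (_≡_; refl; sym; trans; cong; subst)
open import Relation.Nullary using (¬_)
open import Relation.Nullary.Decidable using (⌊_⌋)

------------------------------------------------------------------------
-- Real numbers: Cauchy sequences of rationals, taken up to _≈_

IsCauchy : (ℕ → ℚ) → Set
IsCauchy x = ∀ ε → 0ℚ ℚ.< ε →
  ∃[ N ] ∀ m n → N ℕ.≤ m → N ℕ.≤ n → ℚ.∣ x m ℚ.- x n ∣ ℚ.< ε

record ℝ : Set where
  constructor mkℝ
  field
    seq    : ℕ → ℚ
    cauchy : IsCauchy seq

open ℝ public

infix 4 _≈_ _≤_

record _≈_ (x y : ℝ) : Set where
  constructor mk≈
  field
    close : ∀ ε → 0ℚ ℚ.< ε →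
      ∃[ N ] ∀ n → N ℕ.≤ n → ℚ.∣ seq x n ℚ.- seq y n ∣ ℚ.< ε

record _≤_ (x y : ℝ) : Set where
  constructor mk≤
  field
    below : ∀ ε → 0ℚ ℚ.< ε →
      ∃[ N ] ∀ n → N ℕ.≤ n → seq x n ℚ.≤ seq y n ℚ.+ ε

open _≈_ public
open _≤_ public

+-isCauchy : ∀ x y → IsCauchy x → IsCauchy y → IsCauchy (λ n → x n ℚ.+ y n)
+-isCauchy x y cx cy ε ε>0 = Nx ℕ.⊔ Ny , λ m n m≥ n≥ →
  let δ<x = px m n (ℕ.m⊔n≤o⇒m≤o Nx Ny m≥) (ℕ.m⊔n≤o⇒m≤o Nx Ny n≥)
      δ<y = py m n (ℕ.m⊔n≤o⇒n≤o Nx Ny m≥) (ℕ.m⊔n≤o⇒n≤o Nx Ny n≥)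
  in begin-strict
    ℚ.∣ (x m ℚ.+ y m) ℚ.- (x n ℚ.+ y n) ∣
      ≡⟨ cong ℚ.∣_∣ (regroup (x m) (y m) (x n) (y n)) ⟩
    ℚ.∣ (x m ℚ.- x n) ℚ.+ (y m ℚ.- y n) ∣
      ≤⟨ ℚ.∣p+q∣≤∣p∣+∣q∣ (x m ℚ.- x n) (y m ℚ.- y n) ⟩
    ℚ.∣ x m ℚ.- x n ∣ ℚ.+ ℚ.∣ y m ℚ.- y n ∣
      <⟨ ℚ.+-mono-< δ<x δ<y ⟩
    δ ℚ.+ δ
      ≡⟨ halves ε ⟩
    ε ∎
  where
  open ℚ.≤-Reasoning
  δ = ½ ℚ.* ε
  δ>0 : 0ℚ ℚ.< δ
  δ>0 = subst (ℚ._< δ) (ℚ.*-zeroʳ ½) (ℚ.*-monoʳ-<-pos ½ ε>0)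
  Nx = proj₁ (cx δ δ>0)
  px = proj₂ (cx δ δ>0)
  Ny = proj₁ (cy δ δ>0)
  py = proj₂ (cy δ δ>0)
  open +-*-Solver
  regroup : ∀ a b c d → (a ℚ.+ b) ℚ.- (c ℚ.+ d) ≡ (a ℚ.- c) ℚ.+ (b ℚ.- d)
  regroup = solve 4 (λ a b c d → (a :+ b) :- (c :+ d) := (a :- c) :+ (b :- d)) refl
  halves : ∀ e → ½ ℚ.* e ℚ.+ ½ ℚ.* e ≡ e
  halves = solve 1 (λ e → con ½ :* e :+ con ½ :* e := e) refl

neg-isCauchy : ∀ x → IsCauchy x → IsCauchy (λ n → ℚ.- x n)
neg-isCauchy x cx ε ε>0 = proj₁ (cx ε ε>0) , λ m n m≥ n≥ →
  subst (ℚ._< ε)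
    (trans (sym (ℚ.∣-p∣≡∣p∣ (x m ℚ.- x n))) (cong ℚ.∣_∣ (negate (x m) (x n))))
    (proj₂ (cx ε ε>0) m n m≥ n≥)
  where
  open +-*-Solver
  negate : ∀ a b → ℚ.- (a ℚ.- b) ≡ (ℚ.- a) ℚ.- (ℚ.- b)
  negate = solve 2 (λ a b → :- (a :- b) := (:- a) :- (:- b)) refl

const-isCauchy : ∀ q → IsCauchy (λ _ → q)
const-isCauchy q ε ε>0 = 0 , λ _ _ _ _ →
  subst (ℚ._< ε) (sym (cong ℚ.∣_∣ (ℚ.+-inverseʳ q))) ε>0

bounded : ∀ x → IsCauchy x →
          ∃[ B ] 0ℚ ℚ.< B × ∃[ N ] ∀ n → N ℕ.≤ n → ℚ.∣ x n ∣ ℚ.≤ B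
bounded x cx = B , B>0 , N , λ n n≥ → begin
    ℚ.∣ x n ∣
      ≡⟨ cong ℚ.∣_∣ (split (x n) (x N)) ⟩
    ℚ.∣ x N ℚ.+ (x n ℚ.- x N) ∣
      ≤⟨ ℚ.∣p+q∣≤∣p∣+∣q∣ (x N) (x n ℚ.- x N) ⟩
    ℚ.∣ x N ∣ ℚ.+ ℚ.∣ x n ℚ.- x N ∣
      ≤⟨ ℚ.+-monoʳ-≤ ℚ.∣ x N ∣ (ℚ.<⇒≤ (proj₂ (cx 1ℚ 0<1) n N n≥ ℕ.≤-refl)) ⟩
    B ∎
  where
  open ℚ.≤-Reasoning
  0<1 : 0ℚ ℚ.< 1ℚ
  0<1 = ℚ.positive⁻¹ 1ℚ
  N = proj₁ (cx 1ℚ 0<1)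
  B = ℚ.∣ x N ∣ ℚ.+ 1ℚ
  B>0 : 0ℚ ℚ.< B
  B>0 = ℚ.+-mono-≤-< (ℚ.0≤∣p∣ (x N)) 0<1
  open +-*-Solver
  split : ∀ a b → a ≡ b ℚ.+ (a ℚ.- b)
  split = solve 2 (λ a b → a := b :+ (a :- b)) refl

divide : ∀ K → 0ℚ ℚ.< K → ∀ ε → 0ℚ ℚ.< ε → ∃[ δ ] 0ℚ ℚ.< δ × K ℚ.* δ ≡ ε
divide K K>0 ε ε>0 = 1/K ℚ.* ε
  , subst (ℚ._< 1/K ℚ.* ε) (ℚ.*-zeroʳ 1/K)
      (ℚ.*-monoʳ-<-pos 1/K {{ℚ.1/pos⇒pos K {{K⁺}}}} ε>0)
  , trans (sym (ℚ.*-assoc K 1/K ε))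
      (trans (cong (ℚ._* ε) (ℚ.*-inverseʳ K {{K≢0}})) (ℚ.*-identityˡ ε))
  where
  K⁺ = ℚ.positive {K} K>0
  K≢0 = ℚ.pos⇒nonZero K {{K⁺}}
  1/K = (ℚ.1/ K) {{K≢0}}

∣*∣-bound : ∀ {K δ} → 0ℚ ℚ.< K → ∀ a b → ℚ.∣ a ∣ ℚ.≤ K → ℚ.∣ b ∣ ℚ.< δ →
            ℚ.∣ a ℚ.* b ∣ ℚ.< K ℚ.* δ
∣*∣-bound {K} {δ} K>0 a b a≤ b< = begin-strict
  ℚ.∣ a ℚ.* b ∣          ≡⟨ ℚ.∣p*q∣≡∣p∣*∣q∣ a b ⟩
  ℚ.∣ a ∣ ℚ.* ℚ.∣ b ∣
    ≤⟨ ℚ.*-monoʳ-≤-nonNeg ℚ.∣ b ∣ {{ℚ.nonNegative (ℚ.0≤∣p∣ b)}} a≤ ⟩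
  K ℚ.* ℚ.∣ b ∣          <⟨ ℚ.*-monoʳ-<-pos K {{ℚ.positive K>0}} b< ⟩
  K ℚ.* δ ∎
  where open ℚ.≤-Reasoning

∣Δ*∣-bound : ∀ {A B δ} → 0ℚ ℚ.< A → 0ℚ ℚ.< B → ∀ a b c d →
             ℚ.∣ a ∣ ℚ.≤ A → ℚ.∣ d ∣ ℚ.≤ B →
             ℚ.∣ a ℚ.- c ∣ ℚ.< δ → ℚ.∣ b ℚ.- d ∣ ℚ.< δ →
             ℚ.∣ a ℚ.* b ℚ.- c ℚ.* d ∣ ℚ.< (A ℚ.+ B) ℚ.* δ
∣Δ*∣-bound {A} {B} {δ} A>0 B>0 a b c d a≤ d≤ ac< bd< = begin-strict
  ℚ.∣ a ℚ.* b ℚ.- c ℚ.* d ∣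
    ≡⟨ cong ℚ.∣_∣ (regroup a b c d) ⟩
  ℚ.∣ a ℚ.* (b ℚ.- d) ℚ.+ d ℚ.* (a ℚ.- c) ∣
    ≤⟨ ℚ.∣p+q∣≤∣p∣+∣q∣ (a ℚ.* (b ℚ.- d)) (d ℚ.* (a ℚ.- c)) ⟩
  ℚ.∣ a ℚ.* (b ℚ.- d) ∣ ℚ.+ ℚ.∣ d ℚ.* (a ℚ.- c) ∣
    <⟨ ℚ.+-mono-< (∣*∣-bound A>0 a (b ℚ.- d) a≤ bd<)
                  (∣*∣-bound B>0 d (a ℚ.- c) d≤ ac<) ⟩
  A ℚ.* δ ℚ.+ B ℚ.* δ
    ≡⟨ ℚ.*-distribʳ-+ δ A B ⟨
  (A ℚ.+ B) ℚ.* δ ∎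
  where
  open ℚ.≤-Reasoning
  open +-*-Solver
  regroup : ∀ a b c d →
    a ℚ.* b ℚ.- c ℚ.* d ≡ a ℚ.* (b ℚ.- d) ℚ.+ d ℚ.* (a ℚ.- c)
  regroup = solve 4
    (λ a b c d → a :* b :- c :* d := a :* (b :- d) :+ d :* (a :- c)) refl

*-isCauchy : ∀ x y → IsCauchy x → IsCauchy y → IsCauchy (λ n → x n ℚ.* y n)
*-isCauchy x y cx cy ε ε>0 =
  let A , A>0 , N₁ , bx = bounded x cx
      B , B>0 , N₂ , by = bounded y cy
      δ , δ>0 , Kδ≡ε    = divide (A ℚ.+ B) (ℚ.+-mono-< A>0 B>0) ε ε>0
      N₃ , px           = cx δ δ>0
      N₄ , py           = cy δ δ>0
      N₁₂ = N₁ ℕ.⊔ N₂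
      N₃₄ = N₃ ℕ.⊔ N₄
  in N₁₂ ℕ.⊔ N₃₄ , λ m n m≥ n≥ →
    let m≥₁₂ = ℕ.m⊔n≤o⇒m≤o N₁₂ N₃₄ m≥
        m≥₃₄ = ℕ.m⊔n≤o⇒n≤o N₁₂ N₃₄ m≥
        n≥₁₂ = ℕ.m⊔n≤o⇒m≤o N₁₂ N₃₄ n≥
        n≥₃₄ = ℕ.m⊔n≤o⇒n≤o N₁₂ N₃₄ n≥
    in subst (ℚ.∣ x m ℚ.* y m ℚ.- x n ℚ.* y n ∣ ℚ.<_) Kδ≡ε
         (∣Δ*∣-bound A>0 B>0 (x m) (y m) (x n) (y n)
           (bx m (ℕ.m⊔n≤o⇒m≤o N₁ N₂ m≥₁₂))
           (by n (ℕ.m⊔n≤o⇒n≤o N₁ N₂ n≥₁₂))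
           (px m n (ℕ.m⊔n≤o⇒m≤o N₃ N₄ m≥₃₄) (ℕ.m⊔n≤o⇒m≤o N₃ N₄ n≥₃₄))
           (py m n (ℕ.m⊔n≤o⇒n≤o N₃ N₄ m≥₃₄) (ℕ.m⊔n≤o⇒n≤o N₃ N₄ n≥₃₄)))

abstract
  const-cauchy : ∀ q → IsCauchy (λ _ → q)
  const-cauchy = const-isCauchy

  neg-cauchy : ∀ x → IsCauchy (λ n → ℚ.- seq x n)
  neg-cauchy x = neg-isCauchy (seq x) (cauchy x)

  +-cauchy : ∀ x y → IsCauchy (λ n → seq x n ℚ.+ seq y n)
  +-cauchy x y = +-isCauchy (seq x) (seq y) (cauchy x) (cauchy y)

  *-cauchy : ∀ x y → IsCauchy (λ n → seq x n ℚ.* seq y n)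
  *-cauchy x y = *-isCauchy (seq x) (seq y) (cauchy x) (cauchy y)

infixl 6 _+_ _-_
infixl 7 _*_
infix  8 -_

fromℚ : ℚ → ℝ
fromℚ q = mkℝ (λ _ → q) (const-cauchy q)

fromℤ : ℤ → ℝ
fromℤ k = fromℚ (k ℚ./ 1)

0ℝ 1ℝ : ℝ
0ℝ = fromℚ 0ℚ
1ℝ = fromℚ 1ℚ

_+_ _*_ : ℝ → ℝ → ℝ
x + y = mkℝ (λ n → seq x n ℚ.+ seq y n) (+-cauchy x y)
x * y = mkℝ (λ n → seq x n ℚ.* seq y n) (*-cauchy x y)

-_ : ℝ → ℝ
- x = mkℝ (λ n → ℚ.- seq x n) (neg-cauchy x)

_-_ : ℝ → ℝ → ℝ
x - y = x + (- y)

sum : ∀ {n} → Vector ℝ n → ℝ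
sum = foldr _+_ 0ℝ

------------------------------------------------------------------------
-- Complex numbers

record ℂ : Set where
  constructor _+i_
  field
    re im : ℝ

open ℂ public

infix 4 _≈ᶜ_ _≉ᶜ_

record _≈ᶜ_ (z w : ℂ) : Set where
  constructor mk≈ᶜ
  field
    re≈ : re z ≈ re w
    im≈ : im z ≈ im w

open _≈ᶜ_ public

_≉ᶜ_ : ℂ → ℂ → Set
z ≉ᶜ w = ¬ (z ≈ᶜ w)

infixl 6 _+ᶜ_ _-ᶜ_
infixl 7 _*ᶜ_

_+ᶜ_ _-ᶜ_ _*ᶜ_ : ℂ → ℂ → ℂ
z +ᶜ w = (re z + re w) +i (im z + im w)
z -ᶜ w = (re z - re w) +i (im z - im w)
z *ᶜ w = (re z * re w - im z * im w) +i (re z * im w + im z * re w)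

fromℝ : ℝ → ℂ
fromℝ x = x +i 0ℝ

ratᶜ : ℚ → ℂ
ratᶜ q = fromℝ (fromℚ q)

0ᶜ 1ᶜ 𝕚 : ℂ
0ᶜ = fromℝ 0ℝ
1ᶜ = fromℝ 1ℝ
𝕚  = 0ℝ +i 1ℝ

product : ∀ {n} → Vector ℂ n → ℂ
product = foldr _*ᶜ_ 1ᶜ

------------------------------------------------------------------------
-- Polynomials, as coefficient lists with the constant term first.
-- Trailing zero coefficients are allowed, so the degree is not read off
-- from the length.

ℚ[x] ℂ[x] : Set
ℚ[x] = List ℚ
ℂ[x] = List ℂ

evalℚ : ℚ[x] → ℚ → ℚ
evalℚ []      x = 0ℚ
evalℚ (a ∷ p) x = a ℚ.+ x ℚ.* evalℚ p x

eval : ℂ[x] → ℂ → ℂ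
eval []      z = 0ᶜ
eval (a ∷ p) z = a +ᶜ z *ᶜ eval p z

toℂ[x] : ℚ[x] → ℂ[x]
toℂ[x] = map ratᶜ

coeff : ℂ[x] → ℕ → ℂ
coeff []      k       = 0ᶜ
coeff (a ∷ p) zero    = a
coeff (a ∷ p) (suc k) = coeff p k

HasDegree : ℂ[x] → ℕ → Set
HasDegree p n = (coeff p n ≉ᶜ 0ᶜ) × (∀ k → n ℕ.< k → coeff p k ≈ᶜ 0ᶜ)

-- z₁, …, zₙ are the zeros of p, a polynomial of degree n, listed with
-- multiplicity: p(w) = a (w − z₁) ⋯ (w − zₙ) with a the leading coefficient.
ListsZeros : ∀ {n} → Vector ℂ n → ℂ[x] → Set
ListsZeros {n} z p =
  HasDegree p n × (∀ w → eval p w ≈ᶜ coeff p n *ᶜ product (λ i → w -ᶜ z i))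

------------------------------------------------------------------------
-- Interlacing on a line

record Line : Set where
  field
    α β : ℂ
    β≉0 : β ≉ᶜ 0ᶜ

  point : ℝ → ℂ
  point t = α +ᶜ fromℝ t *ᶜ β

InterlacedBy : Line → ℂ[x] → ℂ[x] → Set
InterlacedBy L f g =
  ∃[ m ] Σ (Vector ℝ (suc m)) λ t → Σ (Vector ℝ m) λ s →
    ListsZeros (λ i → Line.point L (t i)) f ×
    ListsZeros (λ j → Line.point L (s j)) g ×
    (∀ (j : Fin m) → (t (inject₁ j) ≤ s j) × (s j ≤ t (suc j)))

-½ : ℝ
-½ = fromℚ (ℚ.- ½)

-- The line Re z = -1/2, as -1/2 + ℝ i.
R : Line
R = record
  { α   = fromℝ -½
  ; β   = 𝕚
  ; β≉0 = λ 𝕚≈0 → case close (im≈ 𝕚≈0) 1ℚ (ℚ.positive⁻¹ 1ℚ) of λ where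
      (N , small) → ℚ.<-irrefl refl (small N ℕ.≤-refl)
  }

private
  pointwise : ∀ x y → (∀ n → seq x n ≡ seq y n) → x ≈ y
  pointwise x y eq = mk≈ λ ε ε>0 → 0 , λ n _ →
    subst (ℚ._< ε)
      (sym (cong ℚ.∣_∣ (trans (cong (ℚ._- seq y n) (eq n)) (ℚ.+-inverseʳ (seq y n))))) ε>0

R-point : ∀ t → Line.point R t ≈ᶜ (-½ +i t)
R-point t = mk≈ᶜ
  (pointwise (re (Line.point R t)) -½ (λ n → real (seq t n)))
  (pointwise (im (Line.point R t)) t (λ n → imag (seq t n)))
  where
  open +-*-Solver
  real : ∀ a → ℚ.- ½ ℚ.+ (a ℚ.* 0ℚ ℚ.+ ℚ.- (0ℚ ℚ.* 1ℚ)) ≡ ℚ.- ½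
  real = solve 1 (λ a → con (ℚ.- ½) :+ (a :* con 0ℚ :+ :- (con 0ℚ :* con 1ℚ))
                        := con (ℚ.- ½)) refl
  imag : ∀ a → 0ℚ ℚ.+ (a ℚ.* 1ℚ ℚ.+ 0ℚ ℚ.* 0ℚ) ≡ a
  imag = solve 1 (λ a → con 0ℚ :+ (a :* con 1ℚ :+ con 0ℚ :* con 0ℚ) := a) refl

------------------------------------------------------------------------
-- Ehrhart polynomials of subsets of ℝᵈ

Point : ℕ → Set
Point d = Vector ℝ d

infix 4 _≈ᵖ_

_≈ᵖ_ : ∀ {d} → Point d → Point d → Set
x ≈ᵖ y = ∀ k → x k ≈ y k

infixl 7 _·_

_·_ : ∀ {d} → ℝ → Point d → Point d
(c · x) k = c * x k

-ᵖ_ : ∀ {d} → Point d → Point d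
(-ᵖ x) k = - x k

sumᵖ : ∀ {d n} → Vector (Point d) n → Point d
sumᵖ v k = sum (λ i → v i k)

ConvexHull : ∀ {d} → (Point d → Set) → Point d → Set
ConvexHull {d} S x =
  ∃[ n ] Σ (Vector (Point d) n) λ p → Σ (Vector ℝ n) λ c →
    (∀ i → S (p i)) ×
    (∀ i → 0ℝ ≤ c i) ×
    (sum c ≈ 1ℝ) ×
    (x ≈ᵖ sumᵖ (λ i → c i · p i))

Dilate : ∀ {d} → ℕ → (Point d → Set) → Point d → Set
Dilate s P x = ∃[ y ] P y × (x ≈ᵖ fromℤ (ℤ.+ s) · y)

fromℤᵈ : ∀ {d} → Vec ℤ d → Point d
fromℤᵈ v k = fromℤ (lookup v k)

HasCardinality : ∀ {A : Set} → (A → Set) → ℕ → Set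
HasCardinality {A} P N =
  Σ (List A) λ xs → Unique xs × (∀ x → (x ∈ xs) ⇔ P x) × (length xs ≡ N)

-- H(s) = |sP ∩ ℤᵈ| for every integer s ≥ 0.  A polynomial with these values
-- is unique and has rational coefficients, so it is sought in ℚ[x].
IsEhrhartPolynomial : ∀ {d} → (Point d → Set) → ℚ[x] → Set
IsEhrhartPolynomial P H = ∀ (s : ℕ) →
  ∃[ N ] HasCardinality (λ v → Dilate s P (fromℤᵈ v)) N ×
         (evalℚ H (ℤ.+ s ℚ./ 1) ≡ ℤ.+ N ℚ./ 1)

------------------------------------------------------------------------
-- The dual of the Stasheff polytope

e : ∀ {d} → Fin d → Point d
e i k = if ⌊ i ≟ k ⌋ then 1ℝ else 0ℝ

-- e i + ⋯ + e j
e[_⋯_] : ∀ {d} → Fin d → Fin d → Point d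
e[ i ⋯ j ] = sumᵖ (λ l → if ⌊ i ≤? l ⌋ ∧ ⌊ l ≤? j ⌋ then e l else (λ _ → 0ℝ))

StGenerator : ∀ d → Point d → Set
StGenerator d x =
  (∃[ i ] (x ≈ᵖ e i ⊎ x ≈ᵖ -ᵖ e i)) ⊎
  (∃[ i ] ∃[ j ] (i <ᶠ j × x ≈ᵖ e[ i ⋯ j ]))

St : ∀ d → Point d → Set
St d = ConvexHull (StGenerator d)

{-# OPTIONS --safe #-}
module Submission where

-- Read from left to right, a lattice point x of ℤᵈ has a cost, namely
-- Σ_{1≤i≤d+1} max(0, x_{i−1}, x_i) − Σ_{1≤i≤d} x_i with x_0 = x_{d+1} = 0.
-- It is convex and equals 1 on the generators, and x is a sum of cost-many
-- generators, so it is the gauge of the polytope and H_d(s) counts the x of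
-- cost at most s.  For the counts of paths starting at an arbitrary height h,
-- the diagonal differences are local; this gives a recurrence for their
-- Newton coefficients, hence a closed form for these, and from it the
-- three-term recurrence for H_d.
--
-- On the line, H_d(−½ + it) = iᵈ p_d(t) with p_d = a t p_{d−1} − b p_{d−2}
-- and a, b > 0.  As t grows the direction of (p_{d−1}, p_d) turns
-- monotonically, and the number of its half turns counts the zeros of p_d
-- below t.  Bisecting on this count at rational points yields the zeros as
-- Cauchy sequences; interlacing holds because the counts for p_d and p_{d+1}
-- differ by 0 or 1.  Two close points are at most half a turn apart by
-- the Christoffel–Darboux formula, so the zeros are uniformly separated and H_d
-- splits into linear factors over them.

-- Equality and order of reals are undecidable here, so no zero can be located by inspecting signs
-- at real points. This shapes the analytic half: all counting takes place at rational points, and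
-- factors are cancelled by means of an explicit rational lower bound on their modulus. The
-- separation of the zeros by a rational δ, uniform over a box, is what supplies these bounds.
-- Likewise a point is placed on the line by refuting that it keeps a positive distance from it. The
-- hypothesis on `H` gives values at natural numbers only. The recurrence, the degrees and the
-- values on the line are therefore all transferred from lattice point counts by the identity
-- theorem for polynomials. On the counting side the first entry of a point becomes the height from
-- which the remaining entries are read. A recursion on the dimension thus forces an arbitrary
-- starting height h, although only h = 0 matters in the end.

-- Newton series in two variables.

module NewtonSeries where

  open import Data.Nat
  open import Data.Nat.Combinatorics using (_C_; nC1≡n; nCn≡1; k>n⇒nCk≡0; nCk+nC[k+1]≡[n+1]C[k+1])
  open import Data.Nat.Properties
  open import Data.Nat.Tactic.RingSolver using (solve-∀)
  open import Data.Product using (_,_)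
  open import Relation.Binary.PropositionalEquality
  open import Relation.Nullary using (yes; no)

  -- newton s h n = Σⱼ Σₘ s(j,m) C(h,j) C(n,m).
  newton : (ℕ → ℕ → ℕ) → ℕ → ℕ → ℕ
  newton s zero    zero    = s 0 0
  newton s zero    (suc n) = newton s 0 n + newton (λ j m → s j (suc m)) 0 n
  newton s (suc h) n       = newton s h n + newton (λ j m → s (suc j) m) h n

  newton-cong : ∀ {s t} → (∀ j m → s j m ≡ t j m) → ∀ h n → newton s h n ≡ newton t h n
  newton-cong eq zero    zero    = eq 0 0
  newton-cong eq zero    (suc n) =
    cong₂ _+_ (newton-cong eq 0 n) (newton-cong (λ j m → eq j (suc m)) 0 n)
  newton-cong eq (suc h) n       =
    cong₂ _+_ (newton-cong eq h n) (newton-cong (λ j m → eq (suc j) m) h n)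

  private
    interchange : ∀ a b c d → (a + b) + (c + d) ≡ (a + c) + (b + d)
    interchange = solve-∀

  newton-+ : ∀ s t h n → newton (λ j m → s j m + t j m) h n ≡ newton s h n + newton t h n
  newton-+ s t zero    zero    = refl
  newton-+ s t zero    (suc n) =
    trans (cong₂ _+_ (newton-+ s t 0 n) (newton-+ _ _ 0 n)) (interchange (newton s 0 n) _ _ _)
  newton-+ s t (suc h) n       =
    trans (cong₂ _+_ (newton-+ s t h n) (newton-+ _ _ h n)) (interchange (newton s h n) _ _ _)

  newton-* : ∀ c s h n → newton (λ j m → c * s j m) h n ≡ c * newton s h n
  newton-* c s zero    zero    = refl
  newton-* c s zero    (suc n) =
    trans (cong₂ _+_ (newton-* c s 0 n) (newton-* c _ 0 n)) (sym (*-distribˡ-+ c (newton s 0 n) _))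
  newton-* c s (suc h) n       =
    trans (cong₂ _+_ (newton-* c s h n) (newton-* c _ h n)) (sym (*-distribˡ-+ c (newton s h n) _))

  newton-0 : ∀ h n → newton (λ _ _ → 0) h n ≡ 0
  newton-0 zero    zero    = refl
  newton-0 zero    (suc n) = cong₂ _+_ (newton-0 0 n) (newton-0 0 n)
  newton-0 (suc h) n       = cong₂ _+_ (newton-0 h n) (newton-0 h n)

  newton-sucʳ : ∀ s h n → newton s h (suc n) ≡ newton s h n + newton (λ j m → s j (suc m)) h n
  newton-sucʳ s zero    n = refl
  newton-sucʳ s (suc h) n =
    trans (cong₂ _+_ (newton-sucʳ s h n) (newton-sucʳ _ h n)) (interchange (newton s h n) _ _ _)

  -- C(0,j) vanishes for j > 0, so at height 0 only the row j = 0 of the coefficients enters.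
  -- Statements about counts from height 0 thus reduce to that row.
  newton-first : ∀ {s t} → (∀ m → s 0 m ≡ t 0 m) → ∀ n → newton s 0 n ≡ newton t 0 n
  newton-first eq zero    = eq 0
  newton-first eq (suc n) = cong₂ _+_ (newton-first eq n) (newton-first (λ m → eq (suc m)) n)

  -- Multiplication by n, on coefficients: n C(n,m) = m C(n,m) + (m+1) C(n,m+1).
  times : (ℕ → ℕ → ℕ) → ℕ → ℕ → ℕ
  times s j m = m * s j m + m * s j (pred m)

  times-newton : ∀ s n → n * newton s 0 n ≡ newton (times s) 0 n
  times-newton s zero    = refl
  times-newton s (suc n) = begin
    suc n * (newton s 0 n + newton s⁺ 0 n)
      ≡⟨ expand n (newton s 0 n) (newton s⁺ 0 n) ⟩
    n * newton s 0 n + ((n * newton s⁺ 0 n + newton s⁺ 0 n) + newton s 0 n)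
      ≡⟨ cong₂ (λ a b → a + ((b + newton s⁺ 0 n) + newton s 0 n)) (times-newton s n) (times-newton s⁺ n) ⟩
    newton (times s) 0 n + ((newton (times s⁺) 0 n + newton s⁺ 0 n) + newton s 0 n)
      ≡⟨ cong (newton (times s) 0 n +_) (sym (trans (newton-cong shift 0 n)
           (trans (newton-+ (λ j m → times s⁺ j m + s⁺ j m) s 0 n)
                  (cong (_+ newton s 0 n) (newton-+ (times s⁺) s⁺ 0 n))))) ⟩
    newton (times s) 0 n + newton (λ j m → times s j (suc m)) 0 n ∎
    where
    open ≡-Reasoning
    s⁺ : ℕ → ℕ → ℕ
    s⁺ j m = s j (suc m)
    expand : ∀ n a b → suc n * (a + b) ≡ n * a + ((n * b + b) + a)
    expand = solve-∀
    shift : ∀ j m → times s j (suc m) ≡ (times s⁺ j m + s⁺ j m) + s j m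
    shift j zero    = lem (s j 1) (s j 0)
      where
      lem : ∀ a b → 1 * a + 1 * b ≡ (0 * a + 0 * a + a) + b
      lem = solve-∀
    shift j (suc m) = lem m (s j (suc (suc m))) (s j (suc m))
      where
      lem : ∀ m a b → suc (suc m) * a + suc (suc m) * b ≡ (suc m * a + suc m * b + a) + b
      lem = solve-∀

  -- Counts from a given height and the recurrence of their Newton coefficients.

  mutual
    -- The number of x ∈ ℤᵈ of cost at most n from height h; neg, down and up
    -- collect the x whose first entry is negative, in [0, h], and above h.
    count : ℕ → ℕ → ℕ → ℕ
    count zero    h n = 1
    count (suc d) h n = neg d n + (down d h n + up d h n)

    neg : ℕ → ℕ → ℕ
    neg d zero    = 0
    neg d (suc n) = neg d n + count d 0 n

    down : ℕ → ℕ → ℕ → ℕ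
    down d zero    n = count d 0 n
    down d (suc h) n = down d h n + count d (suc h) n

    up : ℕ → ℕ → ℕ → ℕ
    up d h zero    = 0
    up d h (suc n) = count d (suc h) n + up d (suc h) n

  -- Summing over the entries 0, ..., h turns C(h,j) into C(h+1,j+1) = C(h,j) + C(h,j+1), which
  -- gives `downWeight`. After a negative entry reading continues at height 0, so this contribution,
  -- `axisWeight`, is constant in h. `nextWeight` solves the relation Δₙ F = Δₕ F + axis + Δₙ down,
  -- one column m after the other.
  downWeight axisWeight nextWeight : (ℕ → ℕ → ℕ) → ℕ → ℕ → ℕ
  downWeight s zero    m = s 0 m
  downWeight s (suc j) m = s j m + s (suc j) m
  axisWeight s zero    m = s 0 m
  axisWeight s (suc j) m = 0
  nextWeight s j zero    = downWeight s j 0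
  nextWeight s j (suc m) = nextWeight s (suc j) m + (axisWeight s j m + downWeight s j (suc m))

  weight : ℕ → ℕ → ℕ → ℕ
  weight zero    zero    zero    = 1
  weight zero    zero    (suc m) = 0
  weight zero    (suc j) m       = 0
  weight (suc d)                 = nextWeight (weight d)

  newton-axis : ∀ s h n → newton (axisWeight s) h n ≡ newton s 0 n
  newton-axis s zero    n = newton-first (λ _ → refl) n
  newton-axis s (suc h) n =
    trans (cong₂ _+_ (newton-axis s h n) (newton-0 h n)) (+-identityʳ _)

  module _ (d : ℕ) (s : ℕ → ℕ → ℕ) (count≡ : ∀ h n → count d h n ≡ newton s h n) where

    down≡newton : ∀ h n → down d h n ≡ newton (downWeight s) h n
    down≡newton zero    n = trans (count≡ 0 n) (newton-first (λ _ → refl) n)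
    down≡newton (suc h) n = cong₂ _+_ (down≡newton h n)
      (trans (count≡ (suc h) n) (sym (newton-+ s (λ j m → s (suc j) m) h n)))

    -- The diagonal difference removes the sums over the first entry.
    count-diagonal : ∀ h n → count (suc d) h (suc n) ≡
      count (suc d) (suc h) n + (newton (axisWeight s) h n + newton (λ j m → downWeight s j (suc m)) h n)
    count-diagonal h n = begin
      (neg d n + count d 0 n) + (down d h (suc n) + (count d (suc h) n + up d (suc h) n))
        ≡⟨ cong₂ (λ a b → (neg d n + a) + (b + (count d (suc h) n + up d (suc h) n)))
             (trans (count≡ 0 n) (sym (newton-axis s h n)))
             (trans (down≡newton h (suc n)) (trans (newton-sucʳ (downWeight s) h n)
               (cong (_+ newton (λ j m → downWeight s j (suc m)) h n) (sym (down≡newton h n))))) ⟩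
      (neg d n + A) + ((down d h n + D) + (count d (suc h) n + up d (suc h) n))
        ≡⟨ regroup (neg d n) A (down d h n) D (count d (suc h) n) (up d (suc h) n) ⟩
      count (suc d) (suc h) n + (A + D) ∎
      where
      open ≡-Reasoning
      A = newton (axisWeight s) h n
      D = newton (λ j m → downWeight s j (suc m)) h n
      regroup : ∀ a b c d e f → (a + b) + ((c + d) + (e + f)) ≡ (a + ((c + e) + f)) + (b + d)
      regroup = solve-∀

    -- Induction on n for all h at once, because the diagonal relation lowers n while it raises h.
    count-step : ∀ h n → count (suc d) h n ≡ newton (nextWeight s) h n
    count-step h zero    = trans (+-identityʳ (down d h 0)) (trans (down≡newton h 0) (base h (λ _ → refl)))
      where
      -- At n = 0 only the column m = 0 enters, and there `nextWeight` is `downWeight`.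
      base : ∀ h {s t} → (∀ j → s j 0 ≡ t j 0) → newton s h 0 ≡ newton t h 0
      base zero    eq = eq 0
      base (suc h) eq = cong₂ _+_ (base h eq) (base h (λ j → eq (suc j)))
    count-step h (suc n) = begin
      count (suc d) h (suc n)
        ≡⟨ count-diagonal h n ⟩
      count (suc d) (suc h) n + (A + D)
        ≡⟨ cong (_+ (A + D)) (count-step (suc h) n) ⟩
      (newton (nextWeight s) h n + newton (λ j m → nextWeight s (suc j) m) h n) + (A + D)
        ≡⟨ +-assoc (newton (nextWeight s) h n) _ _ ⟩
      newton (nextWeight s) h n + (newton (λ j m → nextWeight s (suc j) m) h n + (A + D))
        ≡⟨ cong (newton (nextWeight s) h n +_) (sym (trans
             (newton-+ (λ j m → nextWeight s (suc j) m) (λ j m → axisWeight s j m + downWeight s j (suc m)) h n)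
             (cong (newton (λ j m → nextWeight s (suc j) m) h n +_)
               (newton-+ (axisWeight s) (λ j m → downWeight s j (suc m)) h n)))) ⟩
      newton (nextWeight s) h n + newton (λ j m → nextWeight s j (suc m)) h n
        ≡⟨ newton-sucʳ (nextWeight s) h n ⟨
      newton (nextWeight s) h (suc n) ∎
      where
      open ≡-Reasoning
      A = newton (axisWeight s) h n
      D = newton (λ j m → downWeight s j (suc m)) h n

  count≡newton : ∀ d h n → count d h n ≡ newton (weight d) h n
  count≡newton zero    h n = sym (one h n)
    where
    first : ∀ n → newton (weight 0) 0 n ≡ 1
    first zero    = refl
    first (suc n) = cong₂ _+_ (first n) (trans (newton-first {t = λ _ _ → 0} (λ _ → refl) n) (newton-0 0 n))
    one : ∀ h n → newton (weight 0) h n ≡ 1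
    one zero    n = first n
    one (suc h) n = cong₂ _+_ (one h n) (newton-0 h n)
  count≡newton (suc d) h n = count-step d (weight d) (count≡newton d) h n

  -- Closed form of the Newton coefficients.

  C-pascal : ∀ n k → suc n C suc k ≡ n C k + n C suc k
  C-pascal n k = sym (nCk+nC[k+1]≡[n+1]C[k+1] n k)

  C-absorb : ∀ n k → suc k * (suc n C suc k) ≡ suc n * (n C k)
  C-absorb zero    zero    = refl
  C-absorb zero    (suc k) = trans (cong (suc (suc k) *_) (k>n⇒nCk≡0 {1} {suc (suc k)} (s≤s (s≤s z≤n))))
    (trans (*-zeroʳ (suc (suc k))) (sym (cong (1 *_) (k>n⇒nCk≡0 {0} {suc k} (s≤s z≤n)))))
  C-absorb (suc n) zero    = trans (cong (1 *_) (nC1≡n (suc (suc n))))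
    (trans (*-identityˡ _) (sym (*-identityʳ _)))
  C-absorb (suc n) (suc k) = begin
    suc (suc k) * (suc (suc n) C suc (suc k))
      ≡⟨ cong (suc (suc k) *_) (C-pascal (suc n) (suc k)) ⟩
    suc (suc k) * (a + suc n C suc (suc k))
      ≡⟨ expand k a _ ⟩
    (suc k * a + a) + suc (suc k) * (suc n C suc (suc k))
      ≡⟨ cong₂ (λ x y → (x + a) + y) (C-absorb n k) (C-absorb n (suc k)) ⟩
    (suc n * (n C k) + a) + suc n * (n C suc k)
      ≡⟨ collect n (n C k) (n C suc k) a ⟩
    suc n * (n C k + n C suc k) + a
      ≡⟨ cong (λ x → suc n * x + a) (sym (C-pascal n k)) ⟩
    suc n * a + a
      ≡⟨ +-comm (suc n * a) a ⟩
    suc (suc n) * a ∎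
    where
    open ≡-Reasoning
    a = suc n C suc k
    expand : ∀ k a b → suc (suc k) * (a + b) ≡ (suc k * a + a) + suc (suc k) * b
    expand = solve-∀
    collect : ∀ n x y a → (suc n * x + a) + suc n * y ≡ suc n * (x + y) + a
    collect = solve-∀

  -- (k+1) C(n,k+1) = (n-k) C(n,k), without the subtraction.
  C-next : ∀ n k → suc k * (n C suc k) + k * (n C k) ≡ n * (n C k)
  C-next n k = +-cancelʳ-≡ (n C k) _ _ (begin
    (suc k * (n C suc k) + k * (n C k)) + n C k
      ≡⟨ collect k (n C k) (n C suc k) ⟩
    suc k * (n C k + n C suc k)
      ≡⟨ cong (suc k *_) (sym (C-pascal n k)) ⟩
    suc k * (suc n C suc k)
      ≡⟨ C-absorb n k ⟩
    suc n * (n C k)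
      ≡⟨ +-comm (n C k) (n * (n C k)) ⟩
    n * (n C k) + n C k ∎)
    where
    open ≡-Reasoning
    collect : ∀ k a b → (suc k * b + k * a) + a ≡ suc k * (a + b)
    collect = solve-∀

  C-next′ : ∀ k i → suc k * ((k + i) C suc k) ≡ i * ((k + i) C k)
  C-next′ k i = +-cancelʳ-≡ (k * ((k + i) C k)) _ _
    (trans (C-next (k + i) k) (trans (*-distribʳ-+ ((k + i) C k) k i) (+-comm (k * _) _)))

  -- `IsClosed` equates this with (d+1)(d+2) times the coefficient, which avoids division in ℕ. In
  -- the row j = 0 the linear factor is d+m+2 and can be absorbed into the second binomial, which
  -- leaves a product of two binomials.
  closed : ℕ → ℕ → ℕ → ℕ
  closed d j m = (suc d C suc (j + m)) * (suc (d + m) C suc d) * (suc j * suc d + suc (j + m))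

  IsClosed : ℕ → (ℕ → ℕ → ℕ) → Set
  IsClosed d s = ∀ j m → suc d * (2 + d) * s j m ≡ closed d j m

  module _ (d : ℕ) (s : ℕ → ℕ → ℕ) (s≡ : IsClosed d s) where

    open ≡-Reasoning

    private
      split : ∀ a b c e → a * (b * (c + e)) ≡ a * b * c + a * b * e
      split = solve-∀

      C-step : ∀ m → (2 + d) * ((2 + d + m) C (2 + d)) ≡ suc m * ((2 + d + m) C suc d)
      C-step m = subst (λ a → (2 + d) * (a C (2 + d)) ≡ suc m * (a C suc d))
        (cong suc (+-suc d m)) (C-next′ (suc d) (suc m))

    -- This is the starting column m = 0 of `nextWeight`. The two neighbouring closed forms combine
    -- through `C-next`, and `C-absorb` leaves a single binomial.
    downWeight-closed : ∀ j → (2 + d) * downWeight s j 0 ≡ suc j * ((2 + d) C suc j)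
    downWeight-closed zero    = *-cancelˡ-≡ _ _ (suc d) (begin
      suc d * ((2 + d) * s 0 0)
        ≡⟨ *-assoc (suc d) (2 + d) (s 0 0) ⟨
      suc d * (2 + d) * s 0 0
        ≡⟨ s≡ 0 0 ⟩
      (suc d C 1) * (suc (d + 0) C suc d) * (1 * suc d + 1)
        ≡⟨ cong₂ (λ x y → x * y * (1 * suc d + 1)) (nC1≡n (suc d))
             (trans (cong (λ x → suc x C suc d) (+-identityʳ d)) (nCn≡1 (suc d))) ⟩
      suc d * 1 * (1 * suc d + 1)
        ≡⟨ lem d ⟩
      suc d * (1 * (2 + d))
        ≡⟨ cong (λ x → suc d * (1 * x)) (sym (nC1≡n (2 + d))) ⟩
      suc d * (1 * ((2 + d) C 1)) ∎)
      where
      lem : ∀ d → suc d * 1 * (1 * suc d + 1) ≡ suc d * (1 * (2 + d))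
      lem = solve-∀
    downWeight-closed (suc j) = *-cancelˡ-≡ _ _ (suc d) (begin
      suc d * ((2 + d) * (s j 0 + s (suc j) 0))
        ≡⟨ split (suc d) (2 + d) (s j 0) (s (suc j) 0) ⟩
      suc d * (2 + d) * s j 0 + suc d * (2 + d) * s (suc j) 0
        ≡⟨ cong₂ _+_ (s≡ j 0) (s≡ (suc j) 0) ⟩
      closed d j 0 + closed d (suc j) 0
        ≡⟨ cong₂ _+_ (at0 j) (at0 (suc j)) ⟩
      x * (suc j * suc d + suc j) + y * (suc (suc j) * suc d + suc (suc j))
        ≡⟨ collect d j x y ⟩
      (2 + d) * ((2 + j) * y + suc j * x)
        ≡⟨ cong ((2 + d) *_) (C-next (suc d) (suc j)) ⟩
      (2 + d) * (suc d * x)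
        ≡⟨ swap (2 + d) (suc d) x ⟩
      suc d * ((2 + d) * x)
        ≡⟨ cong (suc d *_) (sym (C-absorb (suc d) (suc j))) ⟩
      suc d * ((2 + j) * ((2 + d) C (2 + j))) ∎)
      where
      x = suc d C suc j
      y = suc d C suc (suc j)
      at0 : ∀ j → closed d j 0 ≡ (suc d C suc j) * (suc j * suc d + suc j)
      at0 j = trans (cong₂ (λ a b → (suc d C suc a) * (suc b C suc d) * (suc j * suc d + suc a))
                (+-identityʳ j) (+-identityʳ d))
              (trans (cong (λ a → (suc d C suc j) * a * (suc j * suc d + suc j)) (nCn≡1 (suc d)))
                     (cong (_* (suc j * suc d + suc j)) (*-identityʳ (suc d C suc j))))
      collect : ∀ d j x y → x * (suc j * suc d + suc j) + y * (suc (suc j) * suc d + suc (suc j))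
                            ≡ (2 + d) * ((2 + j) * y + suc j * x)
      collect = solve-∀
      swap : ∀ a b c → a * (b * c) ≡ b * (a * c)
      swap = solve-∀

    -- The inhomogeneous term in the recursion for `nextWeight`. For j > 0 it is the sum of the
    -- coefficients at j - 1 and j in column m + 1; for j = 0 the axis term takes the place of the
    -- missing one.
    sum-closed : ∀ j m → (2 + d) * (axisWeight s j m + downWeight s j (suc m))
                         ≡ suc j * ((2 + d + m) C suc d) * ((2 + d) C (2 + (j + m)))
    sum-closed j m = *-cancelˡ-≡ _ _ (suc d) (begin
      suc d * ((2 + d) * (axisWeight s j m + downWeight s j (suc m)))
        ≡⟨ pair j ⟩
      P * B * (j * suc d + K) + Q * B * (suc j * suc d + suc K)
        ≡⟨ collect P Q B (suc d) j K ⟩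
      B * ((P + Q) * (j * suc d) + (Q * suc d + (suc K * Q + K * P)))
        ≡⟨ cong (λ a → B * ((P + Q) * (j * suc d) + (Q * suc d + a))) (C-next (suc d) K) ⟩
      B * ((P + Q) * (j * suc d) + (Q * suc d + suc d * P))
        ≡⟨ collect′ P Q B (suc d) j ⟩
      suc d * (suc j * B * (P + Q))
        ≡⟨ cong (λ a → suc d * (suc j * B * a)) (sym (C-pascal (suc d) K)) ⟩
      suc d * (suc j * B * ((2 + d) C suc K)) ∎)
      where
      K = suc (j + m)
      P = suc d C K
      Q = suc d C suc K
      B = (2 + d + m) C suc d
      B≡ : ∀ m → suc (d + suc m) C suc d ≡ (2 + d + m) C suc d
      B≡ m = cong (λ a → suc a C suc d) (+-suc d m)
      collect : ∀ P Q B D j K → P * B * (j * D + K) + Q * B * (suc j * D + suc K)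
                ≡ B * ((P + Q) * (j * D) + (Q * D + (suc K * Q + K * P)))
      collect = solve-∀
      collect′ : ∀ P Q B D j → B * ((P + Q) * (j * D) + (Q * D + D * P)) ≡ D * (suc j * B * (P + Q))
      collect′ = solve-∀
      second : ∀ j → closed d j (suc m) ≡ (suc d C suc (suc (j + m))) * ((2 + d + m) C suc d) * (suc j * suc d + suc (suc (j + m)))
      second j = cong₂ (λ a b → (suc d C suc a) * b * (suc j * suc d + suc a)) (+-suc j m) (B≡ m)
      pair : ∀ j → suc d * ((2 + d) * (axisWeight s j m + downWeight s j (suc m)))
        ≡ (suc d C suc (j + m)) * B * (j * suc d + suc (j + m)) +
          (suc d C suc (suc (j + m))) * B * (suc j * suc d + suc (suc (j + m)))
      pair zero    = trans (split (suc d) (2 + d) (s 0 m) (s 0 (suc m)))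
        (cong₂ _+_ (trans (s≡ 0 m) first) (trans (s≡ 0 (suc m)) (second 0)))
        where
        -- The boundary term is the value of the closed form at j = −1.
        first : closed d 0 m ≡ (suc d C suc m) * B * suc m
        first = begin
          (suc d C suc m) * (suc (d + m) C suc d) * (1 * suc d + suc m)
            ≡⟨ shuffle (suc d C suc m) (suc (d + m) C suc d) d m ⟩
          (suc d C suc m) * ((2 + d + m) * (suc (d + m) C suc d))
            ≡⟨ cong ((suc d C suc m) *_) absorb ⟩
          (suc d C suc m) * (suc m * B)
            ≡⟨ reorder (suc d C suc m) (suc m) B ⟩
          (suc d C suc m) * B * suc m ∎
          where
          shuffle : ∀ a b d m → a * b * (1 * suc d + suc m) ≡ a * ((2 + d + m) * b)
          shuffle = solve-∀
          reorder : ∀ a b c → a * (b * c) ≡ a * c * b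
          reorder = solve-∀
          absorb : (2 + d + m) * (suc (d + m) C suc d) ≡ suc m * B
          absorb = trans (sym (C-absorb (suc (d + m)) (suc d))) (C-step m)
      pair (suc j) = trans (split (suc d) (2 + d) (s j (suc m)) (s (suc j) (suc m)))
        (cong₂ _+_ (trans (s≡ j (suc m)) (second j)) (trans (s≡ (suc j) (suc m)) (second (suc j))))

    nextWeight-closed : IsClosed (suc d) (nextWeight s)
    nextWeight-closed j zero    = begin
      (2 + d) * (3 + d) * downWeight s j 0
        ≡⟨ swap (2 + d) (3 + d) (downWeight s j 0) ⟩
      (3 + d) * ((2 + d) * downWeight s j 0)
        ≡⟨ cong ((3 + d) *_) (downWeight-closed j) ⟩
      (3 + d) * (suc j * ((2 + d) C suc j))
        ≡⟨ lem d j ((2 + d) C suc j) ⟩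
      ((2 + d) C suc j) * 1 * (suc j * (2 + d) + suc j)
        ≡⟨ cong (λ a → ((2 + d) C suc j) * a * (suc j * (2 + d) + suc j)) (sym (nCn≡1 (2 + d))) ⟩
      ((2 + d) C suc j) * ((2 + d) C (2 + d)) * (suc j * (2 + d) + suc j)
        ≡⟨ cong₂ (λ a b → ((2 + d) C suc a) * ((2 + b) C (2 + d)) * (suc j * (2 + d) + suc a))
             (sym (+-identityʳ j)) (sym (+-identityʳ d)) ⟩
      closed (suc d) j 0 ∎
      where
      swap : ∀ a b c → a * b * c ≡ b * (a * c)
      swap = solve-∀
      lem : ∀ d j c → (3 + d) * (suc j * c) ≡ c * 1 * (suc j * (2 + d) + suc j)
      lem = solve-∀
    nextWeight-closed j (suc m) = begin
      (2 + d) * (3 + d) * (nextWeight s (suc j) m + (axisWeight s j m + downWeight s j (suc m)))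
        ≡⟨ distribute (2 + d) (3 + d) (nextWeight s (suc j) m) (axisWeight s j m + downWeight s j (suc m)) ⟩
      (2 + d) * (3 + d) * nextWeight s (suc j) m + (3 + d) * ((2 + d) * (axisWeight s j m + downWeight s j (suc m)))
        ≡⟨ cong₂ (λ a b → a + (3 + d) * b) (nextWeight-closed (suc j) m) (sum-closed j m) ⟩
      S * B₂ * ((2 + j) * (2 + d) + (2 + (j + m))) + (3 + d) * (suc j * B₁ * S)
        ≡⟨ collect S B₁ B₂ d j m ⟩
      S * B₂ * (suc j * (2 + d) + (2 + (j + m))) + (S * ((2 + d) * B₂) + (3 + d) * (suc j * B₁ * S))
        -- Trading (d+2) B₂ for (m+1) B₁ gives B₁ and B₂ the same coefficient, so that Pascal's rule
        -- can merge them.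
        ≡⟨ cong (λ a → S * B₂ * (suc j * (2 + d) + (2 + (j + m))) + (S * a + (3 + d) * (suc j * B₁ * S))) B₂≡ ⟩
      S * B₂ * (suc j * (2 + d) + (2 + (j + m))) + (S * (suc m * B₁) + (3 + d) * (suc j * B₁ * S))
        ≡⟨ collect′ S B₁ B₂ d j m ⟩
      S * (B₁ + B₂) * (suc j * (2 + d) + (2 + (j + m)))
        ≡⟨ cong (λ a → S * a * (suc j * (2 + d) + (2 + (j + m)))) (sym (C-pascal (2 + d + m) (suc d))) ⟩
      S * ((3 + d + m) C (2 + d)) * (suc j * (2 + d) + (2 + (j + m)))
        ≡⟨ cong₂ (λ a b → ((2 + d) C suc a) * ((2 + b) C (2 + d)) * (suc j * (2 + d) + suc a))
             (sym (+-suc j m)) (sym (+-suc d m)) ⟩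
      closed (suc d) j (suc m) ∎
      where
      S = (2 + d) C (2 + (j + m))
      B₁ = (2 + d + m) C suc d
      B₂ = (2 + d + m) C (2 + d)
      B₂≡ : (2 + d) * B₂ ≡ suc m * B₁
      B₂≡ = C-step m
      distribute : ∀ a b x y → a * b * (x + y) ≡ a * b * x + b * (a * y)
      distribute = solve-∀
      collect : ∀ S B₁ B₂ d j m → S * B₂ * ((2 + j) * (2 + d) + (2 + (j + m))) + (3 + d) * (suc j * B₁ * S)
        ≡ S * B₂ * (suc j * (2 + d) + (2 + (j + m))) + (S * ((2 + d) * B₂) + (3 + d) * (suc j * B₁ * S))
      collect = solve-∀
      collect′ : ∀ S B₁ B₂ d j m →
        S * B₂ * (suc j * (2 + d) + (2 + (j + m))) + (S * (suc m * B₁) + (3 + d) * (suc j * B₁ * S))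
        ≡ S * (B₁ + B₂) * (suc j * (2 + d) + (2 + (j + m)))
      collect′ = solve-∀

  weight-closed : ∀ d → IsClosed d (weight d)
  weight-closed zero    zero    zero    = refl
  weight-closed zero    zero    (suc m) =
    sym (cong (λ a → a * (suc m C 1) * (1 * 1 + suc (suc m))) (k>n⇒nCk≡0 {1} {suc (suc m)} (s≤s (s≤s z≤n))))
  weight-closed zero    (suc j) m       =
    sym (cong (λ a → a * (suc m C 1) * (suc (suc j) * 1 + suc (suc (j + m))))
      (k>n⇒nCk≡0 {1} {suc (suc (j + m))} (s≤s (s≤s z≤n))))
  weight-closed (suc d)                 = nextWeight-closed d (weight d) (weight-closed d)

  -- So `weight d 0 k` is the Kirkman-Cayley number C(d,k) C(d+k+2,k) / (k+1), which counts the
  -- dissections of a (d+3)-gon by k diagonals, that is, the faces with k vertices of the dual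
  -- associahedron.
  weight₀-closed : ∀ d k → suc d * weight d 0 k ≡ (suc d C suc k) * ((2 + d + k) C (2 + d))
  weight₀-closed d k = *-cancelˡ-≡ _ _ (2 + d) (begin
    (2 + d) * (suc d * weight d 0 k)
      ≡⟨ swap (2 + d) (suc d) (weight d 0 k) ⟩
    suc d * (2 + d) * weight d 0 k
      ≡⟨ weight-closed d 0 k ⟩
    x * y * (1 * suc d + suc k)
      ≡⟨ shuffle x y d k ⟩
    x * (suc (suc (d + k)) * y)
      ≡⟨ cong (x *_) (sym (C-absorb (suc (d + k)) (suc d))) ⟩
    x * ((2 + d) * z)
      ≡⟨ swap′ x (2 + d) z ⟩
    (2 + d) * (x * z) ∎)
    where
    open ≡-Reasoning
    x = suc d C suc k
    y = suc (d + k) C suc d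
    z = (2 + d + k) C (2 + d)
    swap : ∀ a b c → a * (b * c) ≡ b * a * c
    swap = solve-∀
    swap′ : ∀ a b c → a * (b * c) ≡ b * (a * c)
    swap′ = solve-∀
    shuffle : ∀ x y d k → x * y * (1 * suc d + suc k) ≡ x * (suc (suc (d + k)) * y)
    shuffle = solve-∀

  -- The three-term recurrence of the counts.

  private
    -- What `weight-recurrence` becomes after a common binomial factor is split off. For k ≤ D put D
    -- = k + i: then (k+1) C(D,k+1) = i δ and (k+1)(k+2) C(D,k+2) = i (i-1) δ, and a polynomial
    -- identity in k and i remains. For k > D all binomials vanish.
    C-quadratic : ∀ D k → let δ = D C k in
      D * D * δ * (D + k + 2) * (D + k + 1) ≡
      (2 * D + 1) * ((2 * k + 1) * (suc k * (D C suc k)) * (D + k + 1) + 2 * k * k * suc k * δ)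
        + (D + 1) * (D + 1) * (suc k * ((2 + k) * (D C (2 + k))))
    C-quadratic D k with k ≤? D
    ... | no k≰D  = begin
      D * D * (D C k) * (D + k + 2) * (D + k + 1)
        ≡⟨ cong (λ a → D * D * a * (D + k + 2) * (D + k + 1)) δ≡0 ⟩
      D * D * 0 * (D + k + 2) * (D + k + 1)
        ≡⟨ vanish D k ⟩
      (2 * D + 1) * ((2 * k + 1) * (suc k * 0) * (D + k + 1) + 2 * k * k * suc k * 0)
        + (D + 1) * (D + 1) * (suc k * ((2 + k) * 0))
        ≡⟨ cong₂ (λ a (b , c) → (2 * D + 1) * ((2 * k + 1) * (suc k * b) * (D + k + 1) + 2 * k * k * suc k * a)
                         + (D + 1) * (D + 1) * (suc k * ((2 + k) * c)))
             (sym δ≡0) (cong₂ _,_ (sym (k>n⇒nCk≡0 (m<n⇒m<1+n (≰⇒> k≰D))))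
                                  (sym (k>n⇒nCk≡0 (m<n⇒m<1+n (m<n⇒m<1+n (≰⇒> k≰D)))))) ⟩
      _ ∎
      where
      open ≡-Reasoning
      δ≡0 : D C k ≡ 0
      δ≡0 = k>n⇒nCk≡0 (≰⇒> k≰D)
      vanish : ∀ D k → D * D * 0 * (D + k + 2) * (D + k + 1) ≡
        (2 * D + 1) * ((2 * k + 1) * (suc k * 0) * (D + k + 1) + 2 * k * k * suc k * 0)
        + (D + 1) * (D + 1) * (suc k * ((2 + k) * 0))
      vanish = solve-∀
    ... | yes k≤D with m≤n⇒∃[o]m+o≡n k≤D
    -- The product i (i-1) has no subtraction-free form in ℕ, so the missing multiple of i is added
    -- on both sides and cancelled at the end.
    ... | i , refl = +-cancelʳ-≡ ((D + 1) * (D + 1) * (i * δ)) _ _ (begin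
      D * D * δ * (D + k + 2) * (D + k + 1) + (D + 1) * (D + 1) * (i * δ)
        ≡⟨ lem k i δ ⟩
      (2 * D + 1) * ((2 * k + 1) * (i * δ) * (D + k + 1) + 2 * k * k * suc k * δ)
        + (D + 1) * (D + 1) * (i * (i * δ))
        ≡⟨ cong₂ (λ a b → (2 * D + 1) * ((2 * k + 1) * a * (D + k + 1) + 2 * k * k * suc k * δ)
                           + (D + 1) * (D + 1) * b) (sym A≡) (sym E≡) ⟩
      (2 * D + 1) * ((2 * k + 1) * A * (D + k + 1) + 2 * k * k * suc k * δ)
        + (D + 1) * (D + 1) * (suc k * ((2 + k) * c₂) + i * δ)
        ≡⟨ distrib _ ((D + 1) * (D + 1)) (suc k * ((2 + k) * c₂)) (i * δ) ⟩
      _ ∎)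
      where
      open ≡-Reasoning
      δ = D C k
      c₁ = D C suc k
      c₂ = D C (2 + k)
      A = suc k * c₁
      A≡ : A ≡ i * δ
      A≡ = C-next′ k i
      E≡ : suc k * ((2 + k) * c₂) + i * δ ≡ i * (i * δ)
      E≡ = +-cancelʳ-≡ (k * (i * δ)) _ _ (begin
        (suc k * ((2 + k) * c₂) + i * δ) + k * (i * δ)
          ≡⟨ cong (λ a → (suc k * ((2 + k) * c₂) + a) + k * a) (sym A≡) ⟩
        (suc k * ((2 + k) * c₂) + suc k * c₁) + k * (suc k * c₁)
          ≡⟨ l₁ k c₁ c₂ ⟩
        suc k * ((2 + k) * c₂ + suc k * c₁)
          ≡⟨ cong (suc k *_) (C-next D (suc k)) ⟩
        suc k * ((k + i) * c₁)
          ≡⟨ l₂ (suc k) k i c₁ ⟩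
        i * A + k * A
          ≡⟨ cong (λ a → i * a + k * a) A≡ ⟩
        i * (i * δ) + k * (i * δ) ∎)
        where
        l₁ : ∀ k c₁ c₂ → (suc k * ((2 + k) * c₂) + suc k * c₁) + k * (suc k * c₁) ≡ suc k * ((2 + k) * c₂ + suc k * c₁)
        l₁ = solve-∀
        l₂ : ∀ s k i c → s * ((k + i) * c) ≡ i * (s * c) + k * (s * c)
        l₂ = solve-∀
      lem : ∀ k i δ → let D = k + i in
        D * D * δ * (D + k + 2) * (D + k + 1) + (D + 1) * (D + 1) * (i * δ) ≡
        (2 * D + 1) * ((2 * k + 1) * (i * δ) * (D + k + 1) + 2 * k * k * suc k * δ)
        + (D + 1) * (D + 1) * (i * (i * δ))
      lem = solve-∀
      distrib : ∀ a b c e → a + b * (c + e) ≡ (a + b * c) + b * e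
      distrib = solve-∀

  -- On Newton coefficients, twice `times` plus the identity is multiplication by 2n + 1; it
  -- involves only the columns k and k - 1. The factor (k+1)(d+2)(d+3) supplies what absorption
  -- needs to bring all binomials to common ones.
  weight-recurrence : ∀ d k →
    (2 + d) * (4 + d) * weight (2 + d) 0 k ≡
    (5 + 2 * d) * (2 * times (weight (suc d)) 0 k + weight (suc d) 0 k) + suc d * (3 + d) * weight d 0 k
  weight-recurrence d k = *-cancelˡ-≡ _ _ (suc k * ((2 + d) * (3 + d))) (begin
    suc k * ((2 + d) * (3 + d)) * ((2 + d) * (4 + d) * a₂)
      ≡⟨ l₁ d k a₂ ⟩
    D * D * suc k * (4 + d) * ((3 + d) * a₂)
      ≡⟨ cong (D * D * suc k * (4 + d) *_) (weight₀-closed (2 + d) k) ⟩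
    D * D * suc k * (4 + d) * (((3 + d) C suc k) * ((4 + d + k) C (4 + d)))
      ≡⟨ l₂ D (suc k) (4 + d) ((3 + d) C suc k) ((4 + d + k) C (4 + d)) ⟩
    D * D * (suc k * ((3 + d) C suc k)) * ((4 + d) * ((4 + d + k) C (4 + d)))
      ≡⟨ cong₂ (λ a b → D * D * a * b) (C-absorb (2 + d) k) (C-absorb (3 + d + k) (3 + d)) ⟩
    D * D * ((3 + d) * δ) * ((4 + d + k) * f₁)
      ≡⟨ l₃ D δ (3 + d) (4 + d + k) f₁ ⟩
    D * D * δ * (4 + d + k) * ((3 + d) * f₁)
      ≡⟨ cong (D * D * δ * (4 + d + k) *_) (C-absorb (2 + d + k) (2 + d)) ⟩
    D * D * δ * (4 + d + k) * ((3 + d + k) * f₀)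
      ≡⟨ l₄ d k δ f₀ ⟩
    D * D * δ * (D + k + 2) * (D + k + 1) * f₀
      ≡⟨ cong (_* f₀) (C-quadratic D k) ⟩
    ((2 * D + 1) * ((2 * k + 1) * (suc k * c₁) * (D + k + 1) + 2 * k * k * suc k * δ)
        + (D + 1) * (D + 1) * (suc k * ((2 + k) * c₂))) * f₀
      ≡⟨ cong (λ a → ((2 * D + 1) * ((2 * k + 1) * (suc k * c₁) * (D + k + 1) + 2 * k * k * suc k * δ)
        + (D + 1) * (D + 1) * (suc k * a)) * f₀) (C-absorb (suc d) (suc k)) ⟩
    ((2 * D + 1) * ((2 * k + 1) * (suc k * c₁) * (D + k + 1) + 2 * k * k * suc k * δ)
        + (D + 1) * (D + 1) * (suc k * (D * β))) * f₀
      ≡⟨ l₅ d k δ c₁ β f₀ ⟩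
    (5 + 2 * d) * suc k * ((2 * k + 1) * c₁ * ((3 + d + k) * f₀) + 2 * k * δ * (k * f₀))
        + D * (3 + d) * (3 + d) * suc k * (β * f₀)
      ≡⟨ cong₂ (λ a b → (5 + 2 * d) * suc k * ((2 * k + 1) * c₁ * a + 2 * k * δ * b) + D * (3 + d) * (3 + d) * suc k * (β * f₀))
           (sym (C-absorb (2 + d + k) (2 + d))) (sym (C-next′ (2 + d) k)) ⟩
    (5 + 2 * d) * suc k * ((2 * k + 1) * c₁ * ((3 + d) * f₁) + 2 * k * δ * ((3 + d) * g₁))
        + D * (3 + d) * (3 + d) * suc k * (β * f₀)
      ≡⟨ l₆ d k c₁ f₁ δ g₁ (β * f₀) ⟩
    (5 + 2 * d) * suc k * (3 + d) * ((2 * k + 1) * (c₁ * f₁) + 2 * (k * (δ * g₁)))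
        + D * (3 + d) * (3 + d) * suc k * (β * f₀)
      ≡⟨ cong₂ (λ a b → (5 + 2 * d) * suc k * (3 + d) * a + D * (3 + d) * (3 + d) * suc k * b)
           (cong₂ (λ a b → (2 * k + 1) * a + 2 * b) (sym (weight₀-closed (suc d) k)) (sym (previous k)))
           (sym (weight₀-closed d k)) ⟩
    (5 + 2 * d) * suc k * (3 + d) * ((2 * k + 1) * (D * a₁) + 2 * (k * (D * a₁⁻)))
        + D * (3 + d) * (3 + d) * suc k * (suc d * a₀)
      ≡⟨ l₇ d k a₁ a₁⁻ a₀ ⟩
    suc k * ((2 + d) * (3 + d)) *
      ((5 + 2 * d) * (2 * (k * a₁ + k * a₁⁻) + a₁) + suc d * (3 + d) * a₀) ∎)
    where
    open ≡-Reasoning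
    D = 2 + d
    a₀ = weight d 0 k
    a₁ = weight (suc d) 0 k
    a₁⁻ = weight (suc d) 0 (pred k)
    a₂ = weight (2 + d) 0 k
    δ = D C k
    c₁ = D C suc k
    c₂ = D C (2 + k)
    β = suc d C suc k
    f₀ = (2 + d + k) C (2 + d)
    f₁ = (3 + d + k) C (3 + d)
    g₁ = (2 + d + k) C (3 + d)
    previous : ∀ k → k * (D * weight (suc d) 0 (pred k)) ≡ k * ((D C k) * ((2 + d + k) C (3 + d)))
    previous zero    = refl
    previous (suc k) = cong (suc k *_) (trans (weight₀-closed (suc d) k)
      (cong (λ a → (D C suc k) * ((2 + a) C (3 + d))) (sym (+-suc d k))))
    l₁ : ∀ d k a → suc k * ((2 + d) * (3 + d)) * ((2 + d) * (4 + d) * a)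
         ≡ (2 + d) * (2 + d) * suc k * (4 + d) * ((3 + d) * a)
    l₁ = solve-∀
    l₂ : ∀ D k e x y → D * D * k * e * (x * y) ≡ D * D * (k * x) * (e * y)
    l₂ = solve-∀
    l₃ : ∀ D δ a b f → D * D * (a * δ) * (b * f) ≡ D * D * δ * b * (a * f)
    l₃ = solve-∀
    l₄ : ∀ d k δ f → (2 + d) * (2 + d) * δ * (4 + d + k) * ((3 + d + k) * f)
         ≡ (2 + d) * (2 + d) * δ * ((2 + d) + k + 2) * ((2 + d) + k + 1) * f
    l₄ = solve-∀
    l₅ : ∀ d k δ c β f →
      ((2 * (2 + d) + 1) * ((2 * k + 1) * (suc k * c) * ((2 + d) + k + 1) + 2 * k * k * suc k * δ)
        + ((2 + d) + 1) * ((2 + d) + 1) * (suc k * ((2 + d) * β))) * f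
      ≡ (5 + 2 * d) * suc k * ((2 * k + 1) * c * ((3 + d + k) * f) + 2 * k * δ * (k * f))
        + (2 + d) * (3 + d) * (3 + d) * suc k * (β * f)
    l₅ = solve-∀
    l₆ : ∀ d k c f δ g x →
      (5 + 2 * d) * suc k * ((2 * k + 1) * c * ((3 + d) * f) + 2 * k * δ * ((3 + d) * g))
        + (2 + d) * (3 + d) * (3 + d) * suc k * x
      ≡ (5 + 2 * d) * suc k * (3 + d) * ((2 * k + 1) * (c * f) + 2 * (k * (δ * g)))
        + (2 + d) * (3 + d) * (3 + d) * suc k * x
    l₆ = solve-∀
    l₇ : ∀ d k x y z →
      (5 + 2 * d) * suc k * (3 + d) * ((2 * k + 1) * ((2 + d) * x) + 2 * (k * ((2 + d) * y)))
        + (2 + d) * (3 + d) * (3 + d) * suc k * (suc d * z)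
      ≡ suc k * ((2 + d) * (3 + d)) *
        ((5 + 2 * d) * (2 * (k * x + k * y) + x) + suc d * (3 + d) * z)
    l₇ = solve-∀

  count-recurrence : ∀ d n →
    (2 + d) * (4 + d) * count (2 + d) 0 n ≡
    (5 + 2 * d) * ((2 * n + 1) * count (suc d) 0 n) + suc d * (3 + d) * count d 0 n
  count-recurrence d n = begin
    c₂ * count (2 + d) 0 n
      ≡⟨ cong (c₂ *_) (count≡newton (2 + d) 0 n) ⟩
    c₂ * newton (weight (2 + d)) 0 n
      ≡⟨ newton-* c₂ (weight (2 + d)) 0 n ⟨
    newton (λ j k → c₂ * weight (2 + d) j k) 0 n
      ≡⟨ newton-first (weight-recurrence d) n ⟩
    newton (λ j k → c₁ * (2 * times w₁ j k + w₁ j k) + c₀ * weight d j k) 0 n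
      ≡⟨ newton-+ (λ j k → c₁ * (2 * times w₁ j k + w₁ j k)) (λ j k → c₀ * weight d j k) 0 n ⟩
    newton (λ j k → c₁ * (2 * times w₁ j k + w₁ j k)) 0 n + newton (λ j k → c₀ * weight d j k) 0 n
      ≡⟨ cong₂ _+_ (newton-* c₁ (λ j k → 2 * times w₁ j k + w₁ j k) 0 n) (newton-* c₀ (weight d) 0 n) ⟩
    c₁ * newton (λ j k → 2 * times w₁ j k + w₁ j k) 0 n + c₀ * newton (weight d) 0 n
      ≡⟨ cong (λ a → c₁ * a + c₀ * newton (weight d) 0 n)
           (trans (newton-+ (λ j k → 2 * times w₁ j k) w₁ 0 n)
             (cong (_+ newton w₁ 0 n) (trans (newton-* 2 (times w₁) 0 n) (cong (2 *_) (sym (times-newton w₁ n)))))) ⟩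
    c₁ * (2 * (n * newton w₁ 0 n) + newton w₁ 0 n) + c₀ * newton (weight d) 0 n
      ≡⟨ cong (λ a → c₁ * a + c₀ * newton (weight d) 0 n) (lem n (newton w₁ 0 n)) ⟩
    c₁ * ((2 * n + 1) * newton w₁ 0 n) + c₀ * newton (weight d) 0 n
      ≡⟨ cong₂ (λ a b → c₁ * ((2 * n + 1) * a) + c₀ * b) (sym (count≡newton (suc d) 0 n)) (sym (count≡newton d 0 n)) ⟩
    c₁ * ((2 * n + 1) * count (suc d) 0 n) + c₀ * count d 0 n ∎
    where
    open ≡-Reasoning
    c₂ = (2 + d) * (4 + d)
    c₁ = 5 + 2 * d
    c₀ = suc d * (3 + d)
    w₁ = weight (suc d)
    lem : ∀ n a → 2 * (n * a) + a ≡ (2 * n + 1) * a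
    lem = solve-∀

  count-one : ∀ n → count 1 0 n ≡ 2 * n + 1
  count-one n = begin
    neg 0 n + (1 + up 0 0 n) ≡⟨ cong₂ (λ a b → a + (1 + b)) (neg≡ n) (up≡ 0 n) ⟩
    n + (1 + n)              ≡⟨ lem n ⟩
    2 * n + 1                ∎
    where
    open ≡-Reasoning
    neg≡ : ∀ n → neg 0 n ≡ n
    neg≡ zero    = refl
    neg≡ (suc n) = trans (+-comm (neg 0 n) 1) (cong suc (neg≡ n))
    up≡ : ∀ h n → up 0 h n ≡ n
    up≡ h zero    = refl
    up≡ h (suc n) = cong suc (up≡ (suc h) n)
    lem : ∀ n → n + (1 + n) ≡ 2 * n + 1
    lem = solve-∀

-- Enumeration of the lattice points of bounded cost.

module LatticePoints where

  open import Data.Empty using (⊥-elim)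
  open import Data.Integer.Base using (ℤ; +_; -[1+_])
  open import Data.List.Base using (List; []; _∷_; _++_; map; length)
  open import Data.List.Membership.Propositional using (_∈_)
  open import Data.List.Membership.Propositional.Properties using (∈-map⁺; ∈-map⁻; ∈-++⁺ˡ; ∈-++⁺ʳ; ∈-++⁻)
  open import Data.List.Membership.Propositional.Properties.WithK using (unique∧set⇒bag)
  open import Data.List.Properties using (length-++; length-map)
  open import Data.List.Relation.Binary.BagAndSetEquality using (∼bag⇒↭)
  open import Data.List.Relation.Binary.Permutation.Propositional.Properties using (↭-length)
  open import Data.List.Relation.Unary.All using ([])
  open import Data.List.Relation.Unary.AllPairs using ([]; _∷_)
  open import Data.List.Relation.Unary.Any using (here)
  open import Data.List.Relation.Unary.Unique.Propositional using (Unique)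
  open import Data.List.Relation.Unary.Unique.Propositional.Properties using (++⁺; map⁺)
  open import Data.Nat
  open import Data.Nat.Properties
  open import Data.Product using (∃₂; _×_; _,_)
  open import Data.Sum using (inj₁; inj₂)
  open import Data.Vec.Base using (Vec; []; _∷_)
  open import Data.Vec.Properties using (∷-injectiveʳ)
  open import Defs using (HasCardinality)
  open import Function.Bundles using (mk⇔)
  import Function.Properties.Equivalence as ⇔
  open import Relation.Binary.PropositionalEquality
  open import Relation.Nullary using (yes; no)
  open NewtonSeries

  -- Read from left to right, x climbs from height h to each entry, entries
  -- below zero being reached by an extra descent from height 0; the cost
  -- is the total climb plus the total extra descent.
  cost : ∀ {d} → ℕ → Vec ℤ d → ℕ
  cost h []               = 0
  cost h (+ x ∷ xs)       = (x ∸ h) + cost x xs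
  cost h (-[1+ k ] ∷ xs)  = suc k + cost 0 xs

  mutual
    -- The clauses mirror those of `count`, so the lengths agree by structural induction. The
    -- argument k of `negPoints` records how many units of descent are already paid for; the next
    -- possible head is -(k+1).
    points : ∀ d → ℕ → ℕ → List (Vec ℤ d)
    points zero    h n = [] ∷ []
    points (suc d) h n = negPoints d 0 n ++ (downPoints d h n ++ upPoints d h n)

    negPoints downPoints upPoints : ∀ d → ℕ → ℕ → List (Vec ℤ (suc d))
    negPoints d k zero    = []
    negPoints d k (suc n) = map (-[1+ k ] ∷_) (points d 0 n) ++ negPoints d (suc k) n
    downPoints d zero    n = map (+ 0 ∷_) (points d 0 n)
    downPoints d (suc h) n = downPoints d h n ++ map (+ suc h ∷_) (points d (suc h) n)
    upPoints d h zero    = []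
    upPoints d h (suc n) = map (+ suc h ∷_) (points d (suc h) n) ++ upPoints d (suc h) n

  mutual
    length-points : ∀ d h n → length (points d h n) ≡ count d h n
    length-points zero    h n = refl
    length-points (suc d) h n =
      trans (length-++ (negPoints d 0 n))
        (cong₂ _+_ (length-neg d 0 n)
          (trans (length-++ (downPoints d h n)) (cong₂ _+_ (length-down d h n) (length-up d h n))))

    length-neg : ∀ d k n → length (negPoints d k n) ≡ neg d n
    length-neg d k zero    = refl
    length-neg d k (suc n) = trans (length-++ (map (-[1+ k ] ∷_) (points d 0 n)))
      (trans (cong₂ _+_ (trans (length-map _ (points d 0 n)) (length-points d 0 n)) (length-neg d (suc k) n))
             (+-comm (count d 0 n) (neg d n)))

    length-down : ∀ d h n → length (downPoints d h n) ≡ down d h n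
    length-down d zero    n = trans (length-map _ (points d 0 n)) (length-points d 0 n)
    length-down d (suc h) n = trans (length-++ (downPoints d h n))
      (cong₂ _+_ (length-down d h n) (trans (length-map _ (points d (suc h) n)) (length-points d (suc h) n)))

    length-up : ∀ d h n → length (upPoints d h n) ≡ up d h n
    length-up d h zero    = refl
    length-up d h (suc n) = trans (length-++ (map (+ suc h ∷_) (points d (suc h) n)))
      (cong₂ _+_ (trans (length-map _ (points d (suc h) n)) (length-points d (suc h) n)) (length-up d (suc h) n))

  mutual
    points-sound : ∀ d h n {v} → v ∈ points d h n → cost h v ≤ n
    points-sound zero    h n (here refl) = z≤n
    points-sound (suc d) h n v∈ with ∈-++⁻ (negPoints d 0 n) v∈
    ... | inj₁ v∈neg with neg-sound d 0 n v∈neg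
    ... | i , xs , refl , c≤ rewrite +-identityʳ i = c≤
    points-sound (suc d) h n v∈ | inj₂ v∈rest with ∈-++⁻ (downPoints d h n) v∈rest
    ... | inj₁ v∈down with down-sound d h n v∈down
    ... | x , xs , refl , x≤h , c≤ rewrite m≤n⇒m∸n≡0 x≤h = c≤
    points-sound (suc d) h n v∈ | inj₂ v∈rest | inj₂ v∈up with up-sound d h n v∈up
    ... | i , xs , refl , c≤ rewrite m+n∸n≡m (suc i) h = c≤

    neg-sound : ∀ d k n {v} → v ∈ negPoints d k n →
      ∃₂ λ i xs → v ≡ -[1+ i + k ] ∷ xs × suc i + cost 0 xs ≤ n
    neg-sound d k (suc n) v∈ with ∈-++⁻ (map (-[1+ k ] ∷_) (points d 0 n)) v∈
    ... | inj₁ v∈map with ∈-map⁻ (-[1+ k ] ∷_) v∈map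
    ... | xs , xs∈ , refl = 0 , xs , refl , s≤s (points-sound d 0 n xs∈)
    neg-sound d k (suc n) v∈ | inj₂ v∈neg with neg-sound d (suc k) n v∈neg
    ... | i , xs , refl , c≤ = suc i , xs , cong (λ a → -[1+ a ] ∷ xs) (+-suc i k) , s≤s c≤

    down-sound : ∀ d h n {v} → v ∈ downPoints d h n →
      ∃₂ λ x xs → v ≡ + x ∷ xs × x ≤ h × cost x xs ≤ n
    down-sound d zero    n v∈ with ∈-map⁻ (+ 0 ∷_) v∈
    ... | xs , xs∈ , refl = 0 , xs , refl , z≤n , points-sound d 0 n xs∈
    down-sound d (suc h) n v∈ with ∈-++⁻ (downPoints d h n) v∈
    ... | inj₁ v∈down with down-sound d h n v∈down
    ... | x , xs , refl , x≤h , c≤ = x , xs , refl , m≤n⇒m≤1+n x≤h , c≤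
    down-sound d (suc h) n v∈ | inj₂ v∈map with ∈-map⁻ (+ suc h ∷_) v∈map
    ... | xs , xs∈ , refl = suc h , xs , refl , ≤-refl , points-sound d (suc h) n xs∈

    up-sound : ∀ d h n {v} → v ∈ upPoints d h n →
      ∃₂ λ i xs → v ≡ + (suc i + h) ∷ xs × suc i + cost (suc i + h) xs ≤ n
    up-sound d h (suc n) v∈ with ∈-++⁻ (map (+ suc h ∷_) (points d (suc h) n)) v∈
    ... | inj₁ v∈map with ∈-map⁻ (+ suc h ∷_) v∈map
    ... | xs , xs∈ , refl = 0 , xs , refl , s≤s (points-sound d (suc h) n xs∈)
    up-sound d h (suc n) v∈ | inj₂ v∈up with up-sound d (suc h) n v∈up
    ... | i , xs , refl , c≤ = suc i , xs , cong (λ a → + suc a ∷ xs) (+-suc i h)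
      , s≤s (subst (λ a → suc i + cost (suc a) xs ≤ n) (+-suc i h) c≤)

  mutual
    points-complete : ∀ d h n v → cost h v ≤ n → v ∈ points d h n
    points-complete zero    h n []              c≤ = here refl
    points-complete (suc d) h n (-[1+ k ] ∷ xs) c≤ = ∈-++⁺ˡ
      (subst (λ a → (-[1+ a ] ∷ xs) ∈ negPoints d 0 n) (+-identityʳ k) (neg-complete d 0 n k xs c≤))
    points-complete (suc d) h n (+ x ∷ xs)      c≤ with x ≤? h
    ... | yes x≤h = ∈-++⁺ʳ (negPoints d 0 n) (∈-++⁺ˡ (down-complete d h n x xs x≤h (m+n≤o⇒n≤o (x ∸ h) c≤)))
    ... | no  x≰h with m≤n⇒∃[o]m+o≡n (≰⇒> x≰h)
    ... | i , refl = ∈-++⁺ʳ (negPoints d 0 n) (∈-++⁺ʳ (downPoints d h n)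
      (subst (λ a → (+ suc a ∷ xs) ∈ upPoints d h n) (+-comm i h)
        (up-complete d h n i xs (subst (_≤ n)
          (cong₂ (λ a b → a + cost (suc b) xs)
            (trans (cong (_∸ h) (cong suc (+-comm h i))) (m+n∸n≡m (suc i) h)) (+-comm h i)) c≤))))

    neg-complete : ∀ d k n i xs → suc i + cost 0 xs ≤ n → (-[1+ i + k ] ∷ xs) ∈ negPoints d k n
    neg-complete d k (suc n) zero    xs (s≤s c≤) = ∈-++⁺ˡ (∈-map⁺ (-[1+ k ] ∷_) (points-complete d 0 n xs c≤))
    neg-complete d k (suc n) (suc i) xs (s≤s c≤) = ∈-++⁺ʳ (map (-[1+ k ] ∷_) (points d 0 n))
      (subst (λ a → (-[1+ a ] ∷ xs) ∈ negPoints d (suc k) n) (+-suc i k) (neg-complete d (suc k) n i xs c≤))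

    down-complete : ∀ d h n x xs → x ≤ h → cost x xs ≤ n → (+ x ∷ xs) ∈ downPoints d h n
    down-complete d zero    n .zero xs z≤n c≤ = ∈-map⁺ (+ 0 ∷_) (points-complete d 0 n xs c≤)
    down-complete d (suc h) n x xs x≤1+h c≤ with m≤n⇒m<n∨m≡n x≤1+h
    ... | inj₁ (s≤s x≤h) = ∈-++⁺ˡ (down-complete d h n x xs x≤h c≤)
    ... | inj₂ refl      = ∈-++⁺ʳ (downPoints d h n) (∈-map⁺ (+ suc h ∷_) (points-complete d (suc h) n xs c≤))

    up-complete : ∀ d h n i xs → suc i + cost (suc i + h) xs ≤ n → (+ (suc i + h) ∷ xs) ∈ upPoints d h n
    up-complete d h (suc n) zero    xs (s≤s c≤) = ∈-++⁺ˡ (∈-map⁺ (+ suc h ∷_) (points-complete d (suc h) n xs c≤))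
    up-complete d h (suc n) (suc i) xs (s≤s c≤) = ∈-++⁺ʳ (map (+ suc h ∷_) (points d (suc h) n))
      (subst (λ a → (+ suc a ∷ xs) ∈ upPoints d (suc h) n) (+-suc i h)
        (up-complete d (suc h) n i xs (subst (λ a → suc i + cost (suc a) xs ≤ n) (sym (+-suc i h)) c≤)))

  mutual
    points-unique : ∀ d h n → Unique (points d h n)
    points-unique zero    h n = [] ∷ []
    points-unique (suc d) h n = ++⁺ (neg-unique d 0 n)
      (++⁺ (down-unique d h n) (up-unique d h n) λ (v∈down , v∈up) → down#up v∈down v∈up)
      λ (v∈neg , v∈rest) → neg#rest v∈neg v∈rest
      where
      down#up : ∀ {v} → v ∈ downPoints d h n → v ∈ upPoints d h n → _
      down#up v∈down v∈up with down-sound d h n v∈down | up-sound d h n v∈up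
      ... | x , _ , refl , x≤h , _ | i , _ , refl , _ = ⊥-elim (<⇒≱ (s≤s (m≤n+m h i)) x≤h)
      neg#rest : ∀ {v} → v ∈ negPoints d 0 n → v ∈ downPoints d h n ++ upPoints d h n → _
      neg#rest v∈neg v∈rest with neg-sound d 0 n v∈neg | ∈-++⁻ (downPoints d h n) v∈rest
      ... | _ , _ , refl , _ | inj₁ v∈down with down-sound d h n v∈down
      ...   | _ , _ , () , _
      neg#rest v∈neg v∈rest | _ , _ , refl , _ | inj₂ v∈up with up-sound d h n v∈up
      ...   | _ , _ , () , _

    neg-unique : ∀ d k n → Unique (negPoints d k n)
    neg-unique d k zero    = []
    neg-unique d k (suc n) = ++⁺ (map⁺ ∷-injectiveʳ (points-unique d 0 n)) (neg-unique d (suc k) n)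
      λ (v∈map , v∈neg) → disjoint v∈map v∈neg
      where
      neg-head : ∀ {a b d} {xs ys : Vec ℤ d} → (-[1+ a ] ∷ xs) ≡ (-[1+ b ] ∷ ys) → a ≡ b
      neg-head refl = refl
      disjoint : ∀ {v} → v ∈ map (-[1+ k ] ∷_) (points d 0 n) → v ∈ negPoints d (suc k) n → _
      disjoint v∈map v∈neg with ∈-map⁻ (-[1+ k ] ∷_) v∈map | neg-sound d (suc k) n v∈neg
      ... | _ , _ , eq | i , _ , refl , _ = ⊥-elim (m≢1+n+m k (sym (trans (sym (+-suc i k)) (neg-head eq))))

    down-unique : ∀ d h n → Unique (downPoints d h n)
    down-unique d zero    n = map⁺ ∷-injectiveʳ (points-unique d 0 n)
    down-unique d (suc h) n = ++⁺ (down-unique d h n) (map⁺ ∷-injectiveʳ (points-unique d (suc h) n))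
      λ (v∈down , v∈map) → disjoint v∈down v∈map
      where
      disjoint : ∀ {v} → v ∈ downPoints d h n → v ∈ map (+ suc h ∷_) (points d (suc h) n) → _
      disjoint v∈down v∈map with down-sound d h n v∈down | ∈-map⁻ (+ suc h ∷_) v∈map
      ... | _ , _ , refl , x≤h , _ | _ , _ , refl = ⊥-elim (1+n≰n x≤h)

    up-unique : ∀ d h n → Unique (upPoints d h n)
    up-unique d h zero    = []
    up-unique d h (suc n) = ++⁺ (map⁺ ∷-injectiveʳ (points-unique d (suc h) n)) (up-unique d (suc h) n)
      λ (v∈map , v∈up) → disjoint v∈map v∈up
      where
      pos-head : ∀ {a b d} {xs ys : Vec ℤ d} → (+ a ∷ xs) ≡ (+ b ∷ ys) → a ≡ b
      pos-head refl = refl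
      disjoint : ∀ {v} → v ∈ map (+ suc h ∷_) (points d (suc h) n) → v ∈ upPoints d (suc h) n → _
      disjoint v∈map v∈up with ∈-map⁻ (+ suc h ∷_) v∈map | up-sound d (suc h) n v∈up
      ... | _ , _ , eq | i , _ , refl , _ = ⊥-elim (m≢1+n+m (suc h) (sym (pos-head eq)))

  -- Lists without repetition and with the same members are permutations of each other. This
  -- identifies the cardinality provided by the Ehrhart hypothesis with `count`.
  cardinality-unique : ∀ {A : Set} {P : A → Set} {m n} → HasCardinality P m → HasCardinality P n → m ≡ n
  cardinality-unique (xs , xs! , xs⇔P , refl) (ys , ys! , ys⇔P , refl) =
    ↭-length (∼bag⇒↭ (unique∧set⇒bag xs! ys! λ {x} → ⇔.trans (xs⇔P x) (⇔.sym (ys⇔P x))))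

  points-cardinality : ∀ d s → HasCardinality (λ (v : Vec ℤ d) → cost 0 v ≤ s) (count d 0 s)
  points-cardinality d s = points d 0 s , points-unique d 0 s
    , (λ v → mk⇔ (points-sound d 0 s) (points-complete d 0 s v)) , length-points d 0 s

-- Order of the rationals, embedded integers, and powers of one half.

module RationalOrder where

  open import Data.Integer.Base as ℤ using (ℤ; +_; -[1+_])
  import Data.Integer.Properties as ℤ
  open import Data.Integer.Tactic.RingSolver as ℤSolver using ()
  open import Data.Maybe.Base using (Maybe; just; nothing)
  open import Data.Nat.Base as ℕ using (ℕ; zero; suc)
  import Data.Nat.Properties as ℕ
  open import Data.Product using (∃; _,_; proj₁; proj₂)
  open import Data.Rational
  open import Data.Rational.Properties
  import Data.Rational.Unnormalised.Base as ℚᵘ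
  import Data.Rational.Unnormalised.Properties as ℚᵘ
  open import Data.Sum using (inj₁; inj₂)
  open import Level using (0ℓ)
  open import Relation.Binary.PropositionalEquality
  open import Relation.Nullary using (yes; no; ¬_)
  open import Tactic.RingSolver using (solve-∀)
  open import Tactic.RingSolver.Core.AlmostCommutativeRing using (AlmostCommutativeRing; fromCommutativeRing)

  ℚ-ring : AlmostCommutativeRing 0ℓ 0ℓ
  ℚ-ring = fromCommutativeRing +-*-commutativeRing isZero
    where
    isZero : ∀ q → Maybe (0ℚ ≡ q)
    isZero q with 0ℚ ≟ q
    ... | yes eq = just eq
    ... | no  _  = nothing


  <⇒≱ : ∀ {p q} → p < q → ¬ (q ≤ p)
  <⇒≱ p<q q≤p = <-irrefl refl (<-≤-trans p<q q≤p)

  neg-involutive : ∀ p → - (- p) ≡ p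
  neg-involutive = solve-∀ ℚ-ring

  *-monoˡ : ∀ {r p q} → 0ℚ ≤ r → p ≤ q → r * p ≤ r * q
  *-monoˡ {r} r≥0 = *-monoˡ-≤-nonNeg r {{nonNegative r≥0}}

  *-monoʳ : ∀ {r p q} → 0ℚ ≤ r → p ≤ q → p * r ≤ q * r
  *-monoʳ {r} r≥0 = *-monoʳ-≤-nonNeg r {{nonNegative r≥0}}

  nonNeg-* : ∀ {p q} → 0ℚ ≤ p → 0ℚ ≤ q → 0ℚ ≤ p * q
  nonNeg-* {p} {q} p≥0 q≥0 =
    subst (_≤ p * q) (*-zeroʳ p) (*-monoˡ p≥0 q≥0)

  pos-* : ∀ {p q} → 0ℚ < p → 0ℚ < q → 0ℚ < p * q
  pos-* {p} {q} p>0 q>0 =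
    subst (_< p * q) (*-zeroʳ p) (*-monoʳ-<-pos p {{positive p>0}} q>0)

  nonNeg-+ : ∀ {p q} → 0ℚ ≤ p → 0ℚ ≤ q → 0ℚ ≤ p + q
  nonNeg-+ = +-mono-≤

  ≤⇒0≤ : ∀ {p q} → p ≤ q → 0ℚ ≤ q - p
  ≤⇒0≤ {p} {q} p≤q = subst (_≤ q - p) (+-inverseʳ p) (+-monoˡ-≤ (- p) p≤q)

  <⇒0< : ∀ {p q} → p < q → 0ℚ < q - p
  <⇒0< {p} {q} p<q = subst (_< q - p) (+-inverseʳ p) (+-monoˡ-< (- p) p<q)

  private
    add-back : ∀ p q → (q - p) + p ≡ q
    add-back = solve-∀ ℚ-ring

  0≤⇒≤ : ∀ {p q r} → 0ℚ ≤ r → q - p ≡ r → p ≤ q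
  0≤⇒≤ {p} {q} r≥0 refl = subst₂ _≤_ (+-identityˡ p) (add-back p q) (+-monoˡ-≤ p r≥0)

  0<⇒< : ∀ {p q r} → 0ℚ < r → q - p ≡ r → p < q
  0<⇒< {p} {q} r>0 refl = subst₂ _<_ (+-identityˡ p) (add-back p q) (+-monoˡ-< p r>0)

  nonPos⇒0≤- : ∀ {p} → p ≤ 0ℚ → 0ℚ ≤ - p
  nonPos⇒0≤- = neg-antimono-≤

  sq-nonNeg : ∀ p → 0ℚ ≤ p * p
  sq-nonNeg p with ≤-total 0ℚ p
  ... | inj₁ p≥0 = nonNeg-* p≥0 p≥0
  ... | inj₂ p≤0 = subst (0ℚ ≤_) (lem p) (nonNeg-* (nonPos⇒0≤- p≤0) (nonPos⇒0≤- p≤0))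
    where
    lem : ∀ p → (- p) * (- p) ≡ p * p
    lem = solve-∀ ℚ-ring

  p≤∣p∣ : ∀ p → p ≤ ∣ p ∣
  p≤∣p∣ p with ≤-total 0ℚ p
  ... | inj₁ p≥0 = ≤-reflexive (sym (0≤p⇒∣p∣≡p p≥0))
  ... | inj₂ p≤0 = ≤-trans p≤0 (0≤∣p∣ p)

  ∣p∣≤ : ∀ {p b} → p ≤ b → - p ≤ b → ∣ p ∣ ≤ b
  ∣p∣≤ {p} {b} p≤b -p≤b with ∣p∣≡p∨∣p∣≡-p p
  ... | inj₁ eq = subst (_≤ b) (sym eq) p≤b
  ... | inj₂ eq = subst (_≤ b) (sym eq) -p≤b

  ∣p∣< : ∀ {p b} → p < b → - p < b → ∣ p ∣ < b
  ∣p∣< {p} {b} p<b -p<b with ∣p∣≡p∨∣p∣≡-p p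
  ... | inj₁ eq = subst (_< b) (sym eq) p<b
  ... | inj₂ eq = subst (_< b) (sym eq) -p<b

  ∣-∣-comm : ∀ p q → ∣ p - q ∣ ≡ ∣ q - p ∣
  ∣-∣-comm p q = trans (sym (∣-p∣≡∣p∣ (p - q))) (cong ∣_∣ (lem p q))
    where
    lem : ∀ p q → - (p - q) ≡ q - p
    lem = solve-∀ ℚ-ring

  ∣-∣-triangle : ∀ p q r → ∣ p - r ∣ ≤ ∣ p - q ∣ + ∣ q - r ∣
  ∣-∣-triangle p q r = subst (λ a → ∣ a ∣ ≤ ∣ p - q ∣ + ∣ q - r ∣) (lem p q r) (∣p+q∣≤∣p∣+∣q∣ (p - q) (q - r))
    where
    lem : ∀ p q r → (p - q) + (q - r) ≡ p - r
    lem = solve-∀ ℚ-ring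

  half>0 : ∀ {ε} → 0ℚ < ε → 0ℚ < ½ * ε
  half>0 = pos-* (positive⁻¹ ½)

  half+half : ∀ ε → ½ * ε + ½ * ε ≡ ε
  half+half = solve-∀ ℚ-ring

  ½ε<ε : ∀ {ε} → 0ℚ < ε → ½ * ε < ε
  ½ε<ε {ε} ε>0 = 0<⇒< (half>0 ε>0) (lem ε)
    where
    lem : ∀ ε → ε - ½ * ε ≡ ½ * ε
    lem = solve-∀ ℚ-ring

  ι : ℤ → ℚ
  ι i = i / 1

  ι-+ : ∀ i j → ι (i ℤ.+ j) ≡ ι i + ι j
  ι-+ i j = toℚᵘ-injective (begin
    toℚᵘ (ι (i ℤ.+ j))                  ≈⟨ toℚᵘ-fromℚᵘ (ℚᵘ.mkℚᵘ (i ℤ.+ j) 0) ⟩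
    ℚᵘ.mkℚᵘ (i ℤ.+ j) 0                 ≈⟨ ℚᵘ.*≡* (lem i j) ⟩
    ℚᵘ.mkℚᵘ i 0 ℚᵘ.+ ℚᵘ.mkℚᵘ j 0
      ≈⟨ ℚᵘ.+-cong (toℚᵘ-fromℚᵘ (ℚᵘ.mkℚᵘ i 0)) (toℚᵘ-fromℚᵘ (ℚᵘ.mkℚᵘ j 0)) ⟨
    toℚᵘ (ι i) ℚᵘ.+ toℚᵘ (ι j)          ≈⟨ toℚᵘ-homo-+ (ι i) (ι j) ⟨
    toℚᵘ (ι i + ι j)                    ∎)
    where
    open ℚᵘ.≃-Reasoning
    lem : ∀ i j → (i ℤ.+ j) ℤ.* (+ 1 ℤ.* + 1) ≡ (i ℤ.* + 1 ℤ.+ j ℤ.* + 1) ℤ.* + 1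
    lem = ℤSolver.solve-∀

  ι-* : ∀ i j → ι (i ℤ.* j) ≡ ι i * ι j
  ι-* i j = toℚᵘ-injective (begin
    toℚᵘ (ι (i ℤ.* j))                  ≈⟨ toℚᵘ-fromℚᵘ (ℚᵘ.mkℚᵘ (i ℤ.* j) 0) ⟩
    ℚᵘ.mkℚᵘ i 0 ℚᵘ.* ℚᵘ.mkℚᵘ j 0
      ≈⟨ ℚᵘ.*-cong (toℚᵘ-fromℚᵘ (ℚᵘ.mkℚᵘ i 0)) (toℚᵘ-fromℚᵘ (ℚᵘ.mkℚᵘ j 0)) ⟨
    toℚᵘ (ι i) ℚᵘ.* toℚᵘ (ι j)          ≈⟨ toℚᵘ-homo-* (ι i) (ι j) ⟨
    toℚᵘ (ι i * ι j)                    ∎)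
    where open ℚᵘ.≃-Reasoning

  ι-mono-≤ : ∀ {i j} → i ℤ.≤ j → ι i ≤ ι j
  ι-mono-≤ {i} {j} i≤j = toℚᵘ-cancel-≤ (ℚᵘ.≤-respˡ-≃ (ℚᵘ.≃-sym (toℚᵘ-fromℚᵘ (ℚᵘ.mkℚᵘ i 0)))
    (ℚᵘ.≤-respʳ-≃ (ℚᵘ.≃-sym (toℚᵘ-fromℚᵘ (ℚᵘ.mkℚᵘ j 0))) (ℚᵘ.*≤* (ℤ.*-monoʳ-≤-nonNeg (+ 1) i≤j))))

  ι-mono-< : ∀ {i j} → i ℤ.< j → ι i < ι j
  ι-mono-< {i} {j} i<j = <-≤-trans (0<⇒< (positive⁻¹ 1ℚ) (lem (ι i)))
    (subst (_≤ ι j) (ι-+ (+ 1) i) (ι-mono-≤ (ℤ.i<j⇒suc[i]≤j i<j)))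
    where
    lem : ∀ a → (1ℚ + a) - a ≡ 1ℚ
    lem = solve-∀ ℚ-ring

  ιℕ : ℕ → ℚ
  ιℕ n = ι (+ n)

  ιℕ-+ : ∀ m n → ιℕ (m ℕ.+ n) ≡ ιℕ m + ιℕ n
  ιℕ-+ m n = ι-+ (+ m) (+ n)

  ιℕ-* : ∀ m n → ιℕ (m ℕ.* n) ≡ ιℕ m * ιℕ n
  ιℕ-* m n = trans (cong ι (ℤ.pos-* m n)) (ι-* (+ m) (+ n))

  ιℕ-suc : ∀ n → ιℕ (suc n) ≡ 1ℚ + ιℕ n
  ιℕ-suc n = ιℕ-+ 1 n

  ιℕ≥0 : ∀ n → 0ℚ ≤ ιℕ n
  ιℕ≥0 n = ι-mono-≤ {+ 0} {+ n} (ℤ.+≤+ ℕ.z≤n)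

  ιℕ>0 : ∀ n → 0ℚ < ιℕ (suc n)
  ιℕ>0 n = ι-mono-< {+ 0} {+ suc n} (ℤ.+<+ (ℕ.s≤s ℕ.z≤n))

  *-/ : ∀ b .{{_ : ℕ.NonZero b}} a → ιℕ b * (+ a / b) ≡ ιℕ a
  *-/ b@(suc b-1) a = toℚᵘ-injective (begin
    toℚᵘ (ιℕ b * (+ a / b))             ≈⟨ toℚᵘ-homo-* (ιℕ b) (+ a / b) ⟩
    toℚᵘ (ιℕ b) ℚᵘ.* toℚᵘ (+ a / b)
      ≈⟨ ℚᵘ.*-cong (toℚᵘ-fromℚᵘ (ℚᵘ.mkℚᵘ (+ b) 0)) (toℚᵘ-fromℚᵘ (ℚᵘ.mkℚᵘ (+ a) b-1)) ⟩
    ℚᵘ.mkℚᵘ (+ b) 0 ℚᵘ.* ℚᵘ.mkℚᵘ (+ a) b-1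
      ≈⟨ ℚᵘ.*≡* (lem (+ a) (+ b)) ⟩
    ℚᵘ.mkℚᵘ (+ a) 0                     ≈⟨ toℚᵘ-fromℚᵘ (ℚᵘ.mkℚᵘ (+ a) 0) ⟨
    toℚᵘ (ιℕ a)                         ∎)
    where
    open ℚᵘ.≃-Reasoning
    lem : ∀ x y → (y ℤ.* x) ℤ.* + 1 ≡ x ℤ.* (+ 1 ℤ.* y)
    lem = ℤSolver.solve-∀

  archimedean : ∀ q → ∃ λ n → q ≤ ιℕ n
  archimedean q@(mkℚ i d-1 _) = ℤ.∣ i ∣ , toℚᵘ-cancel-≤
    (ℚᵘ.≤-respʳ-≃ (ℚᵘ.≃-sym (toℚᵘ-fromℚᵘ (ℚᵘ.mkℚᵘ (+ ℤ.∣ i ∣) 0))) (ℚᵘ.*≤* (bound i)))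
    where
    bound : ∀ i → i ℤ.* + 1 ℤ.≤ + ℤ.∣ i ∣ ℤ.* + suc d-1
    bound (+ n)     = subst₂ ℤ._≤_ (sym (ℤ.*-identityʳ (+ n))) (ℤ.pos-* n (suc d-1)) (ℤ.+≤+ (ℕ.m≤m*n n (suc d-1)))
    bound (-[1+ n ]) = ℤ.-≤+

  ½^ : ℕ → ℚ
  ½^ zero    = 1ℚ
  ½^ (suc n) = ½ * ½^ n

  ½^>0 : ∀ n → 0ℚ < ½^ n
  ½^>0 zero    = positive⁻¹ 1ℚ
  ½^>0 (suc n) = half>0 (½^>0 n)

  ½^-antitone : ∀ {m n} → m ℕ.≤ n → ½^ n ≤ ½^ m
  ½^-antitone {m} {n} m≤n with ℕ.m≤n⇒∃[o]m+o≡n m≤n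
  ... | o , refl = go o
    where
    go : ∀ o → ½^ (m ℕ.+ o) ≤ ½^ m
    go zero    = ≤-reflexive (cong ½^ (ℕ.+-identityʳ m))
    go (suc o) rewrite ℕ.+-suc m o = ≤-trans (<⇒≤ (½ε<ε (½^>0 (m ℕ.+ o)))) (go o)

  -- Decay of order 1/n is all that is needed to make `½^` a null sequence, and it comes from a
  -- direct induction with ½ⁿ ≤ 1.
  n*½^n≤1 : ∀ n → ιℕ n * ½^ n ≤ 1ℚ
  n*½^n≤1 zero    = <⇒≤ (positive⁻¹ 1ℚ)
  n*½^n≤1 (suc n) = begin
    ιℕ (suc n) * (½ * ½^ n)              ≡⟨ cong (_* (½ * ½^ n)) (ιℕ-suc n) ⟩
    (1ℚ + ιℕ n) * (½ * ½^ n)             ≡⟨ lem (ιℕ n) (½^ n) ⟩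
    ½ * (½^ n + ιℕ n * ½^ n)
      ≤⟨ *-monoˡ-≤-nonNeg ½ (+-mono-≤ (½^-antitone {0} {n} ℕ.z≤n) (n*½^n≤1 n)) ⟩
    ½ * (1ℚ + 1ℚ)                        ≡⟨⟩
    1ℚ                                   ∎
    where
    open ≤-Reasoning
    lem : ∀ a b → (1ℚ + a) * (½ * b) ≡ ½ * (b + a * b)
    lem = solve-∀ ℚ-ring

  -- With δ = ε/2, the archimedean property gives c ≤ n δ for large n, whence c ½ⁿ ≤ δ (n ½ⁿ) ≤ δ <
  -- ε.
  ½^-small : ∀ c ε → 0ℚ < ε → ∃ λ N → ∀ n → N ℕ.≤ n → c * ½^ n < ε
  ½^-small c ε ε>0 = N , λ n N≤n → ≤-<-trans (bound n N≤n) (½ε<ε ε>0)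
    where
    δ>0 : 0ℚ < ½ * ε
    δ>0 = half>0 ε>0
    δ : ℚ
    δ = ½ * ε
    instance
      δ⁺ : Positive δ
      δ⁺ = positive δ>0
      δ≢0 : NonZero δ
      δ≢0 = pos⇒nonZero δ
    N : ℕ
    N = proj₁ (archimedean (c * 1/ δ))
    open ≤-Reasoning
    cancel : ∀ a b c → (a * b) * c ≡ a * (c * b)
    cancel = solve-∀ ℚ-ring
    c≤ : ∀ n → N ℕ.≤ n → c ≤ ιℕ n * δ
    c≤ n N≤n = begin
      c                 ≡⟨ *-identityʳ c ⟨
      c * 1ℚ            ≡⟨ cong (c *_) (*-inverseʳ δ) ⟨
      c * (δ * 1/ δ)    ≡⟨ cancel c (1/ δ) δ ⟨
      (c * 1/ δ) * δ
        ≤⟨ *-monoʳ (<⇒≤ δ>0)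
             (≤-trans (proj₂ (archimedean (c * 1/ δ))) (ι-mono-≤ (ℤ.+≤+ N≤n))) ⟩
      ιℕ n * δ          ∎
    bound : ∀ n → N ℕ.≤ n → c * ½^ n ≤ δ
    bound n N≤n = begin
      c * ½^ n            ≤⟨ *-monoʳ (<⇒≤ (½^>0 n)) (c≤ n N≤n) ⟩
      (ιℕ n * δ) * ½^ n   ≡⟨ lem (ιℕ n) δ (½^ n) ⟩
      δ * (ιℕ n * ½^ n)   ≤⟨ *-monoˡ (<⇒≤ δ>0) (n*½^n≤1 n) ⟩
      δ * 1ℚ              ≡⟨ *-identityʳ δ ⟩
      δ                   ∎
      where
      lem : ∀ a b c → (a * b) * c ≡ b * (a * c)
      lem = solve-∀ ℚ-ring

-- Reals and complex numbers up to equality of limits.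

module RealNumbers where

  open import Data.Integer.Base as ℤ using (ℤ; +_)
  import Data.Integer.Properties as ℤ
  open import Data.Nat.Base as ℕ using (ℕ)
  import Data.Nat.Properties as ℕ
  open import Data.Product using (_,_)
  open import Data.Rational
  open import Data.Rational.Properties
  open import Defs using (ℝ; seq; cauchy; _≈_; mk≈; close; mk≤; below; fromℚ; fromℤ; 0ℝ; ℂ; re; im;
    _≈ᶜ_; mk≈ᶜ; re≈; im≈; _+ᶜ_; _-ᶜ_; _*ᶜ_; ∣Δ*∣-bound; bounded; divide)
    renaming (_≤_ to _≤ᴿ_; _+_ to _+ᴿ_; _*_ to _*ᴿ_; -_ to -ᴿ_)
  open import Relation.Binary.PropositionalEquality
  open import Tactic.RingSolver using (solve-∀)
  open RationalOrder

  -- The operations act termwise on the sequences. Every ring identity in ℝ or ℂ is therefore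
  -- reduced to an identity of rationals at each index, which the ring solver settles.
  pointwise : ∀ {x y} → (∀ n → seq x n ≡ seq y n) → x ≈ y
  pointwise {x} {y} eq = mk≈ λ ε ε>0 → 0 , λ n _ →
    subst (_< ε) (sym (cong ∣_∣ (trans (cong (_- seq y n) (eq n)) (+-inverseʳ (seq y n))))) ε>0

  ≈-refl : ∀ {x} → x ≈ x
  ≈-refl = pointwise (λ _ → refl)

  ≈-sym : ∀ {x y} → x ≈ y → y ≈ x
  ≈-sym {x} {y} x≈y = mk≈ λ ε ε>0 → let N , small = close x≈y ε ε>0 in N , λ n n≥N →
    subst (_< ε) (∣-∣-comm (seq x n) (seq y n)) (small n n≥N)

  ≈-trans : ∀ {x y z} → x ≈ y → y ≈ z → x ≈ z
  ≈-trans {x} {y} {z} x≈y y≈z = mk≈ λ ε ε>0 →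
    let N₁ , small₁ = close x≈y (½ * ε) (half>0 ε>0)
        N₂ , small₂ = close y≈z (½ * ε) (half>0 ε>0)
    in N₁ ℕ.⊔ N₂ , λ n n≥ → ≤-<-trans (∣-∣-triangle (seq x n) (seq y n) (seq z n))
         (subst (∣ seq x n - seq y n ∣ + ∣ seq y n - seq z n ∣ <_) (half+half ε)
           (+-mono-< (small₁ n (ℕ.m⊔n≤o⇒m≤o N₁ N₂ n≥)) (small₂ n (ℕ.m⊔n≤o⇒n≤o N₁ N₂ n≥))))

  +-cong : ∀ {x x′ y y′} → x ≈ x′ → y ≈ y′ → x +ᴿ y ≈ x′ +ᴿ y′
  +-cong {x} {x′} {y} {y′} x≈ y≈ = mk≈ λ ε ε>0 →
    let N₁ , small₁ = close x≈ (½ * ε) (half>0 ε>0)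
        N₂ , small₂ = close y≈ (½ * ε) (half>0 ε>0)
    in N₁ ℕ.⊔ N₂ , λ n n≥ → ≤-<-trans
         (subst (λ t → ∣ t ∣ ≤ ∣ seq x n - seq x′ n ∣ + ∣ seq y n - seq y′ n ∣)
           (lem (seq x n) (seq x′ n) (seq y n) (seq y′ n)) (∣p+q∣≤∣p∣+∣q∣ (seq x n - seq x′ n) (seq y n - seq y′ n)))
         (subst (∣ seq x n - seq x′ n ∣ + ∣ seq y n - seq y′ n ∣ <_) (half+half ε)
           (+-mono-< (small₁ n (ℕ.m⊔n≤o⇒m≤o N₁ N₂ n≥)) (small₂ n (ℕ.m⊔n≤o⇒n≤o N₁ N₂ n≥))))
    where
    lem : ∀ a b c e → (a - b) + (c - e) ≡ (a + c) - (b + e)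
    lem = solve-∀ ℚ-ring

  neg-cong : ∀ {x x′} → x ≈ x′ → -ᴿ x ≈ -ᴿ x′
  neg-cong {x} {x′} x≈ = mk≈ λ ε ε>0 → let N , small = close x≈ ε ε>0 in N , λ n n≥N →
    subst (_< ε) (trans (∣-∣-comm (seq x n) (seq x′ n)) (cong ∣_∣ (lem (seq x n) (seq x′ n)))) (small n n≥N)
    where
    lem : ∀ a b → b - a ≡ (- a) - (- b)
    lem = solve-∀ ℚ-ring

  *-cong : ∀ {x x′ y y′} → x ≈ x′ → y ≈ y′ → x *ᴿ y ≈ x′ *ᴿ y′
  *-cong {x} {x′} {y} {y′} x≈ y≈ = mk≈ λ ε ε>0 →
    let A , A>0 , N₁ , bx = bounded (seq x) (cauchy x)
        B , B>0 , N₂ , by = bounded (seq y′) (cauchy y′)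
        δ , δ>0 , Kδ≡ε    = divide (A + B) (+-mono-< A>0 B>0) ε ε>0
        N₃ , small₁       = close x≈ δ δ>0
        N₄ , small₂       = close y≈ δ δ>0
        N₁₂ = N₁ ℕ.⊔ N₂
        N₃₄ = N₃ ℕ.⊔ N₄
    in N₁₂ ℕ.⊔ N₃₄ , λ n n≥ →
      let n≥₁₂ = ℕ.m⊔n≤o⇒m≤o N₁₂ N₃₄ n≥
          n≥₃₄ = ℕ.m⊔n≤o⇒n≤o N₁₂ N₃₄ n≥
      in subst (∣ seq x n * seq y n - seq x′ n * seq y′ n ∣ <_) Kδ≡ε
           (∣Δ*∣-bound A>0 B>0 (seq x n) (seq y n) (seq x′ n) (seq y′ n)
             (bx n (ℕ.m⊔n≤o⇒m≤o N₁ N₂ n≥₁₂)) (by n (ℕ.m⊔n≤o⇒n≤o N₁ N₂ n≥₁₂))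
             (small₁ n (ℕ.m⊔n≤o⇒m≤o N₃ N₄ n≥₃₄)) (small₂ n (ℕ.m⊔n≤o⇒n≤o N₃ N₄ n≥₃₄)))

  ≈⇒≤ : ∀ {x y} → x ≈ y → x ≤ᴿ y
  ≈⇒≤ {x} {y} x≈y = mk≤ λ ε ε>0 → let N , small = close x≈y ε ε>0 in N , λ n n≥N →
    0≤⇒≤ (≤⇒0≤ (<⇒≤ (≤-<-trans (p≤∣p∣ (seq x n - seq y n)) (small n n≥N)))) (lem (seq x n) (seq y n) ε)
    where
    lem : ∀ a b ε → (b + ε) - a ≡ ε - (a - b)
    lem = solve-∀ ℚ-ring

  ≤ᴿ-trans : ∀ {x y z} → x ≤ᴿ y → y ≤ᴿ z → x ≤ᴿ z
  ≤ᴿ-trans {x} {y} {z} x≤y y≤z = mk≤ λ ε ε>0 →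
    let N₁ , le₁ = below x≤y (½ * ε) (half>0 ε>0)
        N₂ , le₂ = below y≤z (½ * ε) (half>0 ε>0)
    in N₁ ℕ.⊔ N₂ , λ n n≥ → ≤-trans (le₁ n (ℕ.m⊔n≤o⇒m≤o N₁ N₂ n≥))
         (≤-trans (+-monoˡ-≤ (½ * ε) (le₂ n (ℕ.m⊔n≤o⇒n≤o N₁ N₂ n≥)))
           (≤-reflexive (trans (+-assoc (seq z n) (½ * ε) (½ * ε)) (cong (λ t → seq z n + t) (half+half ε)))))

  +-mono-≤ᴿ : ∀ {x x′ y y′} → x ≤ᴿ x′ → y ≤ᴿ y′ → x +ᴿ y ≤ᴿ x′ +ᴿ y′
  +-mono-≤ᴿ {x} {x′} {y} {y′} x≤ y≤ = mk≤ λ ε ε>0 →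
    let N₁ , le₁ = below x≤ (½ * ε) (half>0 ε>0)
        N₂ , le₂ = below y≤ (½ * ε) (half>0 ε>0)
    in N₁ ℕ.⊔ N₂ , λ n n≥ → ≤-trans
         (+-mono-≤ (le₁ n (ℕ.m⊔n≤o⇒m≤o N₁ N₂ n≥)) (le₂ n (ℕ.m⊔n≤o⇒n≤o N₁ N₂ n≥)))
         (≤-reflexive (lem (seq x′ n) (seq y′ n) ε))
    where
    lem : ∀ a b ε → (a + ½ * ε) + (b + ½ * ε) ≡ (a + b) + ε
    lem = solve-∀ ℚ-ring

  fromℚ-mono-≤ : ∀ {p q} → p ≤ q → fromℚ p ≤ᴿ fromℚ q
  fromℚ-mono-≤ {p} {q} p≤q = mk≤ λ ε ε>0 → 0 , λ _ _ →
    ≤-trans p≤q (subst (_≤ q + ε) (+-identityʳ q) (+-monoʳ-≤ q (<⇒≤ ε>0)))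

  scale-≤ : ∀ {q c} → q ≤ 1ℚ → 0ℝ ≤ᴿ c → fromℚ q *ᴿ c ≤ᴿ c
  scale-≤ {q} {c} q≤1 c≥0 = mk≤ λ ε ε>0 →
    -- The summand 1 keeps the divisor positive when q = 1; the δ left over is dropped as
    -- nonnegative.
    let δ , δ>0 , Kδ≡ε = divide ((1ℚ - q) + 1ℚ) K>0 ε ε>0
        N , le = below c≥0 δ δ>0
    in N , λ n n≥N → 0≤⇒≤ (nonNeg-+ (nonNeg-* (≤⇒0≤ q≤1) (le n n≥N)) (<⇒≤ δ>0))
         (trans (cong (λ ε → (seq c n + ε) - q * seq c n) (sym Kδ≡ε)) (lem q (seq c n) δ))
    where
    K>0 : 0ℚ < (1ℚ - q) + 1ℚ
    K>0 = +-mono-≤-< (≤⇒0≤ q≤1) (positive⁻¹ 1ℚ)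
    lem : ∀ q c δ → (c + ((1ℚ - q) + 1ℚ) * δ) - q * c ≡ (1ℚ - q) * (c + δ) + δ
    lem = solve-∀ ℚ-ring

  nonNeg-scale-≤ : ∀ {q x y} → 0ℚ ≤ q → x ≤ᴿ y → fromℚ q *ᴿ x ≤ᴿ fromℚ q *ᴿ y
  nonNeg-scale-≤ {q} {x} {y} q≥0 x≤y = mk≤ λ ε ε>0 →
    let δ , δ>0 , Kδ≡ε = divide (q + 1ℚ) (+-mono-≤-< q≥0 (positive⁻¹ 1ℚ)) ε ε>0
        N , le = below x≤y δ δ>0
    in N , λ n n≥N → 0≤⇒≤ (nonNeg-+ (nonNeg-* q≥0 (≤⇒0≤ (le n n≥N))) (<⇒≤ δ>0))
         (trans (cong (λ ε → (q * seq y n + ε) - q * seq x n) (sym Kδ≡ε)) (lem q (seq x n) (seq y n) δ))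
    where
    lem : ∀ q x y δ → (q * y + (q + 1ℚ) * δ) - q * x ≡ q * ((y + δ) - x) + δ
    lem = solve-∀ ℚ-ring

  fromℤ-cancel-≤ : ∀ {i j} → fromℤ i ≤ᴿ fromℤ j → i ℤ.≤ j
  fromℤ-cancel-≤ {i} {j} i≤j = ℤ.≮⇒≥ λ j<i →
    -- Distinct integers are at least 1 apart, so the tolerance ½ already refutes j < i.
    let N , le = below i≤j ½ (positive⁻¹ ½)
    in <⇒≱ (<-≤-trans (0<⇒< (positive⁻¹ ½) (lem (ι j)))
              (subst (_≤ ι i) (ι-+ (+ 1) j) (ι-mono-≤ (ℤ.i<j⇒suc[i]≤j j<i))))
           (le N ℕ.≤-refl)
    where
    lem : ∀ a → (1ℚ + a) - (a + ½) ≡ ½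
    lem = solve-∀ ℚ-ring

  pointwiseᶜ : ∀ {z w} → (∀ n → seq (re z) n ≡ seq (re w) n) → (∀ n → seq (im z) n ≡ seq (im w) n) → z ≈ᶜ w
  pointwiseᶜ re≡ im≡ = mk≈ᶜ (pointwise re≡) (pointwise im≡)

  ≈ᶜ-refl : ∀ {z} → z ≈ᶜ z
  ≈ᶜ-refl = mk≈ᶜ ≈-refl ≈-refl

  ≈ᶜ-sym : ∀ {z w} → z ≈ᶜ w → w ≈ᶜ z
  ≈ᶜ-sym eq = mk≈ᶜ (≈-sym (re≈ eq)) (≈-sym (im≈ eq))

  ≈ᶜ-trans : ∀ {x y z} → x ≈ᶜ y → y ≈ᶜ z → x ≈ᶜ z
  ≈ᶜ-trans p q = mk≈ᶜ (≈-trans (re≈ p) (re≈ q)) (≈-trans (im≈ p) (im≈ q))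

  +ᶜ-cong : ∀ {x x′ y y′} → x ≈ᶜ x′ → y ≈ᶜ y′ → x +ᶜ y ≈ᶜ x′ +ᶜ y′
  +ᶜ-cong p q = mk≈ᶜ (+-cong (re≈ p) (re≈ q)) (+-cong (im≈ p) (im≈ q))

  -ᶜ-cong : ∀ {x x′ y y′} → x ≈ᶜ x′ → y ≈ᶜ y′ → x -ᶜ y ≈ᶜ x′ -ᶜ y′
  -ᶜ-cong p q = mk≈ᶜ (+-cong (re≈ p) (neg-cong (re≈ q))) (+-cong (im≈ p) (neg-cong (im≈ q)))

  *ᶜ-cong : ∀ {x x′ y y′} → x ≈ᶜ x′ → y ≈ᶜ y′ → x *ᶜ y ≈ᶜ x′ *ᶜ y′
  *ᶜ-cong p q = mk≈ᶜ
    (+-cong (*-cong (re≈ p) (re≈ q)) (neg-cong (*-cong (im≈ p) (im≈ q))))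
    (+-cong (*-cong (re≈ p) (im≈ q)) (*-cong (im≈ p) (re≈ q)))

-- The cost as gauge of the polytope: supporting functionals.

module Gauge where

  open import Data.Bool.Base using (true; false; if_then_else_; _∧_)
  open import Data.Fin.Base as Fin using (Fin; zero; suc)
  import Data.Fin.Properties as Fin
  open import Data.Integer.Base as ℤ using (ℤ; +_; -[1+_])
  import Data.Integer.Properties as ℤ
  open import Data.Integer.Tactic.RingSolver as ℤSolver using ()
  open import Data.Nat.Base as ℕ using (ℕ; zero; suc)
  import Data.Nat.Properties as ℕ
  open import Data.Product using (∃; ∃₂; Σ; _×_; _,_; proj₁; proj₂)
  open import Data.Rational using (ℚ; 0ℚ; 1ℚ; ½; _+_; _*_; -_; 1/_)
  import Data.Rational as ℚ
  import Data.Rational.Properties as ℚ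
  open import Data.Sum using (_⊎_; inj₁; inj₂)
  open import Data.Vec.Base using (Vec; []; _∷_; lookup; replicate; zipWith)
  open import Data.Vec.Functional using (Vector)
  open import Data.Vec.Properties using (lookup-replicate; lookup-zipWith; zipWith-assoc; zipWith-identityˡ; zipWith-comm)
  open import Defs using (ℝ; seq; _≈_; 0ℝ; 1ℝ; fromℚ; fromℤ; sum; sumᵖ; Point; _≈ᵖ_; _·_; -ᵖ_; Dilate; fromℤᵈ;
    e; e[_⋯_]; StGenerator; St; HasCardinality)
    renaming (_≤_ to _≤ᴿ_; _+_ to _+ᴿ_; _*_ to _*ᴿ_; -_ to -ᴿ_)
  open import Function.Base using (_∘_)
  open import Function.Bundles using (mk⇔)
  import Function.Properties.Equivalence as ⇔
  open import Relation.Binary.PropositionalEquality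
  open import Relation.Nullary using (yes; no; does)
  open import Relation.Nullary.Decidable using (⌊_⌋; isYes≗does)
  open import Tactic.RingSolver using (solve-∀)
  open LatticePoints using (cost; cardinality-unique; points-cardinality)
  open NewtonSeries using (count)
  open RationalOrder
  open RealNumbers

  infixl 6 _⊕_

  _⊕_ : ∀ {d} → Vec ℤ d → Vec ℤ d → Vec ℤ d
  _⊕_ = zipWith ℤ._+_

  zeros : ∀ {d} → Vec ℤ d
  zeros = replicate _ (+ 0)

  -- The trace of an interval opened earlier on the coordinates still to be read: some ones followed
  -- by zeros. The empty trace is included, since the interval may have ended just before.
  data Prefix : ∀ {d} → Vec ℤ d → Set where
    empty : ∀ {d} → Prefix (zeros {d})
    step  : ∀ {d} {u : Vec ℤ d} → Prefix u → Prefix (+ 1 ∷ u)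

  data Generator : ∀ {d} → Vec ℤ d → Set where
    negative : ∀ {d} → Generator (-[1+ 0 ] ∷ zeros {d})
    interval : ∀ {d} {u : Vec ℤ d} → Prefix u → Generator (+ 1 ∷ u)
    skip     : ∀ {d} {u : Vec ℤ d} → Generator u → Generator (+ 0 ∷ u)

  -- A supporting functional at v: its value at v is the cost, and it is at
  -- most 1 on the generators.

  dot : ∀ {d} → Vec ℤ d → Vec ℤ d → ℤ
  dot []       []       = + 0
  dot (a ∷ as) (x ∷ xs) = a ℤ.* x ℤ.+ dot as xs

  dot-zeros : ∀ {d} (as : Vec ℤ d) → dot as zeros ≡ + 0
  dot-zeros []       = refl
  dot-zeros (a ∷ as) = cong₂ ℤ._+_ (ℤ.*-zeroʳ a) (dot-zeros as)

  -- A slope of the climb max(0, x - h) as a function of the first entry x. Nothing is climbed on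
  -- the way to a negative entry or past the end.
  rise : ∀ {d} → ℕ → Vec ℤ d → ℤ
  rise h []               = + 0
  rise h (+ x ∷ xs)       = if ⌊ h ℕ.<? x ⌋ then + 1 else + 0
  rise h (-[1+ k ] ∷ xs)  = + 0

  rise-bounds : ∀ {d} h (v : Vec ℤ d) → + 0 ℤ.≤ rise h v × rise h v ℤ.≤ + 1
  rise-bounds h []              = ℤ.+≤+ ℕ.z≤n , ℤ.+≤+ ℕ.z≤n
  rise-bounds h (+ x ∷ xs)      with ⌊ h ℕ.<? x ⌋
  ... | true  = ℤ.+≤+ ℕ.z≤n , ℤ.≤-refl
  ... | false = ℤ.≤-refl , ℤ.+≤+ ℕ.z≤n
  rise-bounds h (-[1+ k ] ∷ xs) = ℤ.≤-refl , ℤ.+≤+ ℕ.z≤n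

  -- A nonnegative entry is climbed into, with slope `rise h`, and is the height at which the next
  -- climb starts, which contributes minus the next slope. A negative entry costs its absolute
  -- value, hence -1, and the next climb starts at the fixed height 0.
  support : ∀ {d} → ℕ → Vec ℤ d → Vec ℤ d
  support h []              = []
  support h (+ x ∷ xs)      = (rise h (+ x ∷ xs) ℤ.- rise x xs) ∷ support x xs
  support h (-[1+ k ] ∷ xs) = -[1+ 0 ] ∷ support 0 xs

  -- The slope is charged for all of the first entry x, but only x - h is climbed; the surplus is
  -- the last term, which disappears at h = 0.
  dot-support : ∀ {d} h (v : Vec ℤ d) → dot (support h v) v ≡ + cost h v ℤ.+ rise h v ℤ.* + h
  dot-support h []              = refl
  dot-support h (+ x ∷ xs)      = begin
    (r ℤ.- r′) ℤ.* + x ℤ.+ dot (support x xs) xs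
      ≡⟨ cong (λ z → (r ℤ.- r′) ℤ.* + x ℤ.+ z) (dot-support x xs) ⟩
    (r ℤ.- r′) ℤ.* + x ℤ.+ (+ cost x xs ℤ.+ r′ ℤ.* + x)
      ≡⟨ l₁ r r′ (+ x) (+ cost x xs) ⟩
    r ℤ.* + x ℤ.+ + cost x xs
      ≡⟨ cong (ℤ._+ + cost x xs) climb ⟩
    (+ (x ℕ.∸ h) ℤ.+ r ℤ.* + h) ℤ.+ + cost x xs
      ≡⟨ l₂ (+ (x ℕ.∸ h)) (r ℤ.* + h) (+ cost x xs) ⟩
    + (x ℕ.∸ h) ℤ.+ + cost x xs ℤ.+ r ℤ.* + h ∎
    where
    open ≡-Reasoning
    r = rise h (+ x ∷ xs)
    r′ = rise x xs
    l₁ : ∀ r r′ x c → (r ℤ.- r′) ℤ.* x ℤ.+ (c ℤ.+ r′ ℤ.* x) ≡ r ℤ.* x ℤ.+ c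
    l₁ = ℤSolver.solve-∀
    l₂ : ∀ a b c → (a ℤ.+ b) ℤ.+ c ≡ a ℤ.+ c ℤ.+ b
    l₂ = ℤSolver.solve-∀
    climb : rise h (+ x ∷ xs) ℤ.* + x ≡ + (x ℕ.∸ h) ℤ.+ rise h (+ x ∷ xs) ℤ.* + h
    climb with h ℕ.<? x
    ... | yes h<x = trans (ℤ.*-identityˡ (+ x)) (trans (cong +_ (sym (ℕ.m∸n+n≡m (ℕ.<⇒≤ h<x))))
                      (cong (λ z → + (x ℕ.∸ h) ℤ.+ z) (sym (ℤ.*-identityˡ (+ h)))))
    ... | no  h≮x = cong +_ (sym (trans (ℕ.+-identityʳ (x ℕ.∸ h)) (ℕ.m≤n⇒m∸n≡0 (ℕ.≮⇒≥ h≮x))))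
  dot-support h (-[1+ k ] ∷ xs) = begin
    + suc (k ℕ.+ 0) ℤ.+ dot (support 0 xs) xs
      ≡⟨ cong₂ (λ a b → + suc a ℤ.+ b) (ℕ.+-identityʳ k) (dot-support 0 xs) ⟩
    + suc k ℤ.+ (+ cost 0 xs ℤ.+ rise 0 xs ℤ.* + 0)
      ≡⟨ l₁ (+ suc k) (+ cost 0 xs) (rise 0 xs) (+ h) ⟩
    + suc k ℤ.+ + cost 0 xs ℤ.+ + 0 ℤ.* + h ∎
    where
    open ≡-Reasoning
    l₁ : ∀ a b r h → a ℤ.+ (b ℤ.+ r ℤ.* + 0) ≡ a ℤ.+ b ℤ.+ + 0 ℤ.* h
    l₁ = ℤSolver.solve-∀

  -- Along a run of ones the differences of slopes telescope to the first slope minus a later one,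
  -- which is nonnegative. A negative entry contributes -1, which offsets any slope after it.
  support-prefix : ∀ {d} h (v : Vec ℤ d) {u} → Prefix u → dot (support h v) u ℤ.≤ rise h v
  support-prefix h v empty = subst (ℤ._≤ rise h v) (sym (dot-zeros (support h v))) (proj₁ (rise-bounds h v))
  support-prefix h (+ x ∷ xs) (step {u = u} pre) = begin
    (r ℤ.- r′) ℤ.* + 1 ℤ.+ dot (support x xs) u
      ≤⟨ ℤ.+-monoʳ-≤ ((r ℤ.- r′) ℤ.* + 1) (support-prefix x xs pre) ⟩
    (r ℤ.- r′) ℤ.* + 1 ℤ.+ r′
      ≡⟨ lem r r′ ⟩
    r ∎
    where
    open ℤ.≤-Reasoning
    r = rise h (+ x ∷ xs)
    r′ = rise x xs
    lem : ∀ r r′ → (r ℤ.- r′) ℤ.* + 1 ℤ.+ r′ ≡ r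
    lem = ℤSolver.solve-∀
  support-prefix h (-[1+ k ] ∷ xs) (step {u = u} pre) =
    ℤ.+-monoʳ-≤ -[1+ 0 ] (ℤ.≤-trans (support-prefix 0 xs pre) (proj₂ (rise-bounds 0 xs)))

  support-generator : ∀ {d} h (v : Vec ℤ d) {g} → Generator g → dot (support h v) g ℤ.≤ + 1
  support-generator h v (interval pre) =
    ℤ.≤-trans (support-prefix h v (step pre)) (proj₂ (rise-bounds h v))
  support-generator h (+ x ∷ xs) negative = begin
    (r ℤ.- r′) ℤ.* -[1+ 0 ] ℤ.+ dot (support x xs) zeros
      ≡⟨ cong (λ z → (r ℤ.- r′) ℤ.* -[1+ 0 ] ℤ.+ z) (dot-zeros (support x xs)) ⟩
    (r ℤ.- r′) ℤ.* -[1+ 0 ] ℤ.+ + 0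
      ≡⟨ lem r r′ ⟩
    r′ ℤ.+ ℤ.- r
      ≤⟨ ℤ.+-mono-≤ (proj₂ (rise-bounds x xs)) (ℤ.neg-mono-≤ (proj₁ (rise-bounds h (+ x ∷ xs)))) ⟩
    + 1 ∎
    where
    open ℤ.≤-Reasoning
    r = rise h (+ x ∷ xs)
    r′ = rise x xs
    lem : ∀ r r′ → (r ℤ.- r′) ℤ.* -[1+ 0 ] ℤ.+ + 0 ≡ r′ ℤ.+ ℤ.- r
    lem = ℤSolver.solve-∀
  support-generator h (-[1+ k ] ∷ xs) negative =
    ℤ.≤-reflexive (cong (λ z → + 1 ℤ.+ z) (dot-zeros (support 0 xs)))
  support-generator h (+ x ∷ xs) (skip {u = u} g) =
    subst (ℤ._≤ + 1) (sym (trans (cong (ℤ._+ dot (support x xs) u) (ℤ.*-zeroʳ (rise h (+ x ∷ xs) ℤ.- rise x xs)))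
      (ℤ.+-identityˡ (dot (support x xs) u)))) (support-generator x xs g)
  support-generator h (-[1+ k ] ∷ xs) (skip {u = u} g) =
    subst (ℤ._≤ + 1) (sym (ℤ.+-identityˡ (dot (support 0 xs) u))) (support-generator 0 xs g)

  functional : ∀ {d} → Vec ℤ d → Point d → ℝ
  functional []       y = 0ℝ
  functional (a ∷ as) y = fromℤ a *ᴿ y zero +ᴿ functional as (y ∘ suc)

  functional-cong : ∀ {d} (as : Vec ℤ d) {x y} → x ≈ᵖ y → functional as x ≈ functional as y
  functional-cong []       x≈y = ≈-refl
  functional-cong (a ∷ as) x≈y = +-cong (*-cong ≈-refl (x≈y zero)) (functional-cong as (x≈y ∘ suc))

  functional-fromℤᵈ : ∀ {d} (as v : Vec ℤ d) n → seq (functional as (fromℤᵈ v)) n ≡ ι (dot as v)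
  functional-fromℤᵈ []       []       n = refl
  functional-fromℤᵈ (a ∷ as) (x ∷ xs) n =
    trans (cong₂ _+_ (sym (ι-* a x)) (functional-fromℤᵈ as xs n)) (sym (ι-+ (a ℤ.* x) (dot as xs)))

  functional-· : ∀ {d} (as : Vec ℤ d) c y n → seq (functional as (c · y)) n ≡ seq c n * seq (functional as y) n
  functional-· []       c y n = sym (ℚ.*-zeroʳ (seq c n))
  functional-· (a ∷ as) c y n = trans (cong (λ z → ι a * (seq c n * seq (y zero) n) + z) (functional-· as c (y ∘ suc) n))
    (lem (ι a) (seq c n) (seq (y zero) n) _)
    where
    lem : ∀ a c y z → a * (c * y) + c * z ≡ c * (a * y + z)
    lem = solve-∀ ℚ-ring

  functional-0 : ∀ {d} (as : Vec ℤ d) n → seq (functional as (λ _ → 0ℝ)) n ≡ 0ℚ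
  functional-0 []       n = refl
  functional-0 (a ∷ as) n = cong₂ _+_ (ℚ.*-zeroʳ (ι a)) (functional-0 as n)

  functional-+ : ∀ {d} (as : Vec ℤ d) x y n →
    seq (functional as (λ k → x k +ᴿ y k)) n ≡ seq (functional as x) n + seq (functional as y) n
  functional-+ []       x y n = refl
  functional-+ (a ∷ as) x y n = trans (cong (λ z → ι a * (seq (x zero) n + seq (y zero) n) + z) (functional-+ as (x ∘ suc) (y ∘ suc) n))
    (lem (ι a) (seq (x zero) n) (seq (y zero) n) _ _)
    where
    lem : ∀ a x y z w → a * (x + y) + (z + w) ≡ (a * x + z) + (a * y + w)
    lem = solve-∀ ℚ-ring

  functional-sum : ∀ {d m} (as : Vec ℤ d) (p : Vector (Point d) m) n →
    seq (functional as (sumᵖ p)) n ≡ seq (sum (λ i → functional as (p i))) n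
  functional-sum {m = zero}  as p n = functional-0 as n
  functional-sum {m = suc m} as p n =
    trans (functional-+ as (p zero) (sumᵖ (p ∘ suc)) n) (cong (λ z → seq (functional as (p zero)) n + z) (functional-sum as (p ∘ suc) n))

  sum-mono-≤ : ∀ {m} {x y : Vector ℝ m} → (∀ i → x i ≤ᴿ y i) → sum x ≤ᴿ sum y
  sum-mono-≤ {zero}  x≤y = ≈⇒≤ ≈-refl
  sum-mono-≤ {suc m} x≤y = +-mono-≤ᴿ (x≤y zero) (sum-mono-≤ (x≤y ∘ suc))

  unit minusUnit upTo : ∀ {d} → Fin d → Vec ℤ d
  unit zero    = + 1 ∷ zeros
  unit (suc i) = + 0 ∷ unit i
  minusUnit zero    = -[1+ 0 ] ∷ zeros
  minusUnit (suc i) = + 0 ∷ minusUnit i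
  upTo zero    = + 1 ∷ zeros
  upTo (suc j) = + 1 ∷ upTo j

  segment : ∀ {d} → Fin d → Fin d → Vec ℤ d
  segment zero    j       = upTo j
  segment (suc i) zero    = zeros
  segment (suc i) (suc j) = + 0 ∷ segment i j

  e-suc : ∀ {d} (i k : Fin d) → e (suc i) (suc k) ≡ e i k
  e-suc i k = cong (if_then 1ℝ else 0ℝ) (trans (isYes≗does (suc i Fin.≟ suc k)) (sym (isYes≗does (i Fin.≟ k))))

  e≈unit : ∀ {d} (i : Fin d) → e i ≈ᵖ fromℤᵈ (unit i)
  e≈unit zero    zero    = ≈-refl
  e≈unit zero    (suc k) = pointwise λ _ → cong ι (sym (lookup-replicate k (+ 0)))
  e≈unit (suc i) zero    = ≈-refl
  e≈unit (suc i) (suc k) = subst (_≈ fromℤ (lookup (unit i) k)) (sym (e-suc i k)) (e≈unit i k)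

  -e≈minusUnit : ∀ {d} (i : Fin d) → -ᵖ (e i) ≈ᵖ fromℤᵈ (minusUnit i)
  -e≈minusUnit zero    zero    = pointwise λ _ → refl
  -e≈minusUnit zero    (suc k) = pointwise λ _ → cong ι (sym (lookup-replicate k (+ 0)))
  -e≈minusUnit (suc i) zero    = pointwise λ _ → refl
  -e≈minusUnit (suc i) (suc k) =
    subst (λ x → -ᴿ x ≈ fromℤ (lookup (minusUnit i) k)) (sym (e-suc i k)) (-e≈minusUnit i k)

  sum-0 : ∀ {m} (x : Vector ℝ m) → (∀ i → x i ≈ 0ℝ) → sum x ≈ 0ℝ
  sum-0 {zero}  x x≈0 = ≈-refl
  sum-0 {suc m} x x≈0 = ≈-trans (+-cong (x≈0 zero) (sum-0 (x ∘ suc) (x≈0 ∘ suc))) (pointwise λ _ → refl)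

  sum-cong : ∀ {m} {x y : Vector ℝ m} → (∀ i → x i ≈ y i) → sum x ≈ sum y
  sum-cong {zero}  x≈y = ≈-refl
  sum-cong {suc m} x≈y = +-cong (x≈y zero) (sum-cong (x≈y ∘ suc))

  private
    0ᵖ : ∀ {d} → Point d
    0ᵖ _ = 0ℝ

    choose-suc : ∀ {d} b (l k : Fin d) →
      (if b then e (suc l) else 0ᵖ) (suc k) ≈ (if b then e l else 0ᵖ) k
    choose-suc true  l k = subst (_≈ e l k) (sym (e-suc l k)) ≈-refl
    choose-suc false l k = ≈-refl

    choose-zero : ∀ {d} b (l : Fin d) → (if b then e (suc l) else 0ᵖ) zero ≈ 0ℝ
    choose-zero true  l = ≈-refl
    choose-zero false l = ≈-refl

    suc-≤? : ∀ {d} (i l : Fin d) → ⌊ suc i Fin.≤? suc l ⌋ ≡ ⌊ i Fin.≤? l ⌋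
    suc-≤? i l = trans (isYes≗does (suc i Fin.≤? suc l)) (trans (does-suc i) (sym (isYes≗does (i Fin.≤? l))))
      where
      does-suc : ∀ {d} (i : Fin d) → does (suc i Fin.≤? suc l) ≡ does (i Fin.≤? l)
      does-suc zero    = refl
      does-suc (suc i) = refl

    ≡⇒≈ : ∀ {x y} → x ≡ y → x ≈ y
    ≡⇒≈ refl = ≈-refl

    +0 : ∀ {x y} → y ≈ 0ℝ → x +ᴿ y ≈ x
    +0 {x} y≈0 = ≈-trans (+-cong ≈-refl y≈0) (pointwise λ n → ℚ.+-identityʳ (seq x n))

    0+ : ∀ {x y} → x ≈ 0ℝ → x +ᴿ y ≈ y
    0+ {y = y} x≈0 = ≈-trans (+-cong x≈0 ≈-refl) (pointwise λ n → ℚ.+-identityˡ (seq y n))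

  -- The base case i = 0 of `e⋯≈segment`: there the test i ≤ l is true by computation, and only the
  -- test l ≤ j is left.
  initial≈upTo : ∀ {d} (j k : Fin d) →
    sum (λ l → (if ⌊ l Fin.≤? j ⌋ then e l else 0ᵖ) k) ≈ fromℤ (lookup (upTo j) k)
  initial≈upTo {suc d} zero    k       = ≈-trans (+0 (sum-0 {d} _ λ _ → ≈-refl)) (e≈unit zero k)
  initial≈upTo {suc d} (suc j) zero    = +0 (sum-0 {d} _ λ l → choose-zero ⌊ suc l Fin.≤? suc j ⌋ l)
  initial≈upTo (suc j) (suc k) = ≈-trans (0+ ≈-refl) (≈-trans
    (sum-cong λ l → ≈-trans (choose-suc ⌊ suc l Fin.≤? suc j ⌋ l k)
      (≡⇒≈ (cong (λ b → (if b then e l else 0ᵖ) k) (suc-≤? l j))))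
    (initial≈upTo j k))

  e⋯≈segment : ∀ {d} (i j : Fin d) → i Fin.≤ j → e[ i ⋯ j ] ≈ᵖ fromℤᵈ (segment i j)
  e⋯≈segment zero    j       _         k       = initial≈upTo j k
  e⋯≈segment {suc d} (suc i) (suc j) (ℕ.s≤s i≤j) zero    = ≈-trans (0+ ≈-refl)
    (sum-0 {d} _ λ l → choose-zero (⌊ suc i Fin.≤? suc l ⌋ ∧ ⌊ suc l Fin.≤? suc j ⌋) l)
  e⋯≈segment (suc i) (suc j) (ℕ.s≤s i≤j) (suc k) = ≈-trans (0+ ≈-refl) (≈-trans
    (sum-cong λ l → ≈-trans (choose-suc (⌊ suc i Fin.≤? suc l ⌋ ∧ ⌊ suc l Fin.≤? suc j ⌋) l k)
      (≡⇒≈ (cong₂ (λ b b′ → (if b ∧ b′ then e l else 0ᵖ) k) (suc-≤? i l) (suc-≤? l j))))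
    (e⋯≈segment i j i≤j k))

  unit-generator : ∀ {d} (i : Fin d) → Generator (unit i)
  unit-generator zero    = interval empty
  unit-generator (suc i) = skip (unit-generator i)

  minusUnit-generator : ∀ {d} (i : Fin d) → Generator (minusUnit i)
  minusUnit-generator zero    = negative
  minusUnit-generator (suc i) = skip (minusUnit-generator i)

  upTo-prefix : ∀ {d} (j : Fin d) → Prefix (upTo j)
  upTo-prefix zero    = step empty
  upTo-prefix (suc j) = step (upTo-prefix j)

  segment-generator : ∀ {d} (i j : Fin d) → i Fin.≤ j → Generator (segment i j)
  segment-generator zero    zero    _           = interval empty
  segment-generator zero    (suc j) _           = interval (upTo-prefix j)
  segment-generator (suc i) (suc j) (ℕ.s≤s i≤j) = skip (segment-generator i j i≤j)

  generator-sound : ∀ {d x} → StGenerator d x → ∃ λ g → Generator g × x ≈ᵖ fromℤᵈ g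
  generator-sound (inj₁ (i , inj₁ x≈e))     = unit i , unit-generator i , λ k → ≈-trans (x≈e k) (e≈unit i k)
  generator-sound (inj₁ (i , inj₂ x≈-e))    =
    minusUnit i , minusUnit-generator i , λ k → ≈-trans (x≈-e k) (-e≈minusUnit i k)
  generator-sound (inj₂ (i , j , i<j , x≈)) =
    segment i j , segment-generator i j (ℕ.<⇒≤ i<j) , λ k → ≈-trans (x≈ k) (e⋯≈segment i j (ℕ.<⇒≤ i<j) k)

  private
    -- `Generator` regards a coordinate vector as an interval of length one, whereas `StGenerator`
    -- lists it apart from the sums with i < j. The shapes follow the latter.
    data Shape {d} : Vec ℤ d → Set where
      isUnit      : ∀ i → Shape (unit i)
      isMinusUnit : ∀ i → Shape (minusUnit i)
      isSegment   : ∀ i j → i Fin.< j → Shape (segment i j)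

    prefix-shape : ∀ {d} {u : Vec ℤ d} → Prefix u → u ≡ zeros ⊎ ∃ λ j → u ≡ upTo j
    prefix-shape empty = inj₁ refl
    prefix-shape (step pre) with prefix-shape pre
    ... | inj₁ refl       = inj₂ (zero , refl)
    ... | inj₂ (j , refl) = inj₂ (suc j , refl)

    shape : ∀ {d} {g : Vec ℤ d} → Generator g → Shape g
    shape negative = isMinusUnit zero
    shape (interval pre) with prefix-shape pre
    ... | inj₁ refl       = isUnit zero
    ... | inj₂ (j , refl) = isSegment zero (suc j) (ℕ.s≤s ℕ.z≤n)
    shape (skip g) with shape g
    ... | isUnit i          = isUnit (suc i)
    ... | isMinusUnit i     = isMinusUnit (suc i)
    ... | isSegment i j i<j = isSegment (suc i) (suc j) (ℕ.s≤s i<j)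

  generator-complete : ∀ {d} {g : Vec ℤ d} → Generator g → StGenerator d (fromℤᵈ g)
  generator-complete g with shape g
  ... | isUnit i          = inj₁ (i , inj₁ λ k → ≈-sym (e≈unit i k))
  ... | isMinusUnit i     = inj₁ (i , inj₂ λ k → ≈-sym (-e≈minusUnit i k))
  ... | isSegment i j i<j = inj₂ (i , j , i<j , λ k → ≈-sym (e⋯≈segment i j (ℕ.<⇒≤ i<j) k))

  -- Weak duality: the supporting functional has value cost v at v and at most 1 at y, a convex
  -- combination of generators. Since v = s y, the cost is at most s.
  Dilate⇒cost≤ : ∀ {d} s (v : Vec ℤ d) → Dilate s (St d) (fromℤᵈ v) → cost 0 v ℕ.≤ s
  Dilate⇒cost≤ {d} s v (y , (m , p , c , p-gen , c≥0 , Σc≈1 , y≈) , x≈sy) = ℤ.drop‿+≤+ (fromℤ-cancel-≤ {+ cost 0 v} {+ s}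
    (≤ᴿ-trans (≈⇒≤ value) (≤ᴿ-trans (nonNeg-scale-≤ (ιℕ≥0 s) y≤1) (≈⇒≤ (pointwise λ _ → ℚ.*-identityʳ (ιℕ s))))))
    where
    as : Vec ℤ d
    as = support 0 v
    value : fromℤ (+ cost 0 v) ≈ fromℤ (+ s) *ᴿ functional as y
    value = ≈-trans (pointwise λ n → trans (cong ι (sym
        (trans (dot-support 0 v) (trans (cong (λ z → + cost 0 v ℤ.+ z) (ℤ.*-zeroʳ (rise 0 v))) (ℤ.+-identityʳ (+ cost 0 v))))))
        (sym (functional-fromℤᵈ as v n)))
      (≈-trans (functional-cong as x≈sy) (pointwise (functional-· as (fromℤ (+ s)) y)))
    term : ∀ i → functional as (c i · p i) ≤ᴿ c i
    term i with generator-sound (p-gen i)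
    ... | g , g-gen , p≈g = ≤ᴿ-trans (≈⇒≤ (≈-trans (functional-cong as (λ k → *-cong {c i} ≈-refl (p≈g k)))
        (pointwise λ n → trans (functional-· as (c i) (fromℤᵈ g) n)
          (trans (cong (λ z → seq (c i) n * z) (functional-fromℤᵈ as g n)) (ℚ.*-comm (seq (c i) n) (ι (dot as g)))))))
      (scale-≤ {ι (dot as g)} (ι-mono-≤ (support-generator 0 v g-gen)) (c≥0 i))
    y≤1 : functional as y ≤ᴿ 1ℝ
    y≤1 = ≤ᴿ-trans (≈⇒≤ (≈-trans (functional-cong as y≈) (pointwise (functional-sum as (λ i → c i · p i)))))
      (≤ᴿ-trans (sum-mono-≤ term) (≈⇒≤ Σc≈1))

  -- Decomposition of a lattice point into as many generators as it costs.

  data Sum {d} (P : Vec ℤ d → Set) : ℕ → Vec ℤ d → Set where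
    nil  : Sum P 0 zeros
    cons : ∀ {n u v} → P u → Sum P n v → Sum P (suc n) (u ⊕ v)

  ⊕-identityˡ : ∀ {d} (v : Vec ℤ d) → zeros ⊕ v ≡ v
  ⊕-identityˡ = zipWith-identityˡ ℤ.+-identityˡ

  ⊕-assoc : ∀ {d} (u v w : Vec ℤ d) → (u ⊕ v) ⊕ w ≡ u ⊕ (v ⊕ w)
  ⊕-assoc = zipWith-assoc ℤ.+-assoc

  sum-++ : ∀ {d P m n} {u v : Vec ℤ d} → Sum P m u → Sum P n v → Sum P (m ℕ.+ n) (u ⊕ v)
  sum-++ {v = v} nil su = subst (Sum _ _) (sym (⊕-identityˡ v)) su
  sum-++ {v = v} (cons {u = u} {v = w} p su) sv =
    subst (Sum _ _) (sym (⊕-assoc u w v)) (cons p (sum-++ su sv))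

  sum-split : ∀ {d P} m {n} {v : Vec ℤ d} → Sum P (m ℕ.+ n) v →
    ∃₂ λ u w → Sum P m u × Sum P n w × v ≡ u ⊕ w
  sum-split zero    {v = v} sv = zeros , v , nil , sv , sym (⊕-identityˡ v)
  sum-split (suc m) (cons {u = x} p sv) with sum-split m sv
  ... | u , w , su , sw , refl = x ⊕ u , w , cons p su , sw , sym (⊕-assoc x u w)

  sum-skip : ∀ {d n} {v : Vec ℤ d} → Sum Generator n v → Sum Generator n (+ 0 ∷ v)
  sum-skip nil        = nil
  sum-skip (cons g s) = cons (skip g) (sum-skip s)

  -- Each summand receives a leading one, so the number of summands turns up as the new first entry.
  sum-ones : ∀ {d n} {P : Vec ℤ d → Set} {Q : Vec ℤ (suc d) → Set} {v} →
    (∀ {u} → P u → Q (+ 1 ∷ u)) → Sum P n v → Sum Q n (+ n ∷ v)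
  sum-ones f nil        = nil
  sum-ones f (cons p s) = cons (f p) (sum-ones f s)

  sum-empty : ∀ {d} n → Sum (Prefix {d}) n zeros
  sum-empty zero    = nil
  sum-empty (suc n) = subst (Sum Prefix (suc n)) (⊕-identityˡ zeros) (cons empty (sum-empty n))

  sum-negative : ∀ {d} k → Sum Generator (suc k) (-[1+ k ] ∷ zeros {d})
  sum-negative zero    = subst (λ v → Sum Generator 1 (-[1+ 0 ] ∷ v)) (⊕-identityˡ zeros) (cons negative nil)
  sum-negative (suc k) = subst (λ v → Sum Generator (2 ℕ.+ k) (-[1+ suc k ] ∷ v)) (⊕-identityˡ zeros)
    (cons negative (sum-negative k))

  -- h intervals are open when v is entered; those still open at the first
  -- entry are prefixes of v, and the newly opened ones are counted by the cost.
  decompose : ∀ {d} h (v : Vec ℤ d) → ∃₂ λ a b → Sum Prefix h a × Sum Generator (cost h v) b × v ≡ a ⊕ b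
  decompose h []       = zeros , [] , sum-empty h , nil , refl
  decompose h (+ x ∷ xs) with decompose x xs
  ... | a , b , sa , sb , refl with ℕ.≤-total x h
  -- Of the h open intervals, x continue through this entry and the other o have ended; no new one
  -- is opened, in accordance with x ∸ h = 0.
  ...   | inj₁ x≤h with ℕ.m≤n⇒∃[o]m+o≡n x≤h
  ...     | o , refl = _ , _ , sum-++ (sum-ones step sa) (sum-empty o)
      , subst (λ c → Sum Generator (c ℕ.+ cost x (a ⊕ b)) (+ 0 ∷ b)) (sym (ℕ.m≤n⇒m∸n≡0 x≤h)) (sum-skip sb)
      , cong₂ _∷_ (cong +_ (sym (trans (ℕ.+-identityʳ (x ℕ.+ 0)) (ℕ.+-identityʳ x))))
          (cong (_⊕ b) (sym (trans (zipWith-comm ℤ.+-comm a zeros) (⊕-identityˡ a))))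
  -- Of the x intervals that pass on to `xs`, h were open before and the remaining r start here;
  -- only the latter are new generators.
  decompose h (+ x ∷ xs) | a , b , sa , sb , refl | inj₂ h≤x with ℕ.m≤n⇒∃[o]m+o≡n h≤x
  ...     | r , refl with sum-split h sa
  ...       | a₁ , a₂ , s₁ , s₂ , refl = _ , _ , sum-ones step s₁
      , subst (λ c → Sum Generator (c ℕ.+ cost (h ℕ.+ r) (a₁ ⊕ a₂ ⊕ b)) ((+ r ∷ a₂) ⊕ (+ 0 ∷ b)))
          (sym (ℕ.m+n∸m≡n h r)) (sum-++ (sum-ones interval s₂) (sum-skip sb))
      , cong₂ _∷_ (cong (λ c → + (h ℕ.+ c)) (sym (ℕ.+-identityʳ r))) (⊕-assoc a₁ a₂ b)
  -- All open intervals end before a negative entry. It is reached by k + 1 negative unit vectors,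
  -- and no interval passes on.
  decompose h (-[1+ k ] ∷ xs) with decompose 0 xs
  ... | _ , b , nil , sb , xs≡ = _ , _ , sum-empty h , sum-++ (sum-negative k) (sum-skip sb)
      , cong (-[1+ k ] ∷_) (trans xs≡ (sym (⊕-identityˡ (zeros ⊕ b))))

  decompose-generators : ∀ {d} (v : Vec ℤ d) → Sum Generator (cost 0 v) v
  decompose-generators v with decompose 0 v
  ... | _ , b , nil , sb , v≡ = subst (Sum Generator (cost 0 v)) (sym (trans v≡ (⊕-identityˡ b))) sb

  seq-sum-const : ∀ {n} q m → seq (sum {n} (λ _ → fromℚ q)) m ≡ ιℕ n * q
  seq-sum-const {zero}  q m = sym (ℚ.*-zeroˡ q)
  seq-sum-const {suc n} q m = trans (cong (λ z → q + z) (seq-sum-const {n} q m))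
    (trans (lem q (ιℕ n)) (cong (_* q) (sym (ιℕ-suc n))))
    where
    lem : ∀ q n → q + n * q ≡ (1ℚ + n) * q
    lem = solve-∀ ℚ-ring

  sum-points : ∀ {d n} {v : Vec ℤ d} → Sum Generator n v →
    Σ (Vector (Point d) n) λ p → (∀ i → StGenerator d (p i)) ×
      (∀ q k m → seq (sum (λ i → fromℚ q *ᴿ p i k)) m ≡ q * ι (lookup v k))
  sum-points nil = (λ ()) , (λ ()) , λ q k m →
    trans (sym (ℚ.*-zeroʳ q)) (cong (λ z → q * ι z) (sym (lookup-replicate k (+ 0))))
  sum-points {d} (cons {n} {u} {v} g s) with sum-points s
  ... | p , p-gen , Σp = p′ , p′-gen , λ q k m →
    trans (cong (λ z → q * ι (lookup u k) + z) (Σp q k m)) (trans (sym (ℚ.*-distribˡ-+ q (ι (lookup u k)) (ι (lookup v k))))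
      (cong (λ z → q * z) (trans (sym (ι-+ (lookup u k) (lookup v k))) (cong ι (sym (lookup-zipWith ℤ._+_ k u v))))))
    where
    p′ : Vector (Point d) (suc n)
    p′ zero    = fromℤᵈ u
    p′ (suc i) = p i
    p′-gen : ∀ i → StGenerator d (p′ i)
    p′-gen zero    = generator-complete g
    p′-gen (suc i) = p-gen i

  -- The missing weight is shared equally by e₁ and −e₁.
  cost≤⇒Dilate : ∀ {d} s (v : Vec ℤ (suc d)) → cost 0 v ℕ.≤ s → Dilate s (St (suc d)) (fromℤᵈ v)
  -- Division by s is impossible here. Cost 0 forces v = 0, and dilation by 0 sends any point of the
  -- polytope there.
  cost≤⇒Dilate {d} zero v c≤0 = e zero
    , (1 , (λ _ → e zero) , (λ _ → 1ℝ) , (λ _ → inj₁ (zero , inj₁ λ _ → ≈-refl)) , (λ _ → fromℚ-mono-≤ (ℚ.nonNegative⁻¹ 1ℚ))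
      , pointwise (λ _ → refl) , λ k → pointwise λ n → lem (seq (e zero k) n))
    , λ k → pointwise λ n → trans (cong ι (origin (decompose-generators v) (ℕ.n≤0⇒n≡0 c≤0) k)) (sym (ℚ.*-zeroˡ (seq (e zero k) n)))
    where
    lem : ∀ a → a ≡ 1ℚ * a + 0ℚ
    lem = solve-∀ ℚ-ring
    origin : ∀ {n} {w : Vec ℤ (suc d)} → Sum Generator n w → n ≡ 0 → ∀ k → lookup w k ≡ + 0
    origin nil refl k = lookup-replicate k (+ 0)
  cost≤⇒Dilate {d} s@(suc s-1) v c≤s with ℕ.m≤n⇒∃[o]m+o≡n c≤s | sum-points (decompose-generators v)
  ... | r , c+r≡s | p , p-gen , Σp =
    sumᵖ (λ i → fromℚ (w i) · pts i)
    , (2 ℕ.+ n , pts , (λ i → fromℚ (w i)) , pts-gen , (λ i → fromℚ-mono-≤ (w≥0 i)) , pointwise total , λ k → ≈-refl)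
    , λ k → pointwise λ m → place k m
    where
    n = cost 0 v
    instance
      s⁺ : ℚ.Positive (ιℕ s)
      s⁺ = ℚ.positive (ιℕ>0 s-1)
      s≢0 : ℚ.NonZero (ιℕ s)
      s≢0 = ℚ.pos⇒nonZero (ιℕ s)
    q half : ℚ
    q = 1/ ιℕ s
    half = ½ * (ιℕ r * q)
    sq≡1 : ιℕ s * q ≡ 1ℚ
    sq≡1 = ℚ.*-inverseʳ (ιℕ s)
    q≥0 : 0ℚ ℚ.≤ q
    q≥0 = ℚ.<⇒≤ (ℚ.positive⁻¹ q {{ℚ.1/pos⇒pos (ιℕ s)}})
    half≥0 : 0ℚ ℚ.≤ half
    half≥0 = nonNeg-* (ℚ.nonNegative⁻¹ ½) (nonNeg-* (ιℕ≥0 r) q≥0)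
    w : Fin (2 ℕ.+ n) → ℚ
    w zero          = half
    w (suc zero)    = half
    w (suc (suc i)) = q
    w≥0 : ∀ i → 0ℚ ℚ.≤ w i
    w≥0 zero          = half≥0
    w≥0 (suc zero)    = half≥0
    w≥0 (suc (suc i)) = q≥0
    pts : Vector (Point (suc d)) (2 ℕ.+ n)
    pts zero          = e zero
    pts (suc zero)    = -ᵖ (e zero)
    pts (suc (suc i)) = p i
    pts-gen : ∀ i → StGenerator (suc d) (pts i)
    pts-gen zero          = inj₁ (zero , inj₁ λ _ → ≈-refl)
    pts-gen (suc zero)    = inj₁ (zero , inj₂ λ _ → ≈-refl)
    pts-gen (suc (suc i)) = p-gen i
    total : ∀ m → seq (sum (λ i → fromℚ (w i))) m ≡ 1ℚ
    total m = trans (cong (λ z → half + (half + z)) (seq-sum-const {n} q m))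
      (trans (lem (ιℕ r) (ιℕ n) q) (trans (cong (_* q) (trans (sym (ιℕ-+ n r)) (cong ιℕ c+r≡s))) sq≡1))
      where
      lem : ∀ r n q → ½ * (r * q) + (½ * (r * q) + n * q) ≡ (n + r) * q
      lem = solve-∀ ℚ-ring
    place : ∀ k m → ι (lookup v k) ≡ ιℕ s * seq (sum (λ i → fromℚ (w i) *ᴿ pts i k)) m
    place k m = sym (trans (cong (λ z → ιℕ s * (half * E + (half * (- E) + z))) (Σp q k m))
      (trans (lem (ιℕ s) half E q (ι (lookup v k))) (trans (cong (_* ι (lookup v k)) sq≡1) (ℚ.*-identityˡ _))))
      where
      E = seq (e {suc d} zero k) m
      lem : ∀ s h E q x → s * (h * E + (h * (- E) + q * x)) ≡ (s * q) * x
      lem = solve-∀ ℚ-ring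

  dilate-cardinality : ∀ {d N} s → HasCardinality (λ (v : Vec ℤ (suc d)) → Dilate s (St (suc d)) (fromℤᵈ v)) N →
    N ≡ count (suc d) 0 s
  dilate-cardinality {d} s (xs , xs! , xs⇔ , len) = cardinality-unique
    (xs , xs! , (λ v → ⇔.trans (xs⇔ v) (mk⇔ (Dilate⇒cost≤ s v) (cost≤⇒Dilate s v))) , len)
    (points-cardinality (suc d) s)

-- Oriented directions in the plane and the half turns they make.

module SturmSequences where

  open import Data.Empty using (⊥; ⊥-elim)
  open import Data.Nat.Base as ℕ using (ℕ; zero; suc)
  import Data.Nat.Properties as ℕ
  open import Data.Product using (∃; ∃₂; _×_; _,_; proj₁; proj₂)
  open import Data.Rational
  open import Data.Rational.Properties
  open import Data.Sum using (_⊎_; inj₁; inj₂)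
  open import Relation.Binary.Definitions using (tri<; tri≈; tri>)
  open import Relation.Binary.PropositionalEquality
  open import Relation.Nullary using (yes; no; ¬_)
  open import Tactic.RingSolver using (solve-∀)
  open RationalOrder

  sg : ℕ → ℚ
  sg zero    = 1ℚ
  sg (suc n) = - sg n

  sg² : ∀ n → sg n * sg n ≡ 1ℚ
  sg² zero    = refl
  sg² (suc n) = trans (lem (sg n)) (sg² n)
    where
    lem : ∀ a → (- a) * (- a) ≡ a * a
    lem = solve-∀ ℚ-ring

  -- (fst, snd) is the one of ±(pₙ, pₙ₊₁) pointing into a fixed half plane, and
  -- roots the number of half turns made so far.
  record State : Set where
    constructor state
    field
      roots : ℕ
      fst snd : ℚ
  open State

  -- The half plane is half open: of each nonzero pair and its negative exactly one belongs to it,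
  -- so the boundary case of a zero first entry needs no separate convention.
  Valid : State → Set
  Valid (state c u v) = 0ℚ < u ⊎ (u ≡ 0ℚ × 0ℚ < v)

  valid⇒0≤ : ∀ s → Valid s → 0ℚ ≤ fst s
  valid⇒0≤ s (inj₁ u>0)       = <⇒≤ u>0
  valid⇒0≤ s (inj₂ (u≡0 , _)) = ≤-reflexive (sym u≡0)

  cross : State → State → ℚ
  cross (state _ u v) (state _ u′ v′) = u * v′ - v * u′

  cross-swap : ∀ u v u′ v′ → - (u * v′ - v * u′) ≡ u′ * v - v′ * u
  cross-swap = solve-∀ ℚ-ring

  -- Inside the half plane every direction with positive second entry lies strictly counterclockwise
  -- of every direction with nonpositive one: u v′ - v u′ ≥ u v′ > 0.
  cross-anti : ∀ {s t} → Valid s → Valid t → snd s ≤ 0ℚ → 0ℚ < snd t → cross s t ≤ 0ℚ → ⊥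
  cross-anti {state _ u v} {state c′ u′ v′} (inj₁ u>0) t! v≤0 v′>0 cr≤0 =
    <⇒≱ (pos-* u>0 v′>0) (≤-trans (0≤⇒≤ (nonNeg-* (nonPos⇒0≤- v≤0) (valid⇒0≤ (state c′ u′ v′) t!)) (lem u v u′ v′)) cr≤0)
    where
    lem : ∀ u v u′ v′ → (u * v′ - v * u′) - u * v′ ≡ (- v) * u′
    lem = solve-∀ ℚ-ring
  cross-anti (inj₂ (_ , v>0)) t! v≤0 v′>0 cr≤0 = <⇒≱ v>0 v≤0

  -- The recurrence sends (u, v) to (v, t v - b u), which is negated when v ≤ 0 to return to the
  -- half plane. For u > 0 the counter thus grows exactly when consecutive terms have the same
  -- strict sign, as in Sturm's count.
  step : ℚ → ℚ → State → State
  step t b (state c u v) with 0ℚ <? v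
  ... | yes _ = state (suc c) v (t * v - b * u)
  ... | no  _ = state c (- v) (b * u - t * v)

  step-valid : ∀ t {b} → 0ℚ < b → ∀ s → Valid s → Valid (step t b s)
  step-valid t {b} b>0 (state c u v) s! with 0ℚ <? v
  ... | yes v>0 = inj₁ v>0
  ... | no  v≯0 with s! | <-cmp v 0ℚ
  ...   | inj₂ (_ , v>0) | _             = ⊥-elim (v≯0 v>0)
  ...   | inj₁ u>0       | tri< v<0 _ _  = inj₁ (neg-antimono-< v<0)
  ...   | inj₁ u>0       | tri> _ _ v>0  = ⊥-elim (v≯0 v>0)
  ...   | inj₁ u>0       | tri≈ _ refl _ = inj₂ (refl , subst (0ℚ <_) (lem t b u) (pos-* b>0 u>0))
    where
    lem : ∀ t b u → b * u ≡ b * u - t * 0ℚ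
    lem = solve-∀ ℚ-ring

  infix 4 _⊑_

  -- The order of total angles without angles: half turns are compared before directions, and two
  -- directions in the same half plane are compared by the sign of their cross product.
  _⊑_ : State → State → Set
  s ⊑ t = roots s ℕ.< roots t ⊎ (roots s ≡ roots t × 0ℚ ≤ cross s t)

  -- The step is linear with determinant b > 0, so it keeps orientations, and raising t to t′ turns
  -- the image further by the nonnegative term (t′ - t) v v′. If only one of the two states is
  -- negated, the counters or `cross-anti` settle all but one case.
  ⊑-step : ∀ {t t′ b} → t ≤ t′ → 0ℚ < b → ∀ s s′ → Valid s → Valid s′ →
           s ⊑ s′ → step t b s ⊑ step t′ b s′
  ⊑-step {t} {t′} {b} t≤t′ b>0 (state c u v) (state c′ u′ v′) s! s′! s⊑s′ with 0ℚ <? v | 0ℚ <? v′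
  ⊑-step {t} {t′} {b} t≤t′ b>0 (state c u v) (state c′ u′ v′) s! s′! (inj₁ c<c′) | yes v>0 | yes v′>0 =
    inj₁ (ℕ.s≤s c<c′)
  ⊑-step {t} {t′} {b} t≤t′ b>0 (state c u v) (state c′ u′ v′) s! s′! (inj₂ (refl , cr)) | yes v>0 | yes v′>0 =
    inj₂ (refl , subst (0ℚ ≤_) (lem t t′ b u v u′ v′)
      (nonNeg-+ (nonNeg-* (≤⇒0≤ t≤t′) (<⇒≤ (pos-* v>0 v′>0))) (nonNeg-* (<⇒≤ b>0) cr)))
    where
    lem : ∀ t t′ b u v u′ v′ → (t′ - t) * (v * v′) + b * (u * v′ - v * u′)
          ≡ v * (t′ * v′ - b * u′) - (t * v - b * u) * v′
    lem = solve-∀ ℚ-ring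
  ⊑-step {t} {t′} {b} t≤t′ b>0 (state c u v) (state c′ u′ v′) s! s′! (inj₁ c<c′) | yes v>0 | no v′≯0
    with ℕ.m≤n⇒m<n∨m≡n c<c′
  ... | inj₁ c+1<c′ = inj₁ c+1<c′
  -- The counters have become equal, so the directions are compared. All three terms are nonnegative
  -- by v > 0 ≥ v′, u, u′ ≥ 0 and t ≤ t′.
  ... | inj₂ c+1≡c′ = inj₂ (c+1≡c′ , subst (0ℚ ≤_) (lem t t′ b u v u′ v′)
      (nonNeg-+ (nonNeg-+ (nonNeg-* (nonNeg-* (<⇒≤ b>0) (<⇒≤ v>0)) (valid⇒0≤ (state c′ u′ v′) s′!))
        (nonNeg-* (nonNeg-* (≤⇒0≤ t≤t′) (<⇒≤ v>0)) -v′≥0)) (nonNeg-* (nonNeg-* (<⇒≤ b>0) (valid⇒0≤ (state c u v) s!)) -v′≥0)))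
    where
    -v′≥0 : 0ℚ ≤ - v′
    -v′≥0 = nonPos⇒0≤- (≮⇒≥ v′≯0)
    lem : ∀ t t′ b u v u′ v′ → (b * v * u′ + (t′ - t) * v * (- v′)) + b * u * (- v′)
          ≡ v * (b * u′ - t′ * v′) - (t * v - b * u) * (- v′)
    lem = solve-∀ ℚ-ring
  ⊑-step {t} {t′} {b} t≤t′ b>0 (state c u v) (state c′ u′ v′) s! s′! (inj₂ (refl , cr)) | yes v>0 | no v′≯0 =
    ⊥-elim (cross-anti {state c u′ v′} {state c u v} s′! s! (≮⇒≥ v′≯0) v>0
      (subst (_≤ 0ℚ) (cross-swap u v u′ v′) (neg-antimono-≤ cr)))
  ⊑-step {t} {t′} {b} t≤t′ b>0 (state c u v) (state c′ u′ v′) s! s′! (inj₁ c<c′) | no v≯0 | yes v′>0 =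
    inj₁ (ℕ.m<n⇒m<1+n c<c′)
  ⊑-step {t} {t′} {b} t≤t′ b>0 (state c u v) (state c′ u′ v′) s! s′! (inj₂ (refl , cr)) | no v≯0 | yes v′>0 =
    inj₁ ℕ.≤-refl
  ⊑-step {t} {t′} {b} t≤t′ b>0 (state c u v) (state c′ u′ v′) s! s′! (inj₁ c<c′) | no v≯0 | no v′≯0 =
    inj₁ c<c′
  ⊑-step {t} {t′} {b} t≤t′ b>0 (state c u v) (state c′ u′ v′) s! s′! (inj₂ (refl , cr)) | no v≯0 | no v′≯0 =
    inj₂ (refl , subst (0ℚ ≤_) (lem t t′ b u v u′ v′)
      (nonNeg-+ (nonNeg-* (≤⇒0≤ t≤t′) (nonNeg-* (nonPos⇒0≤- (≮⇒≥ v≯0)) (nonPos⇒0≤- (≮⇒≥ v′≯0))))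
                (nonNeg-* (<⇒≤ b>0) cr)))
    where
    lem : ∀ t t′ b u v u′ v′ → (t′ - t) * ((- v) * (- v′)) + b * (u * v′ - v * u′)
          ≡ (- v) * (b * u′ - t′ * v′) - (b * u - t * v) * (- v′)
    lem = solve-∀ ℚ-ring

  step-roots : ∀ t b s → roots (step t b s) ≡ roots s ⊎ roots (step t b s) ≡ suc (roots s)
  step-roots t b (state c u v) with 0ℚ <? v
  ... | yes _ = inj₂ refl
  ... | no  _ = inj₁ refl

  -- At most half a turn apart.
  Near : State → State → Set
  Near s t = (roots t ≡ roots s × 0ℚ ≤ cross s t) ⊎ (roots t ≡ suc (roots s) × cross s t ≤ 0ℚ)

  -- Whether the counter grows depends only on the sign of v. A difference of -1 or 2 could arise in
  -- just two sign patterns, and in these `cross-anti` contradicts the assumed orientation.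
  near-step : ∀ {t t′ b} s s′ → Valid s → Valid s′ → Near s s′ →
    roots (step t′ b s′) ≡ roots (step t b s) ⊎ roots (step t′ b s′) ≡ suc (roots (step t b s))
  near-step (state c u v) (state c′ u′ v′) s! s′! near with 0ℚ <? v | 0ℚ <? v′ | near
  ... | yes _   | yes _    | inj₁ (refl , _)  = inj₁ refl
  ... | yes _   | yes _    | inj₂ (refl , _)  = inj₂ refl
  ... | no _    | no _     | inj₁ (refl , _)  = inj₁ refl
  ... | no _    | no _     | inj₂ (refl , _)  = inj₂ refl
  ... | yes _   | no _     | inj₂ (refl , _)  = inj₁ refl
  ... | no _    | yes _    | inj₁ (refl , _)  = inj₂ refl
  ... | yes v>0 | no v′≯0  | inj₁ (refl , cr) =
    ⊥-elim (cross-anti {state c u′ v′} {state c u v} s′! s! (≮⇒≥ v′≯0) v>0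
      (subst (_≤ 0ℚ) (cross-swap u v u′ v′) (neg-antimono-≤ cr)))
  ... | no v≯0  | yes v′>0 | inj₂ (refl , cr) =
    ⊥-elim (cross-anti {state c u v} {state (suc c) u′ v′} s! s′! (≮⇒≥ v≯0) v′>0 cr)

  -- Zero counts for a three-term recurrence with positive coefficients.

  module Recurrence (a b : ℕ → ℚ) (a>0 : ∀ n → 0ℚ < a n) (b>0 : ∀ n → 0ℚ < b n) where

    p : ℕ → ℚ → ℚ
    p zero          x = 1ℚ
    p (suc zero)    x = a 0 * x
    p (suc (suc n)) x = a (suc n) * x * p (suc n) x - b n * p n x

    st : ℕ → ℚ → State
    st zero    x = state 0 1ℚ (a 0 * x)
    st (suc n) x = step (a (suc n) * x) (b n) (st n x)

    -- The number of zeros of pₙ below x.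
    below# : ℕ → ℚ → ℕ
    below# n x = roots (st n x)

    st-valid : ∀ n x → Valid (st n x)
    st-valid zero    x = inj₁ (positive⁻¹ 1ℚ)
    st-valid (suc n) x = step-valid (a (suc n) * x) (b>0 n) (st n x) (st-valid n x)

    private
      expand : ∀ s t p b q → (- s) * (t * p - b * q) ≡ b * (s * q) - t * (s * p)
      expand = solve-∀ ℚ-ring

    -- Ties the state to the sequence: with c its counter, its entries are p n x and p (suc n) x up
    -- to the common sign (-1)ⁿ⁺ᶜ.
    st-sign : ∀ n x → sg n * p n x ≡ sg (below# n x) * fst (st n x) ×
                      sg n * p (suc n) x ≡ sg (below# n x) * snd (st n x)
    st-sign zero    x = refl , refl
    st-sign (suc n) x with st n x | st-sign n x
    ... | state c u v | eq₁ , eq₂ with 0ℚ <? v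
    ...   | yes _ =
      trans (sym (neg-distribˡ-* (sg n) (p (suc n) x))) (trans (cong -_ eq₂) (neg-distribˡ-* (sg c) v)) ,
      trans (expand (sg n) (a (suc n) * x) (p (suc n) x) (b n) (p n x))
        (trans (cong₂ (λ y z → (b n) * y - a (suc n) * x * z) eq₁ eq₂)
          (sym (expand (sg c) (a (suc n) * x) v (b n) u)))
    ...   | no _ =
      trans (sym (neg-distribˡ-* (sg n) (p (suc n) x))) (trans (cong -_ eq₂) (neg-distribʳ-* (sg c) v)) ,
      trans (expand (sg n) (a (suc n) * x) (p (suc n) x) (b n) (p n x))
        (trans (cong₂ (λ y z → (b n) * y - a (suc n) * x * z) eq₁ eq₂)
          (sym (l₂ (sg c) (a (suc n) * x) v (b n) u)))
      where
      l₂ : ∀ s t p b q → s * (b * q - t * p) ≡ b * (s * q) - t * (s * p)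
      l₂ = solve-∀ ℚ-ring

    st-mono : ∀ n {x y} → x ≤ y → st n x ⊑ st n y
    st-mono zero {x} {y} x≤y = inj₂ (refl , subst (0ℚ ≤_) (lem (a 0) x y) (nonNeg-* (<⇒≤ (a>0 0)) (≤⇒0≤ x≤y)))
      where
      lem : ∀ a x y → a * (y - x) ≡ 1ℚ * (a * y) - a * x * 1ℚ
      lem = solve-∀ ℚ-ring
    st-mono (suc n) {x} {y} x≤y =
      ⊑-step (*-monoˡ (<⇒≤ (a>0 (suc n))) x≤y) (b>0 n)
        (st n x) (st n y) (st-valid n x) (st-valid n y) (st-mono n x≤y)

    below#-mono : ∀ n {x y} → x ≤ y → below# n x ℕ.≤ below# n y
    below#-mono n x≤y with st-mono n x≤y
    ... | inj₁ c<c′       = ℕ.<⇒≤ c<c′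
    ... | inj₂ (c≡c′ , _) = ℕ.≤-reflexive c≡c′

    below#-reflects-< : ∀ n {x y} → below# n x ℕ.< below# n y → x < y
    below#-reflects-< n {x} {y} c<c′ = ≰⇒> (λ y≤x → ℕ.<⇒≱ c<c′ (below#-mono n y≤x))

    below#-suc : ∀ n x → below# n x ℕ.≤ below# (suc n) x × below# (suc n) x ℕ.≤ suc (below# n x)
    below#-suc n x with step-roots (a (suc n) * x) (b n) (st n x)
    ... | inj₁ eq = ℕ.≤-reflexive (sym eq) , ℕ.m≤n⇒m≤1+n (ℕ.≤-reflexive eq)
    ... | inj₂ eq = subst (below# n x ℕ.≤_) (sym eq) (ℕ.n≤1+n _) , ℕ.≤-reflexive eq

    -- If v ≥ u > 0 and a B ≥ 1 + b, then a B v - b u ≥ v + b (v - u) ≥ v. The terms at B therefore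
    -- stay positive and never decrease, and those at -B alternate in sign, so -B and B enclose all
    -- zeros up to index N.
    Dominates : ℚ → ℕ → Set
    Dominates B N = 0ℚ < B × 1ℚ ≤ a 0 * B × (∀ n → n ℕ.< N → 1ℚ + b n ≤ a (suc n) * B)

    dominates : ∀ N → ∃ λ B → Dominates B N
    dominates zero    = let B = 1/ a 0 in B , 1/a>0 , ≤-reflexive (sym (*-inverseʳ (a 0))) , λ _ ()
      where
      instance
        a⁺ : Positive (a 0)
        a⁺ = positive (a>0 0)
        a≢0 : NonZero (a 0)
        a≢0 = pos⇒nonZero (a 0)
      1/a>0 : 0ℚ < 1/ a 0
      1/a>0 = positive⁻¹ (1/ a 0) {{1/pos⇒pos (a 0)}}
    dominates (suc N) with dominates N
    ... | B , B>0 , first , rest = B + C , <-≤-trans B>0 B≤ ,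
        ≤-trans first (*-monoˡ (<⇒≤ (a>0 0)) B≤) , bound
      where
      instance
        a⁺ : Positive (a (suc N))
        a⁺ = positive (a>0 (suc N))
        a≢0 : NonZero (a (suc N))
        a≢0 = pos⇒nonZero (a (suc N))
      1+b>0 : 0ℚ < 1ℚ + b N
      1+b>0 = +-mono-< (positive⁻¹ 1ℚ) (b>0 N)
      C : ℚ
      C = 1/ a (suc N) * (1ℚ + b N)
      C>0 : 0ℚ < C
      C>0 = pos-* (positive⁻¹ (1/ a (suc N)) {{1/pos⇒pos (a (suc N))}}) 1+b>0
      B≤ : B ≤ B + C
      B≤ = 0≤⇒≤ (<⇒≤ C>0) (lem B C)
        where
        lem : ∀ B C → (B + C) - B ≡ C
        lem = solve-∀ ℚ-ring
      aC : a (suc N) * C ≡ 1ℚ + b N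
      aC = trans (sym (*-assoc (a (suc N)) (1/ a (suc N)) (1ℚ + b N)))
        (trans (cong (_* (1ℚ + b N)) (*-inverseʳ (a (suc N)))) (*-identityˡ (1ℚ + b N)))
      bound : ∀ n → n ℕ.< suc N → 1ℚ + b n ≤ a (suc n) * (B + C)
      bound n n<1+N with ℕ.m≤n⇒m<n∨m≡n n<1+N
      ... | inj₁ (ℕ.s≤s n<N) = ≤-trans (rest n n<N) (*-monoˡ (<⇒≤ (a>0 (suc n))) B≤)
      ... | inj₂ refl = 0≤⇒≤ (nonNeg-* (<⇒≤ (a>0 (suc N))) (<⇒≤ B>0))
          (trans (cong (λ z → a (suc N) * (B + C) - z) (sym aC)) (lem (a (suc N)) B C))
        where
        lem : ∀ a B C → a * (B + C) - a * C ≡ a * B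
        lem = solve-∀ ℚ-ring

    module _ {B : ℚ} {N : ℕ} (dom : Dominates B N) where

      private
        B>0 = proj₁ dom
        first = proj₁ (proj₂ dom)
        rest = proj₂ (proj₂ dom)

      below#-top : ∀ n → n ℕ.≤ N → below# n B ≡ n × 0ℚ < fst (st n B) × fst (st n B) ≤ snd (st n B)
      below#-top zero    _   = refl , positive⁻¹ 1ℚ , first
      below#-top (suc n) n<N with st n B | below#-top n (ℕ.<⇒≤ n<N)
      ... | state c u v | refl , u>0 , u≤v with 0ℚ <? v
      ...   | no  v≯0 = ⊥-elim (v≯0 (<-≤-trans u>0 u≤v))
      ...   | yes v>0 = refl , v>0 , 0≤⇒≤
                (nonNeg-+ (nonNeg-* (≤⇒0≤ (rest n n<N)) (<⇒≤ v>0)) (nonNeg-* (<⇒≤ (b>0 n)) (≤⇒0≤ u≤v)))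
                (lem (a (suc n) * B) (b n) u v)
        where
        lem : ∀ t b u v → (t * v - b * u) - v ≡ (t - (1ℚ + b)) * v + b * (v - u)
        lem = solve-∀ ℚ-ring

      below#-bottom : ∀ n → n ℕ.≤ N → below# n (- B) ≡ 0 × 0ℚ < fst (st n (- B)) × snd (st n (- B)) ≤ - fst (st n (- B))
      below#-bottom zero    _   = refl , positive⁻¹ 1ℚ , subst (_≤ - 1ℚ) (neg-distribʳ-* (a 0) B) (neg-antimono-≤ first)
      below#-bottom (suc n) n<N with st n (- B) | below#-bottom n (ℕ.<⇒≤ n<N)
      ... | state c u v | refl , u>0 , v≤-u with 0ℚ <? v
      ...   | yes v>0 = ⊥-elim (<-asym v>0 (≤-<-trans v≤-u (neg-antimono-< u>0)))
      ...   | no  v≯0 = refl , <-≤-trans u>0 u≤-v ,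
                0≤⇒≤ (nonNeg-+ (nonNeg-* (≤⇒0≤ (rest n n<N)) (nonPos⇒0≤- (≮⇒≥ v≯0)))
                               (nonNeg-* (<⇒≤ (b>0 n)) (≤⇒0≤ u≤-v)))
                     (lem (a (suc n)) B (b n) u v)
        where
        u≤-v : u ≤ - v
        u≤-v = subst (_≤ - v) (neg-involutive u) (neg-antimono-≤ v≤-u)
        lem : ∀ a B b u v → - (- v) - (b * u - a * (- B) * v) ≡ (a * B - (1ℚ + b)) * (- v) + b * ((- v) - u)
        lem = solve-∀ ℚ-ring

      InBox : ℚ → Set
      InBox x = ∣ x ∣ ≤ B

      private
        abs-*-≤ : ∀ {x y c e} → 0ℚ ≤ c → ∣ x ∣ ≤ c → ∣ y ∣ ≤ e → ∣ x * y ∣ ≤ c * e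
        abs-*-≤ {x} {y} {c} {e} c≥0 x≤ y≤ = begin
          ∣ x * y ∣     ≡⟨ ∣p*q∣≡∣p∣*∣q∣ x y ⟩
          ∣ x ∣ * ∣ y ∣ ≤⟨ *-monoʳ (0≤∣p∣ y) x≤ ⟩
          c * ∣ y ∣     ≤⟨ *-monoˡ c≥0 y≤ ⟩
          c * e         ∎
          where open ≤-Reasoning

        abs-+-≤ : ∀ {x y c e} → ∣ x ∣ ≤ c → ∣ y ∣ ≤ e → ∣ x + y ∣ ≤ c + e
        abs-+-≤ {x} {y} x≤ y≤ = ≤-trans (∣p+q∣≤∣p∣+∣q∣ x y) (+-mono-≤ x≤ y≤)

        abs-- : ∀ {x y c e} → ∣ x ∣ ≤ c → ∣ y ∣ ≤ e → ∣ x - y ∣ ≤ c + e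
        abs-- {x} {y} {e = e} x≤ y≤ = abs-+-≤ x≤ (subst (_≤ e) (sym (∣-p∣≡∣p∣ y)) y≤)

        abs-pos : ∀ {x} → 0ℚ < x → ∣ x ∣ ≤ x
        abs-pos x>0 = ≤-reflexive (0≤p⇒∣p∣≡p (<⇒≤ x>0))

      -- One constant bounds both the values and the difference quotients, because the product rule
      -- along the recurrence needs both.
      Lipschitz : (ℚ → ℚ) → ℚ → Set
      Lipschitz f M = 0ℚ < M × ∀ x y → InBox x → InBox y → ∣ f x ∣ ≤ M × ∣ f x - f y ∣ ≤ M * ∣ x - y ∣

      p-lipschitz : ∀ n → ∃ (Lipschitz (p n))
      p-lipschitz zero = 1ℚ , positive⁻¹ 1ℚ , λ x y _ _ → ≤-refl ,
        subst (0ℚ ≤_) (sym (*-identityˡ ∣ x - y ∣)) (0≤∣p∣ (x - y))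
      p-lipschitz (suc zero) = M , M>0 , λ x y x∈ y∈ →
        ≤-trans (abs-*-≤ (<⇒≤ (a>0 0)) (abs-pos (a>0 0)) x∈) (0≤⇒≤ (<⇒≤ (a>0 0)) (l₁ (a 0) B)) ,
        (begin
          ∣ a 0 * x - a 0 * y ∣ ≡⟨ cong ∣_∣ (l₂ (a 0) x y) ⟩
          ∣ a 0 * (x - y) ∣     ≤⟨ abs-*-≤ (<⇒≤ (a>0 0)) (abs-pos (a>0 0)) ≤-refl ⟩
          a 0 * ∣ x - y ∣
            ≤⟨ *-monoʳ (0≤∣p∣ (x - y)) (0≤⇒≤ {a 0} {M} (<⇒≤ (pos-* (a>0 0) B>0)) (l₃ (a 0) B)) ⟩
          M * ∣ x - y ∣         ∎)
        where
        open ≤-Reasoning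
        M = a 0 * B + a 0
        M>0 : 0ℚ < M
        M>0 = +-mono-< (pos-* (a>0 0) B>0) (a>0 0)
        l₁ : ∀ a B → (a * B + a) - a * B ≡ a
        l₁ = solve-∀ ℚ-ring
        l₂ : ∀ a x y → a * x - a * y ≡ a * (x - y)
        l₂ = solve-∀ ℚ-ring
        l₃ : ∀ a B → (a * B + a) - a ≡ a * B
        l₃ = solve-∀ ℚ-ring
      p-lipschitz (suc (suc n)) with p-lipschitz n | p-lipschitz (suc n)
      ... | M₀ , M₀>0 , lip₀ | M₁ , M₁>0 , lip₁ = M , M>0 , λ x y x∈ y∈ →
        ≤-trans (abs-- (abs-*-≤ (<⇒≤ aB>0) (abs-*-≤ (<⇒≤ (a>0 (suc n))) (abs-pos (a>0 (suc n))) x∈) (proj₁ (lip₁ x y x∈ y∈)))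
                        (abs-*-≤ (<⇒≤ (b>0 n)) (abs-pos (b>0 n)) (proj₁ (lip₀ x y x∈ y∈))))
                (0≤⇒≤ (<⇒≤ (pos-* (a>0 (suc n)) M₁>0)) (l₁ (a (suc n)) B M₁ (b n) M₀)) ,
        (begin
          ∣ p (2 ℕ.+ n) x - p (2 ℕ.+ n) y ∣
            ≡⟨ cong ∣_∣ (l₂ (a (suc n)) x y (p (suc n) x) (p (suc n) y) (b n) (p n x) (p n y)) ⟩
          ∣ a (suc n) * (x * (p (suc n) x - p (suc n) y) + (x - y) * p (suc n) y) - b n * (p n x - p n y) ∣
            ≤⟨ abs-- (abs-*-≤ (<⇒≤ (a>0 (suc n))) (abs-pos (a>0 (suc n)))
                       (abs-+-≤ (abs-*-≤ (<⇒≤ B>0) x∈ (proj₂ (lip₁ x y x∈ y∈)))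
                                (abs-*-≤ (0≤∣p∣ (x - y)) ≤-refl (proj₁ (lip₁ y x y∈ x∈)))))
                     (abs-*-≤ (<⇒≤ (b>0 n)) (abs-pos (b>0 n)) (proj₂ (lip₀ x y x∈ y∈))) ⟩
          a (suc n) * (B * (M₁ * ∣ x - y ∣) + ∣ x - y ∣ * M₁) + b n * (M₀ * ∣ x - y ∣)
            ≡⟨ l₃ (a (suc n)) B M₁ (b n) M₀ ∣ x - y ∣ ⟩
          M * ∣ x - y ∣ ∎)
        where
        open ≤-Reasoning
        aB>0 = pos-* (a>0 (suc n)) B>0
        M = a (suc n) * B * M₁ + a (suc n) * M₁ + b n * M₀
        M>0 : 0ℚ < M
        M>0 = +-mono-< (+-mono-< (pos-* aB>0 M₁>0) (pos-* (a>0 (suc n)) M₁>0)) (pos-* (b>0 n) M₀>0)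
        l₁ : ∀ a B M₁ b M₀ → (a * B * M₁ + a * M₁ + b * M₀) - (a * B * M₁ + b * M₀) ≡ a * M₁
        l₁ = solve-∀ ℚ-ring
        l₂ : ∀ a x y px py b qx qy → (a * x * px - b * qx) - (a * y * py - b * qy)
             ≡ a * (x * (px - py) + (x - y) * py) - b * (qx - qy)
        l₂ = solve-∀ ℚ-ring
        l₃ : ∀ a B M₁ b M₀ t → a * (B * (M₁ * t) + t * M₁) + b * (M₀ * t) ≡ (a * B * M₁ + a * M₁ + b * M₀) * t
        l₃ = solve-∀ ℚ-ring

      -- The Christoffel-Darboux kernel and the separation of zeros.

      -- Unfolded, this is the sum over k ≤ n of aₖ bₖ ⋯ bₙ₋₁ pₖ(x) pₖ(y). The products of the b
      -- replace the usual normalisation of the polynomials.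
      kernel : ℕ → ℚ → ℚ → ℚ
      kernel zero    x y = a 0
      kernel (suc n) x y = a (suc n) * (p (suc n) x * p (suc n) y) + b n * kernel n x y

      christoffel-darboux : ∀ n x y → p (suc n) y * p n x - p (suc n) x * p n y ≡ (y - x) * kernel n x y
      christoffel-darboux zero x y = lem (a 0) x y
        where
        lem : ∀ a x y → a * y * 1ℚ - a * x * 1ℚ ≡ (y - x) * a
        lem = solve-∀ ℚ-ring
      christoffel-darboux (suc n) x y = trans
        (l₁ (a (suc n)) x y (p (suc n) x) (p (suc n) y) (b n) (p n x) (p n y))
        (trans (cong (λ w → a (suc n) * (y - x) * (p (suc n) x * p (suc n) y) + b n * w) (christoffel-darboux n x y))
               (l₂ (a (suc n)) (y - x) (p (suc n) x * p (suc n) y) (b n) (kernel n x y)))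
        where
        l₁ : ∀ a x y px py b qx qy → (a * y * py - b * qy) * px - (a * x * px - b * qx) * py
             ≡ a * (y - x) * (px * py) + b * (py * qx - px * qy)
        l₁ = solve-∀ ℚ-ring
        l₂ : ∀ a t q b k → a * t * q + b * (t * k) ≡ t * (a * q + b * k)
        l₂ = solve-∀ ℚ-ring

      Close : ℚ → ℚ → ℚ → Set
      Close δ x y = InBox x × InBox y × ∣ x - y ∣ ≤ δ

      -- On the diagonal the kernel is a sum of squares with positive weights. Off it the products
      -- pₖ(x) pₖ(y) can be negative only by a multiple of the distance, so a uniform bound survives
      -- near the diagonal. The earlier kernels are carried along for `jump≤1`.
      kernel-bound : ∀ n → ∃₂ λ δ κ → 0ℚ < δ × 0ℚ < κ × (∀ x y → Close δ x y →
        κ ≤ kernel n x y × (∀ m → m ℕ.≤ n → 0ℚ ≤ kernel m x y))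
      kernel-bound zero = 1ℚ , a 0 , positive⁻¹ 1ℚ , a>0 0 , λ x y _ → ≤-refl , λ { .zero ℕ.z≤n → <⇒≤ (a>0 0) }
      kernel-bound (suc n) with kernel-bound n | p-lipschitz (suc n)
      ... | δ , κ , δ>0 , κ>0 , bound | M , M>0 , lip = δ ⊓ δ′ , κ′ , δ⊓δ′>0 , κ′>0 , λ x y (x∈ , y∈ , near) →
        let near₁ = ≤-trans near (p⊓q≤p δ δ′)
            near₂ = ≤-trans near (p⊓q≤q δ δ′)
            k≥κ , earlier = bound x y (x∈ , y∈ , near₁)
            k≥κ′ = κ′≤ x y x∈ y∈ near₂ k≥κ
        in k≥κ′ , λ m m≤1+n → extend x y earlier k≥κ′ m (ℕ.m≤n⇒m<n∨m≡n m≤1+n)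
        where
        open ≤-Reasoning
        aMM = a (suc n) * (M * M)
        aMM>0 : 0ℚ < aMM
        aMM>0 = pos-* (a>0 (suc n)) (pos-* M>0 M>0)
        κ′ = ½ * (b n * κ)
        κ′>0 : 0ℚ < κ′
        κ′>0 = half>0 (pos-* (b>0 n) κ>0)
        instance
          aMM≢0 : NonZero aMM
          aMM≢0 = pos⇒nonZero aMM {{positive aMM>0}}
        -- Chosen so that a M² δ′, the most that the new term can subtract, equals κ′, which is half
        -- of the inherited bound b κ.
        δ′ = 1/ aMM * κ′
        δ′>0 : 0ℚ < δ′
        δ′>0 = pos-* (positive⁻¹ (1/ aMM) {{1/pos⇒pos aMM {{positive aMM>0}}}}) κ′>0
        δ⊓δ′>0 : 0ℚ < δ ⊓ δ′
        δ⊓δ′>0 with ⊓-sel δ δ′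
        ... | inj₁ eq = subst (0ℚ <_) (sym eq) δ>0
        ... | inj₂ eq = subst (0ℚ <_) (sym eq) δ′>0
        aMMδ′ : aMM * δ′ ≡ κ′
        aMMδ′ = trans (sym (*-assoc aMM (1/ aMM) κ′)) (trans (cong (_* κ′) (*-inverseʳ aMM)) (*-identityˡ κ′))
        -- p(x) p(y) = p(x)² − p(x)(p(x) − p(y)) ≥ − M² |x − y|
        product-bound : ∀ x y → InBox x → InBox y → - (M * (M * ∣ x - y ∣)) ≤ p (suc n) x * p (suc n) y
        product-bound x y x∈ y∈ = 0≤⇒≤ (nonNeg-+ (sq-nonNeg px) (≤⇒0≤ (≤-trans (p≤∣p∣ (px * (px - py)))
            (abs-*-≤ (<⇒≤ M>0) (proj₁ (lip x y x∈ y∈)) (proj₂ (lip x y x∈ y∈))))))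
            (lem px py (M * (M * ∣ x - y ∣)))
          where
          px = p (suc n) x
          py = p (suc n) y
          lem : ∀ u v t → u * v - (- t) ≡ u * u + (t - u * (u - v))
          lem = solve-∀ ℚ-ring
        κ′≤ : ∀ x y → InBox x → InBox y → ∣ x - y ∣ ≤ δ′ → κ ≤ kernel n x y → κ′ ≤ kernel (suc n) x y
        κ′≤ x y x∈ y∈ near k≥κ = begin
          ½ * (b n * κ)
            ≡⟨ l₁ (b n * κ) ⟩
          - κ′ + b n * κ
            ≡⟨ cong (λ z → - z + b n * κ) (sym aMMδ′) ⟩
          - (aMM * δ′) + b n * κ
            ≤⟨ +-mono-≤ (neg-antimono-≤ (*-monoˡ (<⇒≤ aMM>0) near))
                        (*-monoˡ (<⇒≤ (b>0 n)) k≥κ) ⟩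
          - (aMM * ∣ x - y ∣) + b n * kernel n x y
            ≡⟨ cong (_+ b n * kernel n x y) (l₂ (a (suc n)) M ∣ x - y ∣) ⟩
          a (suc n) * (- (M * (M * ∣ x - y ∣))) + b n * kernel n x y
            ≤⟨ +-monoˡ-≤ (b n * kernel n x y)
                 (*-monoˡ (<⇒≤ (a>0 (suc n))) (product-bound x y x∈ y∈)) ⟩
          kernel (suc n) x y ∎
          where
          l₁ : ∀ t → ½ * t ≡ - (½ * t) + t
          l₁ = solve-∀ ℚ-ring
          l₂ : ∀ a M t → - (a * (M * M) * t) ≡ a * (- (M * (M * t)))
          l₂ = solve-∀ ℚ-ring
        extend : ∀ x y → (∀ m → m ℕ.≤ n → 0ℚ ≤ kernel m x y) → κ′ ≤ kernel (suc n) x y →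
                 ∀ m → m ℕ.< suc n ⊎ m ≡ suc n → 0ℚ ≤ kernel m x y
        extend x y earlier k≥κ′ m (inj₁ (ℕ.s≤s m≤n)) = earlier m m≤n
        extend x y earlier k≥κ′ m (inj₂ refl)        = ≤-trans (<⇒≤ κ′>0) k≥κ′

      private
        -- States are signed pairs of consecutive values, so their cross product is the
        -- Christoffel-Darboux difference up to a sign given by the parities of the two counts.
        cross≡ : ∀ n x y → cross (st n x) (st n y) ≡ sg (below# n x) * sg (below# n y) * ((y - x) * kernel n x y)
        cross≡ n x y = begin
          u * v′ - v * u′
            ≡⟨ cong₂ _-_ (cong₂ _*_ (unsign c u) (unsign c′ v′)) (cong₂ _*_ (unsign c v) (unsign c′ u′)) ⟩
          sg c * (sg c * u) * (sg c′ * (sg c′ * v′)) - sg c * (sg c * v) * (sg c′ * (sg c′ * u′))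
            ≡⟨ cong₂ (λ s t → s - t)
                 (cong₂ (λ s t → sg c * s * (sg c′ * t)) (sym (proj₁ (st-sign n x))) (sym (proj₂ (st-sign n y))))
                 (cong₂ (λ s t → sg c * s * (sg c′ * t)) (sym (proj₂ (st-sign n x))) (sym (proj₁ (st-sign n y)))) ⟩
          sg c * (sg n * p n x) * (sg c′ * (sg n * p (suc n) y)) - sg c * (sg n * p (suc n) x) * (sg c′ * (sg n * p n y))
            ≡⟨ l₁ (sg c) (sg c′) (sg n) (p n x) (p (suc n) y) (p (suc n) x) (p n y) ⟩
          sg c * sg c′ * (sg n * sg n * (p (suc n) y * p n x - p (suc n) x * p n y))
            ≡⟨ cong (sg c * sg c′ *_) (trans (cong₂ _*_ (sg² n) (christoffel-darboux n x y)) (*-identityˡ _)) ⟩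
          sg c * sg c′ * ((y - x) * kernel n x y) ∎
          where
          open ≡-Reasoning
          c = below# n x
          c′ = below# n y
          u = fst (st n x)
          v = snd (st n x)
          u′ = fst (st n y)
          v′ = snd (st n y)
          unsign : ∀ c u → u ≡ sg c * (sg c * u)
          unsign c u = trans (sym (*-identityˡ u)) (trans (cong (_* u) (sym (sg² c))) (*-assoc (sg c) (sg c) u))
          l₁ : ∀ s s′ t a b c d → s * (t * a) * (s′ * (t * b)) - s * (t * c) * (s′ * (t * d))
               ≡ s * s′ * (t * t * (b * a - c * d))
          l₁ = solve-∀ ℚ-ring

      near-of : ∀ n x y → x ≤ y → 0ℚ ≤ kernel n x y →
        below# n y ≡ below# n x ⊎ below# n y ≡ suc (below# n x) → Near (st n x) (st n y)
      near-of n x y x≤y k≥0 (inj₁ eq) = inj₁ (eq , subst (0ℚ ≤_)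
        (sym (trans (cross≡ n x y) (trans (cong (_* ((y - x) * kernel n x y))
          (trans (cong (λ c → sg (below# n x) * sg c) eq) (sg² (below# n x)))) (*-identityˡ _))))
        (nonNeg-* (≤⇒0≤ x≤y) k≥0))
      near-of n x y x≤y k≥0 (inj₂ eq) = inj₂ (eq , subst (_≤ 0ℚ)
        (sym (trans (cross≡ n x y) (trans (cong (_* ((y - x) * kernel n x y))
          (trans (cong (λ c → sg (below# n x) * sg c) eq)
            (trans (sym (neg-distribʳ-* (sg (below# n x)) (sg (below# n x)))) (cong -_ (sg² (below# n x)))))) (lem _))))
        (neg-antimono-≤ (nonNeg-* (≤⇒0≤ x≤y) k≥0)))
        where
        lem : ∀ t → (- 1ℚ) * t ≡ - t
        lem = solve-∀ ℚ-ring

      -- Two facts alternate in the induction: counts differing by at most one together with a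
      -- nonnegative kernel give the orientation required by `Near`, and nearness limits the
      -- difference of the next counts.
      jump≤1 : ∀ n x y → x ≤ y → (∀ m → m ℕ.< n → 0ℚ ≤ kernel m x y) →
        below# n y ≡ below# n x ⊎ below# n y ≡ suc (below# n x)
      jump≤1 zero    x y x≤y _   = inj₁ refl
      jump≤1 (suc n) x y x≤y k≥0 =
        near-step (st n x) (st n y) (st-valid n x) (st-valid n y)
          (near-of n x y x≤y (k≥0 n ℕ.≤-refl) (jump≤1 n x y x≤y (λ m m<n → k≥0 m (ℕ.m<n⇒m<1+n m<n))))

      close-jump : ∀ n → ∃ λ δ → 0ℚ < δ × (∀ x y → x ≤ y → Close δ x y →
        below# n y ≡ below# n x ⊎ below# n y ≡ suc (below# n x))
      close-jump n = let δ , _ , δ>0 , _ , bound = kernel-bound n in δ , δ>0 , λ x y x≤y close →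
        jump≤1 n x y x≤y (λ m m<n → proj₂ (bound x y close) m (ℕ.<⇒≤ m<n))

      -- Bisection on the zero count.

      -- Keeps at most k zeros below the lower end and more than k below the upper end, so it closes
      -- in on the zero with index k, counted from 0. The test is a comparison of natural numbers at
      -- a rational midpoint.
      bracket : ℕ → ℕ → ℕ → ℚ × ℚ
      bracket n k zero    = - B , B
      bracket n k (suc i) with bracket n k i
      ... | l , u with below# n (½ * (l + u)) ℕ.≤? k
      ...   | yes _ = ½ * (l + u) , u
      ...   | no  _ = l , ½ * (l + u)

      lo up : ℕ → ℕ → ℕ → ℚ
      lo n k i = proj₁ (bracket n k i)
      up n k i = proj₂ (bracket n k i)

      private
        above-mid : ∀ l u → u - ½ * (l + u) ≡ ½ * (u - l)
        above-mid = solve-∀ ℚ-ring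
        below-mid : ∀ l u → ½ * (l + u) - l ≡ ½ * (u - l)
        below-mid = solve-∀ ℚ-ring
        half-out : ∀ c h → ½ * (c * h) ≡ c * (½ * h)
        half-out = solve-∀ ℚ-ring

      bracket-width : ∀ n k i → up n k i - lo n k i ≡ (B + B) * ½^ i
      bracket-width n k zero    = lem B
        where
        lem : ∀ B → B - (- B) ≡ (B + B) * 1ℚ
        lem = solve-∀ ℚ-ring
      bracket-width n k (suc i) with bracket n k i | bracket-width n k i
      ... | l , u | eq with below# n (½ * (l + u)) ℕ.≤? k
      ...   | yes _ = trans (above-mid l u) (trans (cong (½ *_) eq) (half-out (B + B) (½^ i)))
      ...   | no  _ = trans (below-mid l u) (trans (cong (½ *_) eq) (half-out (B + B) (½^ i)))

      lo≤up : ∀ n k i → lo n k i ≤ up n k i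
      lo≤up n k i = 0≤⇒≤ (nonNeg-* (<⇒≤ (+-mono-< B>0 B>0)) (<⇒≤ (½^>0 i))) (bracket-width n k i)

      bracket-inside : ∀ n k i → - B ≤ lo n k i × up n k i ≤ B
      bracket-inside n k zero    = ≤-refl , ≤-refl
      bracket-inside n k (suc i) with bracket n k i | bracket-inside n k i | lo≤up n k i
      ... | l , u | l≥ , u≤ | l≤u with below# n (½ * (l + u)) ℕ.≤? k
      ...   | yes _ = ≤-trans l≥ (0≤⇒≤ (nonNeg-* (nonNegative⁻¹ ½) (≤⇒0≤ l≤u)) (below-mid l u)) , u≤
      ...   | no  _ = l≥ , ≤-trans (0≤⇒≤ (nonNeg-* (nonNegative⁻¹ ½) (≤⇒0≤ l≤u)) (above-mid l u)) u≤

      bracket-counts : ∀ n k → n ℕ.≤ N → k ℕ.< n → ∀ i →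
        below# n (lo n k i) ℕ.≤ k × k ℕ.< below# n (up n k i)
      bracket-counts n k n≤N k<n zero =
        subst (ℕ._≤ k) (sym (proj₁ (below#-bottom n n≤N))) ℕ.z≤n ,
        subst (k ℕ.<_) (sym (proj₁ (below#-top n n≤N))) k<n
      bracket-counts n k n≤N k<n (suc i) with bracket n k i | bracket-counts n k n≤N k<n i
      ... | l , u | l# , u# with below# n (½ * (l + u)) ℕ.≤? k
      ...   | yes m# = m# , u#
      ...   | no  m# = l# , ℕ.≰⇒> m#

      private
        neg-flip : ∀ {x} → - B ≤ x → - x ≤ B
        neg-flip {x} -B≤x = subst (- x ≤_) (neg-involutive B) (neg-antimono-≤ -B≤x)

      lo∈ : ∀ n k i → InBox (lo n k i)
      lo∈ n k i = let l≥ , u≤ = bracket-inside n k i in ∣p∣≤ (≤-trans (lo≤up n k i) u≤) (neg-flip l≥)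

      up∈ : ∀ n k i → InBox (up n k i)
      up∈ n k i = let l≥ , u≤ = bracket-inside n k i in ∣p∣≤ u≤ (neg-flip (≤-trans l≥ (lo≤up n k i)))

      lo<up : ∀ {n k} → n ℕ.≤ N → k ℕ.< n → ∀ i j → lo n k i < up n k j
      lo<up {n} {k} n≤N k<n i j = below#-reflects-< n
        (ℕ.≤-<-trans (proj₁ (bracket-counts n k n≤N k<n i)) (proj₂ (bracket-counts n k n≤N k<n j)))

      width : ℕ → ℚ
      width i = (B + B) * ½^ i

      width-small : ∀ ε → 0ℚ < ε → ∃ λ I → ∀ i → I ℕ.≤ i → width i < ε
      width-small = ½^-small (B + B)

      up≡ : ∀ n k i → up n k i ≡ lo n k i + width i
      up≡ n k i = trans (lem (up n k i) (lo n k i)) (cong (lo n k i +_) (bracket-width n k i))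
        where
        lem : ∀ u l → u ≡ l + (u - l)
        lem = solve-∀ ℚ-ring

      lo-cauchy : ∀ {n k} → n ℕ.≤ N → k ℕ.< n → ∀ ε → 0ℚ < ε →
        ∃ λ I → ∀ i j → I ℕ.≤ i → I ℕ.≤ j → ∣ lo n k i - lo n k j ∣ < ε
      lo-cauchy {n} {k} n≤N k<n ε ε>0 = let I , small = width-small ε ε>0 in I , λ i j I≤i I≤j →
        ∣p∣< (<-trans (gap i j) (small j I≤j))
             (subst (_< ε) (lem (lo n k j) (lo n k i)) (<-trans (gap j i) (small i I≤i)))
        where
        lem : ∀ a b → a - b ≡ - (b - a)
        lem = solve-∀ ℚ-ring
        gap : ∀ i j → lo n k i - lo n k j < width j
        gap i j = 0<⇒< (<⇒0< (subst (lo n k i <_) (up≡ n k j) (lo<up n≤N k<n i j)))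
          (l₁ (lo n k i) (lo n k j) (width j))
          where
          l₁ : ∀ a b w → w - (a - b) ≡ (b + w) - a
          l₁ = solve-∀ ℚ-ring

      -- Across a narrow bracket the count rises by exactly one, so the values at its ends have
      -- weakly opposite signs. Hence |p(l)| ≤ |p(l) - p(u)|, and the Lipschitz bound compares this
      -- with the width.
      p-lo-small : ∀ {n k} → n ℕ.≤ N → k ℕ.< n → ∀ ε → 0ℚ < ε →
        ∃ λ I → ∀ i → I ℕ.≤ i → ∣ p n (lo n k i) ∣ < ε
      p-lo-small {n} {k} n≤N k<n ε ε>0 with close-jump n | p-lipschitz n
      ... | δ , δ>0 , jump | M , M>0 , lip = proj₁ small₁ ℕ.⊔ proj₁ small₂ , λ i I≤i →
        bound i (proj₂ small₁ i (ℕ.m⊔n≤o⇒m≤o (proj₁ small₁) (proj₁ small₂) I≤i))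
                (proj₂ small₂ i (ℕ.m⊔n≤o⇒n≤o (proj₁ small₁) (proj₁ small₂) I≤i))
        where
        small₁ = width-small δ δ>0
        small₂ = ½^-small (M * (B + B)) ε ε>0
        open ≤-Reasoning
        ∣lo-up∣ : ∀ i → ∣ lo n k i - up n k i ∣ ≡ width i
        ∣lo-up∣ i = trans (∣-∣-comm (lo n k i) (up n k i)) (trans (cong ∣_∣ (bracket-width n k i))
          (0≤p⇒∣p∣≡p (nonNeg-* (<⇒≤ (+-mono-< B>0 B>0)) (<⇒≤ (½^>0 i)))))
        counts : ∀ l u → below# n l ℕ.≤ k → k ℕ.< below# n u →
          below# n u ≡ below# n l ⊎ below# n u ≡ suc (below# n l) → below# n u ≡ suc (below# n l)
        counts l u l# u# (inj₁ eq) = ⊥-elim (ℕ.<⇒≱ u# (subst (ℕ._≤ k) (sym eq) l#))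
        counts l u l# u# (inj₂ eq) = eq
        opposite : ∀ l u → below# n u ≡ suc (below# n l) → ∣ p n l ∣ ≤ ∣ p n l - p n u ∣
        opposite l u eq = begin
          ∣ p n l ∣             ≡⟨ scale (p n l) ⟩
          ∣ sg n * p n l ∣      ≡⟨ cong ∣_∣ (proj₁ (st-sign n l)) ⟩
          ∣ sg c * fst (st n l) ∣ ≡⟨ scale′ c (fst (st n l)) ⟩
          ∣ fst (st n l) ∣      ≡⟨ 0≤p⇒∣p∣≡p ul≥0 ⟩
          fst (st n l)          ≤⟨ 0≤⇒≤ uu≥0 (l₁ (fst (st n l)) (fst (st n u))) ⟩
          fst (st n l) + fst (st n u) ≡⟨ 0≤p⇒∣p∣≡p (nonNeg-+ ul≥0 uu≥0) ⟨
          ∣ fst (st n l) + fst (st n u) ∣ ≡⟨ scale′ c _ ⟨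
          ∣ sg c * (fst (st n l) + fst (st n u)) ∣ ≡⟨ cong ∣_∣ (l₂ (sg c) (fst (st n l)) (fst (st n u))) ⟩
          ∣ sg c * fst (st n l) - (- sg c) * fst (st n u) ∣
            ≡⟨ cong₂ (λ s t → ∣ s - t ∣) (sym (proj₁ (st-sign n l)))
                 (trans (cong (λ c → sg c * fst (st n u)) (sym eq)) (sym (proj₁ (st-sign n u)))) ⟩
          ∣ sg n * p n l - sg n * p n u ∣ ≡⟨ cong ∣_∣ (l₃ (sg n) (p n l) (p n u)) ⟩
          ∣ sg n * (p n l - p n u) ∣ ≡⟨ scale (p n l - p n u) ⟨
          ∣ p n l - p n u ∣ ∎
          where
          c = below# n l
          ul≥0 = valid⇒0≤ (st n l) (st-valid n l)
          uu≥0 = valid⇒0≤ (st n u) (st-valid n u)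
          ∣sg∣ : ∀ n → ∣ sg n ∣ ≡ 1ℚ
          ∣sg∣ zero    = refl
          ∣sg∣ (suc n) = trans (∣-p∣≡∣p∣ (sg n)) (∣sg∣ n)
          scale′ : ∀ m q → ∣ sg m * q ∣ ≡ ∣ q ∣
          scale′ m q = trans (∣p*q∣≡∣p∣*∣q∣ (sg m) q) (trans (cong (_* ∣ q ∣) (∣sg∣ m)) (*-identityˡ ∣ q ∣))
          scale : ∀ q → ∣ q ∣ ≡ ∣ sg n * q ∣
          scale q = sym (scale′ n q)
          l₁ : ∀ a b → (a + b) - a ≡ b
          l₁ = solve-∀ ℚ-ring
          l₂ : ∀ s a b → s * (a + b) ≡ s * a - (- s) * b
          l₂ = solve-∀ ℚ-ring
          l₃ : ∀ s a b → s * a - s * b ≡ s * (a - b)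
          l₃ = solve-∀ ℚ-ring
        bound : ∀ i → width i < δ → M * (B + B) * ½^ i < ε → ∣ p n (lo n k i) ∣ < ε
        bound i w<δ Mw<ε = let l = lo n k i ; u = up n k i ; l# , u# = bracket-counts n k n≤N k<n i in
          begin-strict
          ∣ p n l ∣              ≤⟨ opposite l u (counts l u l# u# (jump l u (lo≤up n k i)
                                      (lo∈ n k i , up∈ n k i , ≤-trans (≤-reflexive (∣lo-up∣ i)) (<⇒≤ w<δ)))) ⟩
          ∣ p n l - p n u ∣      ≤⟨ proj₂ (lip l u (lo∈ n k i) (up∈ n k i)) ⟩
          M * ∣ l - u ∣          ≡⟨ cong (M *_) (∣lo-up∣ i) ⟩
          M * ((B + B) * ½^ i)   ≡⟨ *-assoc M (B + B) (½^ i) ⟨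
          M * (B + B) * ½^ i     <⟨ Mw<ε ⟩
          ε                      ∎

      -- From the lower end for k to the upper end for k′ the count rises by at least two, so
      -- `close-jump` puts them more than δ apart. The width of the bracket then takes away at most
      -- δ/2.
      lo-gap : ∀ {n k k′} → n ℕ.≤ N → k ℕ.< k′ → k′ ℕ.< n →
        ∃ λ δ → 0ℚ < δ × ∃ λ I → ∀ i → I ℕ.≤ i → δ ≤ lo n k′ i - lo n k i
      lo-gap {n} {k} {k′} n≤N k<k′ k′<n with close-jump n
      ... | δ , δ>0 , jump = ½ * δ , half>0 δ>0 , proj₁ small , λ i I≤i → bound i (proj₂ small i I≤i)
        where
        small = width-small (½ * δ) (half>0 δ>0)
        open ≤-Reasoning
        far : ∀ i → δ < up n k′ i - lo n k i
        far i = ≰⇒> λ near → too-far (jump l u (<⇒≤ l<u)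
            (lo∈ n k i , up∈ n k′ i , ≤-trans (≤-reflexive (trans (∣-∣-comm l u) (0≤p⇒∣p∣≡p (≤⇒0≤ (<⇒≤ l<u))))) near))
          where
          l = lo n k i
          u = up n k′ i
          l# : below# n l ℕ.≤ k
          l# = proj₁ (bracket-counts n k n≤N (ℕ.<-trans k<k′ k′<n) i)
          u# : k′ ℕ.< below# n u
          u# = proj₂ (bracket-counts n k′ n≤N k′<n i)
          l<u : l < u
          l<u = below#-reflects-< n (ℕ.≤-<-trans l# (ℕ.<-trans k<k′ u#))
          too-far : ¬ (below# n u ≡ below# n l ⊎ below# n u ≡ suc (below# n l))
          too-far (inj₁ eq) = ℕ.<⇒≱ (ℕ.<-trans k<k′ u#) (subst (ℕ._≤ k) (sym eq) l#)
          too-far (inj₂ eq) = ℕ.<⇒≱ u# (subst (ℕ._≤ k′) (sym eq) (ℕ.≤-trans (ℕ.s≤s l#) k<k′))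
        bound : ∀ i → width i < ½ * δ → ½ * δ ≤ lo n k′ i - lo n k i
        bound i w< = 0≤⇒≤ (nonNeg-+ (<⇒≤ (<⇒0< (far i))) (<⇒≤ (<⇒0< w<)))
          (trans (l₁ (lo n k′ i) (lo n k i) δ (width i))
            (cong (λ u → ((u - lo n k i) - δ) + (½ * δ - width i)) (sym (up≡ n k′ i))))
          where
          l₁ : ∀ a b δ w → (a - b) - ½ * δ ≡ (((a + w) - b) - δ) + (½ * δ - w)
          l₁ = solve-∀ ℚ-ring

      private
        lo≤lo+ε : ∀ {m k n k′} → (∀ i → lo m k i < up n k′ i) →
          ∀ ε → 0ℚ < ε → ∃ λ I → ∀ i → I ℕ.≤ i → lo m k i ≤ lo n k′ i + ε
        lo≤lo+ε {m} {k} {n} {k′} lt ε ε>0 = let I , small = width-small ε ε>0 in I , λ i I≤i →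
          ≤-trans (<⇒≤ (lt i)) (≤-trans (≤-reflexive (up≡ n k′ i)) (+-monoʳ-≤ (lo n k′ i) (<⇒≤ (small i I≤i))))

      -- At the lower end for n + 1 the count for n + 1 is at most k; at the upper end for n it
      -- exceeds k, since it is not below the count for n. The tolerance ε pays for passing from
      -- that upper end to the lower one.
      interlace-left : ∀ {n k} → suc n ℕ.≤ N → k ℕ.< n → ∀ ε → 0ℚ < ε →
        ∃ λ I → ∀ i → I ℕ.≤ i → lo (suc n) k i ≤ lo n k i + ε
      interlace-left {n} {k} n<N k<n = lo≤lo+ε {suc n} {k} {n} {k} λ i → below#-reflects-< (suc n) (ℕ.≤-<-trans
        (proj₁ (bracket-counts (suc n) k n<N (ℕ.m<n⇒m<1+n k<n) i))
        (ℕ.<-≤-trans (proj₂ (bracket-counts n k (ℕ.<⇒≤ n<N) k<n i)) (proj₁ (below#-suc n (up n k i)))))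

      interlace-right : ∀ {n k} → suc n ℕ.≤ N → k ℕ.< n → ∀ ε → 0ℚ < ε →
        ∃ λ I → ∀ i → I ℕ.≤ i → lo n k i ≤ lo (suc n) (suc k) i + ε
      interlace-right {n} {k} n<N k<n = lo≤lo+ε {n} {k} {suc n} {suc k} λ i → below#-reflects-< (suc n) (ℕ.≤-<-trans
        (ℕ.≤-trans (proj₂ (below#-suc n (lo n k i))) (ℕ.s≤s (proj₁ (bracket-counts n k (ℕ.<⇒≤ n<N) k<n i))))
        (proj₂ (bracket-counts (suc n) (suc k) n<N (ℕ.s≤s k<n) i)))

-- Complex polynomials: cancellation, factorization, identity theorem.

module ComplexPolynomials where

  open import Data.Empty using (⊥-elim)
  open import Data.Fin.Base as Fin using (zero; suc)
  open import Data.Integer.Base as ℤ using ()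
  open import Data.List.Base using ([]; _∷_; map; length)
  open import Data.Nat.Base as ℕ using (ℕ; zero; suc)
  import Data.Nat.Properties as ℕ
  open import Data.Product using (_,_)
  open import Data.Rational
  open import Data.Rational.Properties
  open import Data.Vec.Functional using (Vector)
  open import Defs using (seq; _≈_; mk≈; close; 0ℝ; fromℚ; ℂ; _+i_; re; im; _≈ᶜ_; mk≈ᶜ; re≈; im≈; _+ᶜ_; _-ᶜ_; _*ᶜ_; 0ᶜ; 1ᶜ; ratᶜ;
    product; ℂ[x]; eval; evalℚ; coeff; toℂ[x])
    renaming (-_ to -ᴿ_)
  open import Function.Base using (_∘_)
  open import Relation.Binary.Definitions using (tri<; tri≈; tri>)
  open import Relation.Binary.PropositionalEquality
  open import Tactic.RingSolver using (solve-∀)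
  open RationalOrder
  open RealNumbers

  *ᶜ-zeroʳ : ∀ z → z *ᶜ 0ᶜ ≈ᶜ 0ᶜ
  *ᶜ-zeroʳ z = pointwiseᶜ (λ n → l₁ (seq (re z) n) (seq (im z) n)) (λ n → l₂ (seq (re z) n) (seq (im z) n))
    where
    l₁ : ∀ a b → a * 0ℚ + - (b * 0ℚ) ≡ 0ℚ
    l₁ = solve-∀ ℚ-ring
    l₂ : ∀ a b → a * 0ℚ + b * 0ℚ ≡ 0ℚ
    l₂ = solve-∀ ℚ-ring

  *ᶜ-comm : ∀ z w → z *ᶜ w ≈ᶜ w *ᶜ z
  *ᶜ-comm z w = pointwiseᶜ
    (λ n → l₁ (seq (re z) n) (seq (im z) n) (seq (re w) n) (seq (im w) n))
    (λ n → l₂ (seq (re z) n) (seq (im z) n) (seq (re w) n) (seq (im w) n))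
    where
    l₁ : ∀ a b c e → a * c + - (b * e) ≡ c * a + - (e * b)
    l₁ = solve-∀ ℚ-ring
    l₂ : ∀ a b c e → a * e + b * c ≡ c * b + e * a
    l₂ = solve-∀ ℚ-ring

  *ᶜ-assoc : ∀ x y z → (x *ᶜ y) *ᶜ z ≈ᶜ x *ᶜ (y *ᶜ z)
  *ᶜ-assoc x y z = pointwiseᶜ
    (λ n → l₁ (seq (re x) n) (seq (im x) n) (seq (re y) n) (seq (im y) n) (seq (re z) n) (seq (im z) n))
    (λ n → l₂ (seq (re x) n) (seq (im x) n) (seq (re y) n) (seq (im y) n) (seq (re z) n) (seq (im z) n))
    where
    l₁ : ∀ a b c e f g → (a * c + - (b * e)) * f + - ((a * e + b * c) * g)
         ≡ a * (c * f + - (e * g)) + - (b * (c * g + e * f))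
    l₁ = solve-∀ ℚ-ring
    l₂ : ∀ a b c e f g → (a * c + - (b * e)) * g + (a * e + b * c) * f
         ≡ a * (c * g + e * f) + b * (c * f + - (e * g))
    l₂ = solve-∀ ℚ-ring

  *ᶜ-swap : ∀ x y z → x *ᶜ (y *ᶜ z) ≈ᶜ y *ᶜ (x *ᶜ z)
  *ᶜ-swap x y z = ≈ᶜ-trans (≈ᶜ-sym (*ᶜ-assoc x y z)) (≈ᶜ-trans (*ᶜ-cong (*ᶜ-comm x y) ≈ᶜ-refl) (*ᶜ-assoc y x z))

  *ᶜ-identityʳ : ∀ z → z *ᶜ 1ᶜ ≈ᶜ z
  *ᶜ-identityʳ z = pointwiseᶜ (λ n → l₁ (seq (re z) n) (seq (im z) n)) (λ n → l₂ (seq (re z) n) (seq (im z) n))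
    where
    l₁ : ∀ a b → a * 1ℚ + - (b * 0ℚ) ≡ a
    l₁ = solve-∀ ℚ-ring
    l₂ : ∀ a b → a * 0ℚ + b * 1ℚ ≡ b
    l₂ = solve-∀ ℚ-ring

  *ᶜ-distribˡ : ∀ x y z → x *ᶜ (y +ᶜ z) ≈ᶜ x *ᶜ y +ᶜ x *ᶜ z
  *ᶜ-distribˡ x y z = pointwiseᶜ
    (λ n → l₁ (seq (re x) n) (seq (im x) n) (seq (re y) n) (seq (im y) n) (seq (re z) n) (seq (im z) n))
    (λ n → l₂ (seq (re x) n) (seq (im x) n) (seq (re y) n) (seq (im y) n) (seq (re z) n) (seq (im z) n))
    where
    l₁ : ∀ a b c e f g → a * (c + f) + - (b * (e + g)) ≡ (a * c + - (b * e)) + (a * f + - (b * g))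
    l₁ = solve-∀ ℚ-ring
    l₂ : ∀ a b c e f g → a * (e + g) + b * (c + f) ≡ (a * e + b * c) + (a * g + b * f)
    l₂ = solve-∀ ℚ-ring

  +ᶜ-identityʳ : ∀ z → z +ᶜ 0ᶜ ≈ᶜ z
  +ᶜ-identityʳ z = pointwiseᶜ (λ n → +-identityʳ (seq (re z) n)) (λ n → +-identityʳ (seq (im z) n))

  +ᶜ-identityˡ : ∀ z → 0ᶜ +ᶜ z ≈ᶜ z
  +ᶜ-identityˡ z = pointwiseᶜ (λ n → +-identityˡ (seq (re z) n)) (λ n → +-identityˡ (seq (im z) n))

  +ᶜ-interchange : ∀ x y z w → (x +ᶜ y) +ᶜ (z +ᶜ w) ≈ᶜ (x +ᶜ z) +ᶜ (y +ᶜ w)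
  +ᶜ-interchange x y z w = pointwiseᶜ
    (λ n → lem (seq (re x) n) (seq (re y) n) (seq (re z) n) (seq (re w) n))
    (λ n → lem (seq (im x) n) (seq (im y) n) (seq (im z) n) (seq (im w) n))
    where
    lem : ∀ a b c e → (a + b) + (c + e) ≡ (a + c) + (b + e)
    lem = solve-∀ ℚ-ring

  sum-zero : ∀ {x y} → x ≈ᶜ 0ᶜ → y ≈ᶜ 0ᶜ → x +ᶜ y ≈ᶜ 0ᶜ
  sum-zero x≈0 y≈0 = ≈ᶜ-trans (+ᶜ-cong x≈0 y≈0) (+ᶜ-identityʳ 0ᶜ)

  product-zero : ∀ x {y} → y ≈ᶜ 0ᶜ → x *ᶜ y ≈ᶜ 0ᶜ
  product-zero x y≈0 = ≈ᶜ-trans (*ᶜ-cong ≈ᶜ-refl y≈0) (*ᶜ-zeroʳ x)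

  zero-left : ∀ {x y} → x ≈ᶜ 0ᶜ → x +ᶜ y ≈ᶜ y
  zero-left {y = y} x≈0 = ≈ᶜ-trans (+ᶜ-cong x≈0 ≈ᶜ-refl) (+ᶜ-identityˡ y)

  zero-right : ∀ {x y} → y ≈ᶜ 0ᶜ → x +ᶜ y ≈ᶜ x
  zero-right {x} y≈0 = ≈ᶜ-trans (+ᶜ-cong ≈ᶜ-refl y≈0) (+ᶜ-identityʳ x)

  fromℚ-injective : ∀ {p q} → fromℚ p ≈ fromℚ q → p ≡ q
  fromℚ-injective {p} {q} p≈q with <-cmp p q
  ... | tri≈ _ eq _ = eq
  ... | tri< p<q _ _ = ⊥-elim (let N , small = close p≈q (q - p) (<⇒0< p<q) in
    <-irrefl (trans (∣-∣-comm p q) (0≤p⇒∣p∣≡p (<⇒≤ (<⇒0< p<q)))) (small N ℕ.≤-refl))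
  ... | tri> _ _ q<p = ⊥-elim (let N , small = close p≈q (p - q) (<⇒0< q<p) in
    <-irrefl (0≤p⇒∣p∣≡p (<⇒≤ (<⇒0< q<p))) (small N ℕ.≤-refl))

  -- The form in which nonvanishing is used. It passes to products directly, with no reciprocals of
  -- complex numbers.
  Cancelable : ℂ → Set
  Cancelable w = ∀ {y} → w *ᶜ y ≈ᶜ 0ᶜ → y ≈ᶜ 0ᶜ

  1-cancelable : Cancelable 1ᶜ
  1-cancelable {y} eq = ≈ᶜ-trans (≈ᶜ-sym (≈ᶜ-trans (*ᶜ-comm 1ᶜ y) (*ᶜ-identityʳ y))) eq

  *-cancelable : ∀ {u v} → Cancelable u → Cancelable v → Cancelable (u *ᶜ v)
  *-cancelable {u} {v} cu cv {y} eq = cv (cu (≈ᶜ-trans (≈ᶜ-sym (*ᶜ-assoc u v y)) eq))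

  normSq : ℂ → ℕ → ℚ
  normSq w n = seq (re w) n * seq (re w) n + seq (im w) n * seq (im w) n

  -- Multiplication by the conjugate of w turns w y ≈ 0 into |w|² y ≈ 0, whose real and imaginary
  -- parts are divided by the bound ε.
  apart⇒cancelable : ∀ w ε N → 0ℚ < ε → (∀ n → N ℕ.≤ n → ε ≤ normSq w n) → Cancelable w
  apart⇒cancelable w ε N ε>0 far {y} wy≈0 = mk≈ᶜ
    (cancel (re y) (λ n → l₁ (seq (re w) n) (seq (im w) n) (seq (re y) n) (seq (im y) n)) (re≈ conj*wy≈0))
    (cancel (im y) (λ n → l₂ (seq (re w) n) (seq (im w) n) (seq (re y) n) (seq (im y) n)) (im≈ conj*wy≈0))
    where
    conj : ℂ
    conj = re w +i (-ᴿ im w)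
    conj*wy≈0 : conj *ᶜ (w *ᶜ y) ≈ᶜ 0ᶜ
    conj*wy≈0 = product-zero conj wy≈0
    l₁ : ∀ a b x y → a * (a * x + - (b * y)) + - ((- b) * (a * y + b * x)) ≡ (a * a + b * b) * x
    l₁ = solve-∀ ℚ-ring
    l₂ : ∀ a b x y → a * (a * y + b * x) + (- b) * (a * x + - (b * y)) ≡ (a * a + b * b) * y
    l₂ = solve-∀ ℚ-ring
    cancel : ∀ x {v} → (∀ n → seq v n ≡ normSq w n * seq x n) → v ≈ 0ℝ → x ≈ 0ℝ
    cancel x {v} eq v≈0 = mk≈ λ η η>0 →
      let M , small = close v≈0 (ε * η) (pos-* ε>0 η>0) in N ℕ.⊔ M , λ n n≥ →
        *-cancelˡ-<-nonNeg ε {{nonNegative (<⇒≤ ε>0)}} (≤-<-trans (bound n (ℕ.m⊔n≤o⇒m≤o N M n≥))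
          (small n (ℕ.m⊔n≤o⇒n≤o N M n≥)))
      where
      open ≤-Reasoning
      bound : ∀ n → N ℕ.≤ n → ε * ∣ seq x n - 0ℚ ∣ ≤ ∣ seq v n - 0ℚ ∣
      bound n n≥N = begin
        ε * ∣ seq x n - 0ℚ ∣
          ≤⟨ *-monoʳ (0≤∣p∣ (seq x n - 0ℚ))
               (≤-trans (far n n≥N) (p≤∣p∣ (normSq w n))) ⟩
        ∣ normSq w n ∣ * ∣ seq x n - 0ℚ ∣
          ≡⟨ ∣p*q∣≡∣p∣*∣q∣ (normSq w n) (seq x n - 0ℚ) ⟨
        ∣ normSq w n * (seq x n - 0ℚ) ∣
          ≡⟨ cong ∣_∣ (lem (normSq w n) (seq x n)) ⟩
        ∣ normSq w n * seq x n - 0ℚ ∣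
          ≡⟨ cong (λ t → ∣ t - 0ℚ ∣) (eq n) ⟨
        ∣ seq v n - 0ℚ ∣ ∎
        where
        lem : ∀ s x → s * (x - 0ℚ) ≡ s * x - 0ℚ
        lem = solve-∀ ℚ-ring

  infixl 6 _+ᴾ_
  infixl 7 _·ᴾ_

  _+ᴾ_ : ℂ[x] → ℂ[x] → ℂ[x]
  []      +ᴾ q       = q
  (a ∷ p) +ᴾ []      = a ∷ p
  (a ∷ p) +ᴾ (b ∷ q) = (a +ᶜ b) ∷ (p +ᴾ q)

  _·ᴾ_ : ℂ → ℂ[x] → ℂ[x]
  c ·ᴾ p = map (c *ᶜ_) p

  coeff-+ᴾ : ∀ p q k → coeff (p +ᴾ q) k ≈ᶜ coeff p k +ᶜ coeff q k
  coeff-+ᴾ []      q       k       = ≈ᶜ-sym (+ᶜ-identityˡ _)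
  coeff-+ᴾ (a ∷ p) []      k       = ≈ᶜ-sym (+ᶜ-identityʳ _)
  coeff-+ᴾ (a ∷ p) (b ∷ q) zero    = ≈ᶜ-refl
  coeff-+ᴾ (a ∷ p) (b ∷ q) (suc k) = coeff-+ᴾ p q k

  coeff-·ᴾ : ∀ c p k → coeff (c ·ᴾ p) k ≈ᶜ c *ᶜ coeff p k
  coeff-·ᴾ c []      k       = ≈ᶜ-sym (*ᶜ-zeroʳ c)
  coeff-·ᴾ c (a ∷ p) zero    = ≈ᶜ-refl
  coeff-·ᴾ c (a ∷ p) (suc k) = coeff-·ᴾ c p k

  eval-+ᴾ : ∀ p q z → eval (p +ᴾ q) z ≈ᶜ eval p z +ᶜ eval q z
  eval-+ᴾ []      q       z = ≈ᶜ-sym (+ᶜ-identityˡ _)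
  eval-+ᴾ (a ∷ p) []      z = ≈ᶜ-sym (+ᶜ-identityʳ _)
  eval-+ᴾ (a ∷ p) (b ∷ q) z = ≈ᶜ-trans (+ᶜ-cong ≈ᶜ-refl (≈ᶜ-trans (*ᶜ-cong ≈ᶜ-refl (eval-+ᴾ p q z))
    (*ᶜ-distribˡ z (eval p z) (eval q z)))) (+ᶜ-interchange a b (z *ᶜ eval p z) (z *ᶜ eval q z))

  eval-·ᴾ : ∀ c p z → eval (c ·ᴾ p) z ≈ᶜ c *ᶜ eval p z
  eval-·ᴾ c []      z = ≈ᶜ-sym (*ᶜ-zeroʳ c)
  eval-·ᴾ c (a ∷ p) z = ≈ᶜ-trans (+ᶜ-cong ≈ᶜ-refl (≈ᶜ-trans (*ᶜ-cong ≈ᶜ-refl (eval-·ᴾ c p z)) (*ᶜ-swap z c (eval p z))))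
    (≈ᶜ-sym (*ᶜ-distribˡ c a (z *ᶜ eval p z)))

  VanishesFrom : ℕ → ℂ[x] → Set
  VanishesFrom n p = ∀ k → n ℕ.≤ k → coeff p k ≈ᶜ 0ᶜ

  eval-vanishing : ∀ p → VanishesFrom 0 p → ∀ z → eval p z ≈ᶜ 0ᶜ
  eval-vanishing []      van z = ≈ᶜ-refl
  eval-vanishing (a ∷ p) van z =
    sum-zero (van 0 ℕ.z≤n) (product-zero z (eval-vanishing p (λ k _ → van (suc k) ℕ.z≤n) z))

  vanishes-length : ∀ p → VanishesFrom (length p) p
  vanishes-length []      k       _           = ≈ᶜ-refl
  vanishes-length (a ∷ p) (suc k) (ℕ.s≤s len≤k) = vanishes-length p k len≤k

  eval-constant : ∀ p → VanishesFrom 1 p → ∀ z → eval p z ≈ᶜ coeff p 0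
  eval-constant []      van z = ≈ᶜ-refl
  eval-constant (a ∷ p) van z =
    zero-right (product-zero z (eval-vanishing p (λ k _ → van (suc k) (ℕ.s≤s ℕ.z≤n)) z))

  -- Synthetic division by x - z: Horner's intermediate values are the values at z of the successive
  -- tails of the coefficient list.
  quot : ℂ[x] → ℂ → ℂ[x]
  quot []      z = []
  quot (a ∷ p) z = eval p z ∷ quot p z

  eval-quot : ∀ p z w → eval p w ≈ᶜ (w -ᶜ z) *ᶜ eval (quot p z) w +ᶜ eval p z
  eval-quot []      z w = ≈ᶜ-sym (sum-zero (*ᶜ-zeroʳ (w -ᶜ z)) ≈ᶜ-refl)
  eval-quot (a ∷ p) z w = ≈ᶜ-trans (+ᶜ-cong ≈ᶜ-refl (*ᶜ-cong ≈ᶜ-refl (eval-quot p z w)))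
    (pointwiseᶜ
      (λ n → l₁ (seq (re a) n) (seq (re w) n) (seq (im w) n) (seq (re z) n) (seq (im z) n)
                (seq (re Q) n) (seq (im Q) n) (seq (re P) n) (seq (im P) n))
      (λ n → l₂ (seq (im a) n) (seq (re w) n) (seq (im w) n) (seq (re z) n) (seq (im z) n)
                (seq (re Q) n) (seq (im Q) n) (seq (re P) n) (seq (im P) n)))
    where
    Q = eval (quot p z) w
    P = eval p z
    l₁ : ∀ a w w′ z z′ q q′ p p′ →
      a + (w * (((w + - z) * q + - ((w′ + - z′) * q′)) + p) + - (w′ * (((w + - z) * q′ + (w′ + - z′) * q) + p′)))
      ≡ ((w + - z) * (p + (w * q + - (w′ * q′))) + - ((w′ + - z′) * (p′ + (w * q′ + w′ * q)))) + (a + (z * p + - (z′ * p′)))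
    l₁ = solve-∀ ℚ-ring
    l₂ : ∀ a w w′ z z′ q q′ p p′ →
      a + (w * (((w + - z) * q′ + (w′ + - z′) * q) + p′) + w′ * (((w + - z) * q + - ((w′ + - z′) * q′)) + p))
      ≡ ((w + - z) * (p′ + (w * q′ + w′ * q)) + (w′ + - z′) * (p + (w * q + - (w′ * q′)))) + (a + (z * p′ + z′ * p))
    l₂ = solve-∀ ℚ-ring

  quot-vanishes : ∀ {n} p z → VanishesFrom (suc n) p → VanishesFrom n (quot p z)
  quot-vanishes []      z van k       n≤k = ≈ᶜ-refl
  quot-vanishes (a ∷ p) z van zero    ℕ.z≤n = eval-vanishing p (λ k _ → van (suc k) (ℕ.s≤s ℕ.z≤n)) z
  quot-vanishes {zero}  (a ∷ p) z van (suc k) n≤k =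
    quot-vanishes {zero} p z (λ i _ → van (suc i) (ℕ.s≤s ℕ.z≤n)) k ℕ.z≤n
  quot-vanishes {suc n} (a ∷ p) z van (suc k) (ℕ.s≤s n≤k) =
    quot-vanishes {n} p z (λ i n<i → van (suc i) (ℕ.s≤s n<i)) k n≤k

  quot-leading : ∀ n p z → VanishesFrom (2 ℕ.+ n) p → coeff (quot p z) n ≈ᶜ coeff p (suc n)
  quot-leading n       []      z van = ≈ᶜ-refl
  quot-leading zero    (a ∷ p) z van = eval-constant p (λ k 1≤k → van (suc k) (ℕ.s≤s 1≤k)) z
  quot-leading (suc n) (a ∷ p) z van = quot-leading n p z (λ k n+2≤k → van (suc k) (ℕ.s≤s n+2≤k))

  root-of-quot : ∀ p {z w} → Cancelable (w -ᶜ z) → eval p z ≈ᶜ 0ᶜ → eval p w ≈ᶜ 0ᶜ → eval (quot p z) w ≈ᶜ 0ᶜ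
  root-of-quot p {z} {w} cancel pz≈0 pw≈0 =
    cancel (≈ᶜ-trans (≈ᶜ-sym (zero-right pz≈0)) (≈ᶜ-trans (≈ᶜ-sym (eval-quot p z w)) pw≈0))

  -- The linear factors are split off one at a time. The other zeros stay zeros of the quotient
  -- because their differences from the removed one can be cancelled.
  factorization : ∀ n p (z : Vector ℂ n) → VanishesFrom (suc n) p → (∀ i → eval p (z i) ≈ᶜ 0ᶜ) →
    (∀ {i j} → i Fin.< j → Cancelable (z j -ᶜ z i)) →
    ∀ w → eval p w ≈ᶜ coeff p n *ᶜ product (λ i → w -ᶜ z i)
  factorization zero    p z van roots apart w = ≈ᶜ-trans (eval-constant p van w) (≈ᶜ-sym (*ᶜ-identityʳ _))
  factorization (suc n) p z van roots apart w =
    ≈ᶜ-trans (eval-quot p (z zero) w) (≈ᶜ-trans (zero-right (roots zero))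
      (≈ᶜ-trans (*ᶜ-cong ≈ᶜ-refl (≈ᶜ-trans
        (factorization n (quot p (z zero)) (z ∘ suc) (quot-vanishes p (z zero) van)
          (λ i → root-of-quot p (apart (ℕ.s≤s ℕ.z≤n)) (roots zero) (roots (suc i)))
          (λ i<j → apart (ℕ.s≤s i<j)) w)
        (*ᶜ-cong (quot-leading n p (z zero) van) ≈ᶜ-refl)))
        (*ᶜ-swap (w -ᶜ z zero) (coeff p (suc n)) (product (λ i → w -ᶜ z (suc i))))))

  product-cancelable : ∀ {n} {z : Vector ℂ n} → (∀ i → Cancelable (z i)) → Cancelable (product z)
  product-cancelable {zero}  c = 1-cancelable
  product-cancelable {suc n} c = *-cancelable (c zero) (product-cancelable (c ∘ suc))

  quot-zero : ∀ p z → VanishesFrom 0 (quot p z) → eval p z ≈ᶜ 0ᶜ → VanishesFrom 0 p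
  quot-zero []      z q≈0 p≈0 k       _ = ≈ᶜ-refl
  quot-zero (a ∷ p) z q≈0 p≈0 zero    _ = ≈ᶜ-trans (≈ᶜ-sym (zero-right (product-zero z (q≈0 0 ℕ.z≤n)))) p≈0
  quot-zero (a ∷ p) z q≈0 p≈0 (suc k) _ =
    quot-zero p z (λ i _ → q≈0 (suc i) ℕ.z≤n) (q≈0 0 ℕ.z≤n) k ℕ.z≤n

  natᶜ : ℕ → ℂ
  natᶜ n = ratᶜ (ιℕ n)

  natᶜ-cancelable : ∀ {m n} → m ℕ.< n → Cancelable (natᶜ n -ᶜ natᶜ m)
  natᶜ-cancelable {m} {n} m<n = apart⇒cancelable (natᶜ n -ᶜ natᶜ m) (t * t) 0 (pos-* t>0 t>0)
    (λ _ _ → ≤-reflexive (sym (+-identityʳ (t * t))))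
    where
    t = ιℕ n - ιℕ m
    t>0 : 0ℚ < t
    t>0 = <⇒0< (ι-mono-< (ℤ.+<+ m<n))

  -- Each division by x - N lowers the degree bound and uses up one zero, so the zeros are only
  -- assumed from N on and N increases in the induction.
  zero-on-ℕ : ∀ n N p → VanishesFrom n p → (∀ m → N ℕ.≤ m → eval p (natᶜ m) ≈ᶜ 0ᶜ) → VanishesFrom 0 p
  zero-on-ℕ zero    N p van zeros = van
  zero-on-ℕ (suc n) N p van zeros = quot-zero p (natᶜ N)
    (zero-on-ℕ n (suc N) (quot p (natᶜ N)) (quot-vanishes p (natᶜ N) van)
      (λ m N<m → root-of-quot p (natᶜ-cancelable N<m) (zeros N ℕ.≤-refl) (zeros m (ℕ.<⇒≤ N<m))))
    (zeros N ℕ.≤-refl)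

  minus : ℂ[x] → ℂ[x]
  minus q = ratᶜ (- 1ℚ) ·ᴾ q

  private
    cancel-minus : ∀ {x y} → x +ᶜ ratᶜ (- 1ℚ) *ᶜ y ≈ᶜ 0ᶜ → x ≈ᶜ y
    cancel-minus {x} {y} eq = ≈ᶜ-trans (pointwiseᶜ
        (λ n → l₁ (seq (re x) n) (seq (re y) n) (seq (im y) n))
        (λ n → l₂ (seq (im x) n) (seq (re y) n) (seq (im y) n)))
      (zero-left eq)
      where
      l₁ : ∀ x y y′ → x ≡ (x + ((- 1ℚ) * y + - (0ℚ * y′))) + y
      l₁ = solve-∀ ℚ-ring
      l₂ : ∀ x y y′ → x ≡ (x + ((- 1ℚ) * y′ + 0ℚ * y)) + y′
      l₂ = solve-∀ ℚ-ring

    minus-cancel : ∀ {x y} → x ≈ᶜ y → x +ᶜ ratᶜ (- 1ℚ) *ᶜ y ≈ᶜ 0ᶜ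
    minus-cancel {x} {y} eq = ≈ᶜ-trans (+ᶜ-cong eq ≈ᶜ-refl) (pointwiseᶜ
        (λ n → l₁ (seq (re y) n) (seq (im y) n))
        (λ n → l₂ (seq (re y) n) (seq (im y) n)))
      where
      l₁ : ∀ y y′ → y + ((- 1ℚ) * y + - (0ℚ * y′)) ≡ 0ℚ
      l₁ = solve-∀ ℚ-ring
      l₂ : ∀ y y′ → y′ + ((- 1ℚ) * y′ + 0ℚ * y) ≡ 0ℚ
      l₂ = solve-∀ ℚ-ring

  module _ (p q : ℂ[x]) (agree : ∀ m → eval p (natᶜ m) ≈ᶜ eval q (natᶜ m)) where

    private
      difference : ℂ[x]
      difference = p +ᴾ minus q
      difference≈0 : VanishesFrom 0 difference
      difference≈0 = zero-on-ℕ (length difference) 0 difference (vanishes-length difference) λ m _ →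
        ≈ᶜ-trans (eval-+ᴾ p (minus q) (natᶜ m)) (≈ᶜ-trans (+ᶜ-cong ≈ᶜ-refl (eval-·ᴾ (ratᶜ (- 1ℚ)) q (natᶜ m)))
          (minus-cancel (agree m)))

    coeff-unique : ∀ k → coeff p k ≈ᶜ coeff q k
    coeff-unique k = cancel-minus (≈ᶜ-trans (+ᶜ-cong ≈ᶜ-refl (≈ᶜ-sym (coeff-·ᴾ (ratᶜ (- 1ℚ)) q k)))
      (≈ᶜ-trans (≈ᶜ-sym (coeff-+ᴾ p (minus q) k)) (difference≈0 k ℕ.z≤n)))

    eval-unique : ∀ z → eval p z ≈ᶜ eval q z
    eval-unique z = cancel-minus (≈ᶜ-trans (+ᶜ-cong ≈ᶜ-refl (≈ᶜ-sym (eval-·ᴾ (ratᶜ (- 1ℚ)) q z)))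
      (≈ᶜ-trans (≈ᶜ-sym (eval-+ᴾ p (minus q) z)) (eval-vanishing difference difference≈0 z)))

  eval-ratᶜ : ∀ p x → eval (toℂ[x] p) (ratᶜ x) ≈ᶜ ratᶜ (evalℚ p x)
  eval-ratᶜ []      x = ≈ᶜ-refl
  eval-ratᶜ (a ∷ p) x = ≈ᶜ-trans (+ᶜ-cong ≈ᶜ-refl (*ᶜ-cong ≈ᶜ-refl (eval-ratᶜ p x)))
    (pointwiseᶜ (λ _ → l₁ a x (evalℚ p x)) (λ _ → l₂ x (evalℚ p x)))
    where
    l₁ : ∀ a x e → a + (x * e + - (0ℚ * 0ℚ)) ≡ a + x * e
    l₁ = solve-∀ ℚ-ring
    l₂ : ∀ x e → 0ℚ + (x * 0ℚ + 0ℚ * e) ≡ 0ℚ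
    l₂ = solve-∀ ℚ-ring

-- The Ehrhart polynomials: recurrence, degree, values on the line.

module Ehrhart where

  open import Data.Empty using (⊥; ⊥-elim)
  open import Data.Fin.Base as Fin using (toℕ)
  import Data.Fin.Properties as Fin
  open import Data.Integer.Base using (+_)
  open import Data.List.Base using ([]; _∷_)
  open import Data.Nat.Base as ℕ using (ℕ; zero; suc)
  import Data.Nat.Properties as ℕ
  open import Data.Nat.Tactic.RingSolver as ℕSolver using ()
  open import Data.Product using (∃; _×_; _,_; proj₁; proj₂)
  open import Data.Rational hiding (-½)
  open import Data.Rational.Properties
  open import Data.Vec.Functional using (Vector)
  open import Defs using (ℝ; mkℝ; seq; cauchy; _≈_; mk≈; mk≤; 0ℝ; 1ℝ; fromℚ; ℂ; _+i_; re; im; _≈ᶜ_; mk≈ᶜ; re≈; _+ᶜ_; _-ᶜ_; _*ᶜ_;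
    0ᶜ; 1ᶜ; 𝕚; ratᶜ; fromℝ; -½; ℚ[x]; ℂ[x]; eval; evalℚ; coeff; toℂ[x]; HasDegree; ListsZeros; InterlacedBy; R; R-point;
    IsEhrhartPolynomial; St; module Line)
    renaming (_*_ to _*ᴿ_; _-_ to _-ᴿ_)
  open import Relation.Binary.PropositionalEquality
  open import Relation.Nullary using (yes; no)
  open import Tactic.RingSolver using (solve-∀)
  open ComplexPolynomials
  open Gauge using (dilate-cardinality)
  open NewtonSeries using (count; count-recurrence; count-one)
  open RationalOrder
  open RealNumbers
  open SturmSequences

  -- The coefficients for dimension n + 2, spelled as in the theorem so that its recurrence is
  -- obtained without conversion.
  α β : ℕ → ℚ
  α n = + (2 ℕ.* (2 ℕ.+ n) ℕ.+ 1) / ((2 ℕ.+ n) ℕ.* (2 ℕ.+ n ℕ.+ 2))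
  β n = + ((2 ℕ.+ n ℕ.∸ 1) ℕ.* (2 ℕ.+ n ℕ.+ 1)) / ((2 ℕ.+ n) ℕ.* (2 ℕ.+ n ℕ.+ 2))

  private
    denominator : ℕ → ℕ
    denominator n = (2 ℕ.+ n) ℕ.* (2 ℕ.+ n ℕ.+ 2)

    α-* : ∀ n → ιℕ (denominator n) * α n ≡ ιℕ (2 ℕ.* (2 ℕ.+ n) ℕ.+ 1)
    α-* n = *-/ (denominator n) (2 ℕ.* (2 ℕ.+ n) ℕ.+ 1)

    β-* : ∀ n → ιℕ (denominator n) * β n ≡ ιℕ ((2 ℕ.+ n ℕ.∸ 1) ℕ.* (2 ℕ.+ n ℕ.+ 1))
    β-* n = *-/ (denominator n) ((2 ℕ.+ n ℕ.∸ 1) ℕ.* (2 ℕ.+ n ℕ.+ 1))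

    ιℕ-positive : ∀ n → 0 ℕ.< n → 0ℚ < ιℕ n
    ιℕ-positive (suc n) _ = ιℕ>0 n

    pos-factor : ∀ m q k → 0 ℕ.< m → 0 ℕ.< k → ιℕ m * q ≡ ιℕ k → 0ℚ < q
    pos-factor m q k m>0 k>0 eq = *-cancelˡ-<-nonNeg (ιℕ m) {{nonNegative (ιℕ≥0 m)}}
      (subst₂ _<_ (sym (*-zeroʳ (ιℕ m))) (sym eq) (ιℕ-positive k k>0))

    denominator>0 : ∀ n → 0 ℕ.< denominator n
    denominator>0 n = ℕ.s≤s ℕ.z≤n

  α>0 : ∀ n → 0ℚ < α n
  α>0 n = pos-factor (denominator n) (α n) (2 ℕ.* (2 ℕ.+ n) ℕ.+ 1) (denominator>0 n) (ℕ.s≤s ℕ.z≤n) (α-* n)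

  β>0 : ∀ n → 0ℚ < β n
  β>0 n = pos-factor (denominator n) (β n) ((2 ℕ.+ n ℕ.∸ 1) ℕ.* (2 ℕ.+ n ℕ.+ 1)) (denominator>0 n) (ℕ.s≤s ℕ.z≤n) (β-* n)

  count-recurrenceℚ : ∀ n s →
    ιℕ (count (2 ℕ.+ n) 0 s) ≡ α n * (ι (+ 2) * ιℕ s + 1ℚ) * ιℕ (count (suc n) 0 s) + β n * ιℕ (count n 0 s)
  count-recurrenceℚ n s = *-cancelˡ-≡ (begin
    ιℕ D * ιℕ c₂
      ≡⟨ ιℕ-* D c₂ ⟨
    ιℕ (D ℕ.* c₂)
      ≡⟨ cong ιℕ (trans (l₁ n c₂) (trans (count-recurrence n s) (l₂ n s c₁ c₀))) ⟩
    ιℕ (A ℕ.* ((2 ℕ.* s ℕ.+ 1) ℕ.* c₁) ℕ.+ B ℕ.* c₀)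
      ≡⟨ trans (ιℕ-+ (A ℕ.* ((2 ℕ.* s ℕ.+ 1) ℕ.* c₁)) (B ℕ.* c₀)) (cong₂ _+_
           (trans (ιℕ-* A ((2 ℕ.* s ℕ.+ 1) ℕ.* c₁)) (cong (ιℕ A *_) (trans (ιℕ-* (2 ℕ.* s ℕ.+ 1) c₁)
             (cong (_* ιℕ c₁) (trans (ιℕ-+ (2 ℕ.* s) 1) (cong (_+ 1ℚ) (ιℕ-* 2 s)))))))
           (ιℕ-* B c₀)) ⟩
    ιℕ A * ((ι (+ 2) * ιℕ s + 1ℚ) * ιℕ c₁) + ιℕ B * ιℕ c₀
      ≡⟨ cong₂ (λ a b → a * ((ι (+ 2) * ιℕ s + 1ℚ) * ιℕ c₁) + b * ιℕ c₀) (α-* n) (β-* n) ⟨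
    ιℕ D * α n * ((ι (+ 2) * ιℕ s + 1ℚ) * ιℕ c₁) + ιℕ D * β n * ιℕ c₀
      ≡⟨ l₃ (ιℕ D) (α n) (ι (+ 2) * ιℕ s + 1ℚ) (ιℕ c₁) (β n) (ιℕ c₀) ⟩
    ιℕ D * (α n * (ι (+ 2) * ιℕ s + 1ℚ) * ιℕ c₁ + β n * ιℕ c₀) ∎)
    where
    open ≡-Reasoning
    D = denominator n
    A = 2 ℕ.* (2 ℕ.+ n) ℕ.+ 1
    B = (2 ℕ.+ n ℕ.∸ 1) ℕ.* (2 ℕ.+ n ℕ.+ 1)
    c₂ = count (2 ℕ.+ n) 0 s
    c₁ = count (suc n) 0 s
    c₀ = count n 0 s
    instance
      D⁺ : Positive (ιℕ D)
      D⁺ = positive (ιℕ-positive D (denominator>0 n))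
      D≢0 : NonZero (ιℕ D)
      D≢0 = pos⇒nonZero (ιℕ D)
    *-cancelˡ-≡ : ∀ {p q} → ιℕ D * p ≡ ιℕ D * q → p ≡ q
    *-cancelˡ-≡ {p} {q} eq = ≤-antisym
      (*-cancelˡ-≤-pos (ιℕ D) (≤-reflexive eq)) (*-cancelˡ-≤-pos (ιℕ D) (≤-reflexive (sym eq)))
    l₁ : ∀ n c → (2 ℕ.+ n) ℕ.* (2 ℕ.+ n ℕ.+ 2) ℕ.* c ≡ (2 ℕ.+ n) ℕ.* (4 ℕ.+ n) ℕ.* c
    l₁ = ℕSolver.solve-∀
    l₂ : ∀ n s c₁ c₀ → (5 ℕ.+ 2 ℕ.* n) ℕ.* ((2 ℕ.* s ℕ.+ 1) ℕ.* c₁) ℕ.+ suc n ℕ.* (3 ℕ.+ n) ℕ.* c₀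
         ≡ (2 ℕ.* (2 ℕ.+ n) ℕ.+ 1) ℕ.* ((2 ℕ.* s ℕ.+ 1) ℕ.* c₁) ℕ.+ (suc n ℕ.* (2 ℕ.+ n ℕ.+ 1)) ℕ.* c₀
    l₂ = ℕSolver.solve-∀
    l₃ : ∀ D a x y b z → D * a * (x * y) + D * b * z ≡ D * (a * x * y + b * z)
    l₃ = solve-∀ ℚ-ring

  linear : ℂ[x] → ℂ[x]
  linear p = ratᶜ (ι (+ 2)) ·ᴾ (0ᶜ ∷ p) +ᴾ p

  eval-linear : ∀ p z → eval (linear p) z ≈ᶜ (ratᶜ (ι (+ 2)) *ᶜ z +ᶜ 1ᶜ) *ᶜ eval p z
  eval-linear p z = ≈ᶜ-trans (eval-+ᴾ (ratᶜ (ι (+ 2)) ·ᴾ (0ᶜ ∷ p)) p z)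
    (≈ᶜ-trans (+ᶜ-cong (eval-·ᴾ (ratᶜ (ι (+ 2))) (0ᶜ ∷ p) z) ≈ᶜ-refl)
      (pointwiseᶜ
        (λ n → l₁ (ι (+ 2)) (seq (re z) n) (seq (im z) n) (seq (re (eval p z)) n) (seq (im (eval p z)) n))
        (λ n → l₂ (ι (+ 2)) (seq (re z) n) (seq (im z) n) (seq (re (eval p z)) n) (seq (im (eval p z)) n))))
    where
    l₁ : ∀ c z z′ p p′ → (c * (0ℚ + (z * p + - (z′ * p′))) + - (0ℚ * (0ℚ + (z * p′ + z′ * p)))) + p
         ≡ ((c * z + - (0ℚ * z′)) + 1ℚ) * p + - (((c * z′ + 0ℚ * z) + 0ℚ) * p′)
    l₁ = solve-∀ ℚ-ring
    l₂ : ∀ c z z′ p p′ → (c * (0ℚ + (z * p′ + z′ * p)) + 0ℚ * (0ℚ + (z * p + - (z′ * p′)))) + p′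
         ≡ ((c * z + - (0ℚ * z′)) + 1ℚ) * p′ + ((c * z′ + 0ℚ * z) + 0ℚ) * p
    l₂ = solve-∀ ℚ-ring

  combine : ℚ → ℚ → ℂ[x] → ℂ[x] → ℂ[x]
  combine a b p q = ratᶜ a ·ᴾ linear p +ᴾ ratᶜ b ·ᴾ q

  eval-combine : ∀ a b p q z → eval (combine a b p q) z ≈ᶜ
    ratᶜ a *ᶜ (ratᶜ (ι (+ 2)) *ᶜ z +ᶜ 1ᶜ) *ᶜ eval p z +ᶜ ratᶜ b *ᶜ eval q z
  eval-combine a b p q z = ≈ᶜ-trans (eval-+ᴾ (ratᶜ a ·ᴾ linear p) (ratᶜ b ·ᴾ q) z)
    (+ᶜ-cong (≈ᶜ-trans (eval-·ᴾ (ratᶜ a) (linear p) z) (≈ᶜ-trans (*ᶜ-cong ≈ᶜ-refl (eval-linear p z))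
                (≈ᶜ-sym (*ᶜ-assoc (ratᶜ a) (ratᶜ (ι (+ 2)) *ᶜ z +ᶜ 1ᶜ) (eval p z)))))
             (eval-·ᴾ (ratᶜ b) q z))

  coeff-combine : ∀ a b p q k → coeff (combine a b p q) (suc k) ≈ᶜ
    ratᶜ a *ᶜ (ratᶜ (ι (+ 2)) *ᶜ coeff p k +ᶜ coeff p (suc k)) +ᶜ ratᶜ b *ᶜ coeff q (suc k)
  coeff-combine a b p q k = ≈ᶜ-trans (coeff-+ᴾ (ratᶜ a ·ᴾ linear p) (ratᶜ b ·ᴾ q) (suc k))
    (+ᶜ-cong (≈ᶜ-trans (coeff-·ᴾ (ratᶜ a) (linear p) (suc k)) (*ᶜ-cong ≈ᶜ-refl
               (≈ᶜ-trans (coeff-+ᴾ (ratᶜ (ι (+ 2)) ·ᴾ (0ᶜ ∷ p)) p (suc k))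
                 (+ᶜ-cong (coeff-·ᴾ (ratᶜ (ι (+ 2))) (0ᶜ ∷ p) (suc k)) ≈ᶜ-refl))))
             (coeff-·ᴾ (ratᶜ b) q (suc k)))

  eval-cong : ∀ p {z w} → z ≈ᶜ w → eval p z ≈ᶜ eval p w
  eval-cong []      z≈w = ≈ᶜ-refl
  eval-cong (a ∷ p) z≈w = +ᶜ-cong ≈ᶜ-refl (*ᶜ-cong z≈w (eval-cong p z≈w))

  cancelable-resp : ∀ {u v} → u ≈ᶜ v → Cancelable v → Cancelable u
  cancelable-resp u≈v cv eq = cv (≈ᶜ-trans (*ᶜ-cong (≈ᶜ-sym u≈v) ≈ᶜ-refl) eq)

  ratᶜ-* : ∀ p q → ratᶜ p *ᶜ ratᶜ q ≈ᶜ ratᶜ (p * q)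
  ratᶜ-* p q = pointwiseᶜ (λ _ → l₁ p q) (λ _ → l₂ p q)
    where
    l₁ : ∀ p q → p * q + - (0ℚ * 0ℚ) ≡ p * q
    l₁ = solve-∀ ℚ-ring
    l₂ : ∀ p q → p * 0ℚ + 0ℚ * q ≡ 0ℚ
    l₂ = solve-∀ ℚ-ring

  onLine : ℝ → ℂ
  onLine t = -½ +i t

  iᵖ : ℕ → ℂ
  iᵖ zero    = 1ᶜ
  iᵖ (suc n) = 𝕚 *ᶜ iᵖ n

  -- At z = -½ + i t the factor 2z + 1 is 2 i t, whence the 2 in front of `α`. Dividing by iⁿ⁺²
  -- changes the sign of the term with `β`, so the recurrence takes Sturm's form.
  a : ℕ → ℚ
  a zero    = ι (+ 2)
  a (suc n) = ι (+ 2) * α n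

  a>0 : ∀ n → 0ℚ < a n
  a>0 zero    = ιℕ>0 1
  a>0 (suc n) = pos-* (ιℕ>0 1) (α>0 n)

  open Recurrence a β a>0 β>0

  pᴿ : ℕ → ℝ → ℝ
  pᴿ zero          t = 1ℝ
  pᴿ (suc zero)    t = fromℚ (a 0) *ᴿ t
  pᴿ (suc (suc n)) t = fromℚ (a (suc n)) *ᴿ t *ᴿ pᴿ (suc n) t -ᴿ fromℚ (β n) *ᴿ pᴿ n t

  seq-pᴿ : ∀ n t i → seq (pᴿ n t) i ≡ p n (seq t i)
  seq-pᴿ zero          t i = refl
  seq-pᴿ (suc zero)    t i = refl
  seq-pᴿ (suc (suc n)) t i = cong₂ (λ x y → a (suc n) * seq t i * x + - (β n * y)) (seq-pᴿ (suc n) t i) (seq-pᴿ n t i)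

  -- For given ε, a single rational comparison at a late index decides whether x is within ε/2 of -½
  -- there. If not, the Cauchy bound ε/4 keeps all later terms at least ε/4 away, which is excluded.
  apart-from-line : ∀ x → (∀ ε N → 0ℚ < ε → (∀ n → N ℕ.≤ n → ε ≤ ∣ seq x n - (- ½) ∣) → ⊥) → x ≈ -½
  apart-from-line x not-apart = mk≈ λ ε ε>0 →
    let η = ½ * (½ * ε)
        η>0 = half>0 (half>0 ε>0)
        N , small = cauchy x η η>0
    in N , λ n n≥N → ≤-<-trans (∣-∣-triangle (seq x n) (seq x N) (- ½))
         (<-trans (+-mono-< (small n N n≥N ℕ.≤-refl) (near ε η N refl η>0 small))
                  (0<⇒< η>0 (l₁ ε)))
    where
    l₁ : ∀ ε → ε - (½ * (½ * ε) + ½ * ε) ≡ ½ * (½ * ε)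
    l₁ = solve-∀ ℚ-ring
    near : ∀ ε η N → η ≡ ½ * (½ * ε) → 0ℚ < η →
      (∀ m n → N ℕ.≤ m → N ℕ.≤ n → ∣ seq x m - seq x n ∣ < η) → ∣ seq x N - (- ½) ∣ < ½ * ε
    near ε η N eq η>0 small with ∣ seq x N - (- ½) ∣ <? ½ * ε
    ... | yes lt = lt
    ... | no ¬lt = ⊥-elim (not-apart η N η>0 λ n n≥N →
      0≤⇒≤ (nonNeg-+ (≤⇒0≤ (≤-trans (≮⇒≥ ¬lt) (∣-∣-triangle (seq x N) (seq x n) (- ½))))
                     (<⇒≤ (<⇒0< (small N n ℕ.≤-refl n≥N))))
           (trans (cong (λ η → ∣ seq x n - (- ½) ∣ - η) eq)
             (trans (l₂ ∣ seq x n - (- ½) ∣ ∣ seq x N - seq x n ∣ ε)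
               (cong (λ η → ((∣ seq x N - seq x n ∣ + ∣ seq x n - (- ½) ∣) - ½ * ε) + (η - ∣ seq x N - seq x n ∣)) (sym eq)))))
      where
      l₂ : ∀ y w ε → y - ½ * (½ * ε) ≡ ((w + y) - ½ * ε) + (½ * (½ * ε) - w)
      l₂ = solve-∀ ℚ-ring

  module _ (H : ℕ → ℚ[x]) (H₀ : ∀ x → evalℚ (H 0) x ≡ 1ℚ)
           (ehrhart : ∀ d → 1 ℕ.≤ d → IsEhrhartPolynomial (St d) (H d)) where

    P : ℕ → ℂ[x]
    P d = toℂ[x] (H d)

    P-natᶜ : ∀ d s → eval (P d) (natᶜ s) ≈ᶜ natᶜ (count d 0 s)
    P-natᶜ zero    s = ≈ᶜ-trans (eval-ratᶜ (H 0) (ιℕ s)) (subst (λ q → ratᶜ q ≈ᶜ natᶜ 1) (sym (H₀ (ιℕ s))) ≈ᶜ-refl)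
    P-natᶜ (suc d) s with ehrhart (suc d) (ℕ.s≤s ℕ.z≤n) s
    ... | N , card , value = ≈ᶜ-trans (eval-ratᶜ (H (suc d)) (ιℕ s))
      (subst (λ q → ratᶜ q ≈ᶜ natᶜ (count (suc d) 0 s))
        (sym (trans value (cong ιℕ (dilate-cardinality s card)))) ≈ᶜ-refl)

    P-combine-natᶜ : ∀ n s → eval (P (2 ℕ.+ n)) (natᶜ s) ≈ᶜ eval (combine (α n) (β n) (P (suc n)) (P n)) (natᶜ s)
    P-combine-natᶜ n s = ≈ᶜ-trans (P-natᶜ (2 ℕ.+ n) s) (≈ᶜ-sym
      (≈ᶜ-trans (eval-combine (α n) (β n) (P (suc n)) (P n) (natᶜ s))
        (≈ᶜ-trans (+ᶜ-cong (*ᶜ-cong ≈ᶜ-refl (P-natᶜ (suc n) s)) (*ᶜ-cong ≈ᶜ-refl (P-natᶜ n s)))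
          (pointwiseᶜ
            (λ _ → trans (l₁ (α n) (ι (+ 2)) (ιℕ s) (ιℕ (count (suc n) 0 s)) (β n) (ιℕ (count n 0 s))) (sym (count-recurrenceℚ n s)))
            (λ _ → l₂ (α n) (ι (+ 2)) (ιℕ s) (ιℕ (count (suc n) 0 s)) (β n) (ιℕ (count n 0 s)))))))
      where
      l₁ : ∀ a c s x b y →
        ((a * ((c * s + - (0ℚ * 0ℚ)) + 1ℚ) + - (0ℚ * ((c * 0ℚ + 0ℚ * s) + 0ℚ))) * x
          + - ((a * ((c * 0ℚ + 0ℚ * s) + 0ℚ) + 0ℚ * ((c * s + - (0ℚ * 0ℚ)) + 1ℚ)) * 0ℚ)) + (b * y + - (0ℚ * 0ℚ))
        ≡ a * (c * s + 1ℚ) * x + b * y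
      l₁ = solve-∀ ℚ-ring
      l₂ : ∀ a c s x b y →
        ((a * ((c * s + - (0ℚ * 0ℚ)) + 1ℚ) + - (0ℚ * ((c * 0ℚ + 0ℚ * s) + 0ℚ))) * 0ℚ
          + (a * ((c * 0ℚ + 0ℚ * s) + 0ℚ) + 0ℚ * ((c * s + - (0ℚ * 0ℚ)) + 1ℚ)) * x) + (b * 0ℚ + 0ℚ * y)
        ≡ 0ℚ
      l₂ = solve-∀ ℚ-ring

    P-recurrence : ∀ n z → eval (P (2 ℕ.+ n)) z ≈ᶜ
      ratᶜ (α n) *ᶜ (ratᶜ (ι (+ 2)) *ᶜ z +ᶜ 1ᶜ) *ᶜ eval (P (suc n)) z +ᶜ ratᶜ (β n) *ᶜ eval (P n) z
    P-recurrence n z = ≈ᶜ-trans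
      (eval-unique (P (2 ℕ.+ n)) (combine (α n) (β n) (P (suc n)) (P n)) (P-combine-natᶜ n) z)
      (eval-combine (α n) (β n) (P (suc n)) (P n) z)

    private
      one two : ℂ[x]
      one = 1ᶜ ∷ []
      two = 1ᶜ ∷ ratᶜ (ι (+ 2)) ∷ []

      P₀-natᶜ : ∀ s → eval (P 0) (natᶜ s) ≈ᶜ eval one (natᶜ s)
      P₀-natᶜ s = ≈ᶜ-trans (P-natᶜ 0 s) (≈ᶜ-sym (zero-right (*ᶜ-zeroʳ (natᶜ s))))

      P₁-natᶜ : ∀ s → eval (P 1) (natᶜ s) ≈ᶜ eval two (natᶜ s)
      P₁-natᶜ s = ≈ᶜ-trans (P-natᶜ 1 s) (pointwiseᶜ
        (λ _ → trans (cong ιℕ (count-one s)) (trans (ιℕ-+ (2 ℕ.* s) 1) (trans (cong (_+ 1ℚ) (ιℕ-* 2 s)) (l₁ (ι (+ 2)) (ιℕ s)))))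
        (λ _ → l₂ (ι (+ 2)) (ιℕ s)))
        where
        l₁ : ∀ c s → c * s + 1ℚ ≡ 1ℚ + (s * (c + (s * 0ℚ + - (0ℚ * 0ℚ))) + - (0ℚ * (0ℚ + (s * 0ℚ + 0ℚ * 0ℚ))))
        l₁ = solve-∀ ℚ-ring
        l₂ : ∀ c s → 0ℚ ≡ 0ℚ + (s * (0ℚ + (s * 0ℚ + 0ℚ * 0ℚ)) + 0ℚ * (c + (s * 0ℚ + - (0ℚ * 0ℚ))))
        l₂ = solve-∀ ℚ-ring

    -- An explicit positive rational makes the leading coefficient visibly nonzero; it is multiplied
    -- by 2 α at each step. The vanishing of higher coefficients has to be proved, since the length
    -- of the list `H d` is unknown.
    P-leading : ∀ d → ∃ λ q → 0ℚ < q × coeff (P d) d ≈ᶜ ratᶜ q × VanishesFrom (suc d) (P d)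
    P-leading zero = 1ℚ , positive⁻¹ 1ℚ , coeff-unique (P 0) one P₀-natᶜ 0 , vanish
      where
      vanish : VanishesFrom 1 (P 0)
      vanish (suc k) _ = coeff-unique (P 0) one P₀-natᶜ (suc k)
    P-leading (suc zero) = ι (+ 2) , ιℕ>0 1 , coeff-unique (P 1) two P₁-natᶜ 1 , vanish
      where
      vanish : VanishesFrom 2 (P 1)
      vanish (suc (suc k)) _ = coeff-unique (P 1) two P₁-natᶜ (suc (suc k))
      vanish (suc zero) (ℕ.s≤s ())
    P-leading (suc (suc n)) with P-leading (suc n) | P-leading n
    ... | q , q>0 , lead , van₁ | _ , _ , _ , van₀ =
      α n * (ι (+ 2) * q) , pos-* (α>0 n) (pos-* (ιℕ>0 1) q>0) ,
      ≈ᶜ-trans (coeff≈ (suc n)) (≈ᶜ-trans (zero-right (product-zero (ratᶜ (β n)) (van₀ (2 ℕ.+ n) (ℕ.n≤1+n (suc n)))))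
        (≈ᶜ-trans (*ᶜ-cong ≈ᶜ-refl (≈ᶜ-trans (zero-right (van₁ (2 ℕ.+ n) ℕ.≤-refl))
          (≈ᶜ-trans (*ᶜ-cong ≈ᶜ-refl lead) (ratᶜ-* (ι (+ 2)) q)))) (ratᶜ-* (α n) (ι (+ 2) * q)))) ,
      vanish
      where
      coeff≈ : ∀ k → coeff (P (2 ℕ.+ n)) (suc k) ≈ᶜ
        ratᶜ (α n) *ᶜ (ratᶜ (ι (+ 2)) *ᶜ coeff (P (suc n)) k +ᶜ coeff (P (suc n)) (suc k)) +ᶜ ratᶜ (β n) *ᶜ coeff (P n) (suc k)
      coeff≈ k = ≈ᶜ-trans (coeff-unique (P (2 ℕ.+ n)) (combine (α n) (β n) (P (suc n)) (P n)) (P-combine-natᶜ n) (suc k))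
        (coeff-combine (α n) (β n) (P (suc n)) (P n) k)
      vanish : VanishesFrom (3 ℕ.+ n) (P (2 ℕ.+ n))
      vanish (suc k) (ℕ.s≤s n+2≤k) = ≈ᶜ-trans (coeff≈ k) (sum-zero
        (product-zero (ratᶜ (α n)) (sum-zero (product-zero (ratᶜ (ι (+ 2))) (van₁ k n+2≤k)) (van₁ (suc k) (ℕ.m≤n⇒m≤1+n n+2≤k))))
        (product-zero (ratᶜ (β n)) (van₀ (suc k) (ℕ.m≤n⇒m≤1+n (ℕ.<⇒≤ n+2≤k)))))

    P-degree : ∀ d → HasDegree (P d) d
    P-degree d = let q , q>0 , lead , van = P-leading d in
      (λ c≈0 → <-irrefl (sym (fromℚ-injective (≈-trans (≈-sym (re≈ lead)) (re≈ c≈0)))) q>0) , van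

    P-onLine : ∀ d t → eval (P d) (onLine t) ≈ᶜ iᵖ d *ᶜ fromℝ (pᴿ d t)
    P-onLine zero       t = ≈ᶜ-trans (eval-unique (P 0) one P₀-natᶜ (onLine t))
      (≈ᶜ-trans (zero-right (*ᶜ-zeroʳ (onLine t))) (≈ᶜ-sym (*ᶜ-identityʳ 1ᶜ)))
    P-onLine (suc zero) t = ≈ᶜ-trans (eval-unique (P 1) two P₁-natᶜ (onLine t))
      (pointwiseᶜ (λ n → l₁ (seq t n)) (λ n → l₂ (seq t n)))
      where
      l₁ : ∀ t → 1ℚ + ((- ½) * (ι (+ 2) + ((- ½) * 0ℚ + - (t * 0ℚ))) + - (t * (0ℚ + ((- ½) * 0ℚ + t * 0ℚ))))
           ≡ (0ℚ * 1ℚ + - (1ℚ * 0ℚ)) * (ι (+ 2) * t) + - ((0ℚ * 0ℚ + 1ℚ * 1ℚ) * 0ℚ)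
      l₁ = solve-∀ ℚ-ring
      l₂ : ∀ t → 0ℚ + ((- ½) * (0ℚ + ((- ½) * 0ℚ + t * 0ℚ)) + t * (ι (+ 2) + ((- ½) * 0ℚ + - (t * 0ℚ))))
           ≡ (0ℚ * 1ℚ + - (1ℚ * 0ℚ)) * 0ℚ + (0ℚ * 0ℚ + 1ℚ * 1ℚ) * (ι (+ 2) * t)
      l₂ = solve-∀ ℚ-ring
    P-onLine (suc (suc n)) t = ≈ᶜ-trans (P-recurrence n (onLine t))
      (≈ᶜ-trans (+ᶜ-cong (*ᶜ-cong ≈ᶜ-refl (P-onLine (suc n) t)) (*ᶜ-cong ≈ᶜ-refl (P-onLine n t)))
        (pointwiseᶜ
          (λ i → l₁ (α n) (β n) (seq t i) (seq (re (iᵖ n)) i) (seq (im (iᵖ n)) i) (seq (pᴿ (suc n) t) i) (seq (pᴿ n t) i))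
          (λ i → l₂ (α n) (β n) (seq t i) (seq (re (iᵖ n)) i) (seq (im (iᵖ n)) i) (seq (pᴿ (suc n) t) i) (seq (pᴿ n t) i))))
      where
      l₁ : ∀ a b t u v x y →
        let c = ι (+ 2)
            z = c * (- ½) + - (0ℚ * t) + 1ℚ
            z′ = c * t + 0ℚ * (- ½) + 0ℚ
            w = 0ℚ * u + - (1ℚ * v)
            w′ = 0ℚ * v + 1ℚ * u
            W = 0ℚ * w + - (1ℚ * w′)
            W′ = 0ℚ * w′ + 1ℚ * w
            X = c * a * t * x + - (b * y)
        in ((a * z + - (0ℚ * z′)) * (w * x + - (w′ * 0ℚ)) + - ((a * z′ + 0ℚ * z) * (w * 0ℚ + w′ * x)))
           + (b * (u * y + - (v * 0ℚ)) + - (0ℚ * (u * 0ℚ + v * y)))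
           ≡ W * X + - (W′ * 0ℚ)
      l₁ = solve-∀ ℚ-ring
      l₂ : ∀ a b t u v x y →
        let c = ι (+ 2)
            z = c * (- ½) + - (0ℚ * t) + 1ℚ
            z′ = c * t + 0ℚ * (- ½) + 0ℚ
            w = 0ℚ * u + - (1ℚ * v)
            w′ = 0ℚ * v + 1ℚ * u
            W = 0ℚ * w + - (1ℚ * w′)
            W′ = 0ℚ * w′ + 1ℚ * w
            X = c * a * t * x + - (b * y)
        in ((a * z + - (0ℚ * z′)) * (w * 0ℚ + w′ * x) + (a * z′ + 0ℚ * z) * (w * x + - (w′ * 0ℚ)))
           + (b * (u * 0ℚ + v * y) + 0ℚ * (u * y + - (v * 0ℚ)))
           ≡ W * 0ℚ + W′ * X
      l₂ = solve-∀ ℚ-ring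

    -- The zeros as limits of lower bracket ends.

    module _ {B : ℚ} {N : ℕ} (dom : Dominates B N) where

      root : ∀ n → n ℕ.≤ N → Vector ℝ n
      root n n≤N k = mkℝ (lo dom n (toℕ k)) (lo-cauchy dom n≤N (Fin.toℕ<n k))

      root-zero : ∀ n n≤N k → eval (P n) (Line.point R (root n n≤N k)) ≈ᶜ 0ᶜ
      root-zero n n≤N k = ≈ᶜ-trans (eval-cong (P n) (R-point t)) (≈ᶜ-trans (P-onLine n t)
        (product-zero (iᵖ n) (mk≈ᶜ pt≈0 ≈-refl)))
        where
        t = root n n≤N k
        pt≈0 : pᴿ n t ≈ 0ℝ
        pt≈0 = mk≈ λ ε ε>0 → let I , small = p-lo-small dom n≤N (Fin.toℕ<n k) ε ε>0 in I , λ i i≥I →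
          subst (λ q → ∣ q ∣ < ε) (trans (sym (seq-pᴿ n t i)) (sym (+-identityʳ (seq (pᴿ n t) i)))) (small i i≥I)

      root-apart : ∀ n n≤N {i j} → i Fin.< j →
        Cancelable (Line.point R (root n n≤N j) -ᶜ Line.point R (root n n≤N i))
      root-apart n n≤N {i} {j} i<j = let δ , δ>0 , I , gap = lo-gap dom n≤N i<j (Fin.toℕ<n j) in
        cancelable-resp (-ᶜ-cong (R-point tⱼ) (R-point tᵢ))
          (apart⇒cancelable (onLine tⱼ -ᶜ onLine tᵢ) (δ * δ) I (pos-* δ>0 δ>0) λ m m≥I →
            0≤⇒≤ (nonNeg-+ (sq-nonNeg (- ½ - - ½)) (nonNeg-+ (nonNeg-* (≤⇒0≤ (gap m m≥I)) (<⇒≤ δ>0))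
                     (nonNeg-* (≤-trans (<⇒≤ δ>0) (gap m m≥I)) (≤⇒0≤ (gap m m≥I)))))
                 (lem (- ½ - - ½) (seq tⱼ m - seq tᵢ m) δ))
        where
        tᵢ = root n n≤N i
        tⱼ = root n n≤N j
        lem : ∀ r g δ → (r * r + g * g) - δ * δ ≡ r * r + ((g - δ) * δ + g * (g - δ))
        lem = solve-∀ ℚ-ring

      P-zeros : ∀ n n≤N → ListsZeros (λ k → Line.point R (root n n≤N k)) (P n)
      P-zeros n n≤N = P-degree n ,
        factorization n (P n) (λ k → Line.point R (root n n≤N k)) (proj₂ (P-degree n)) (root-zero n n≤N) (root-apart n n≤N)

      -- If z kept a distance ε from the line, every factor z - tₖ would be cancelable, and P(z) = 0
      -- would force the leading coefficient to vanish. The real parts alone give the distance to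
      -- every point of the line.
      zeros-on-line : ∀ n → n ℕ.≤ N → ∀ z → eval (P n) z ≈ᶜ 0ᶜ → re z ≈ -½
      zeros-on-line n n≤N z Pz≈0 = apart-from-line (re z) λ ε M ε>0 far →
        proj₁ (P-degree n) (product-cancelable (λ k → factor-cancelable ε M ε>0 far (root n n≤N k))
          (≈ᶜ-trans (*ᶜ-comm _ (coeff (P n) n)) (≈ᶜ-trans (≈ᶜ-sym (proj₂ (P-zeros n n≤N) z)) Pz≈0)))
        where
        factor-cancelable : ∀ ε M → 0ℚ < ε → (∀ m → M ℕ.≤ m → ε ≤ ∣ seq (re z) m - (- ½) ∣) →
          ∀ t → Cancelable (z -ᶜ Line.point R t)
        factor-cancelable ε M ε>0 far t = cancelable-resp (-ᶜ-cong ≈ᶜ-refl (R-point t))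
          (apart⇒cancelable (z -ᶜ onLine t) (ε * ε) M (pos-* ε>0 ε>0) λ m m≥M →
            let r = seq (re z) m - (- ½) in
            ≤-trans (≤-trans (*-monoˡ (<⇒≤ ε>0) (far m m≥M))
                             (*-monoʳ (0≤∣p∣ r) (far m m≥M)))
              (≤-trans (≤-reflexive (trans (sym (∣p*q∣≡∣p∣*∣q∣ r r)) (0≤p⇒∣p∣≡p (sq-nonNeg r))))
                (0≤⇒≤ (sq-nonNeg (seq (im z) m - seq t m)) (lem (r * r) _))))
          where
          lem : ∀ a b → (a + b) - a ≡ b
          lem = solve-∀ ℚ-ring

    interlaced : ∀ d → InterlacedBy R (P (suc d)) (P d)
    interlaced d = let B , dom = dominates (suc d) in
      d , root dom (suc d) ℕ.≤-refl , root dom d (ℕ.n≤1+n d) , P-zeros dom (suc d) ℕ.≤-refl , P-zeros dom d (ℕ.n≤1+n d) ,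
      λ j → mk≤ (λ ε ε>0 → subst (λ k → ∃ λ I → ∀ i → I ℕ.≤ i → lo dom (suc d) k i ≤ lo dom d (toℕ j) i + ε)
                   (sym (Fin.toℕ-inject₁ j)) (interlace-left dom ℕ.≤-refl (Fin.toℕ<n j) ε ε>0)) ,
            mk≤ (interlace-right dom ℕ.≤-refl (Fin.toℕ<n j))

    on-line : ∀ d z → eval (P d) z ≈ᶜ 0ᶜ → re z ≈ -½
    on-line d = zeros-on-line (proj₂ (dominates d)) d ℕ.≤-refl

open import Defs hiding (_≤_)
open import Data.Integer using (+_)
open import Data.Nat using (ℕ; suc; _≤_) renaming (_+_ to _+ℕ_; _*_ to _*ℕ_; _∸_ to _∸ℕ_)
open import Data.Product using (_×_; _,_)
open import Data.Rational using (ℚ; 1ℚ; _/_)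
open import Relation.Binary.PropositionalEquality using (_≡_)

mainTheorem5 : (H : ℕ → ℚ[x]) →
    (∀ (x : ℚ) → evalℚ (H 0) x ≡ 1ℚ) →
    (∀ d → 1 ≤ d → IsEhrhartPolynomial (St d) (H d)) →
    (∀ n → let d = 2 +ℕ n in ∀ (m : ℂ) →
    eval (toℂ[x] (H d)) m
    ≈ᶜ ratᶜ (+ (2 *ℕ d +ℕ 1) / (d *ℕ (d +ℕ 2)))
    *ᶜ (ratᶜ (+ 2 / 1) *ᶜ m +ᶜ 1ᶜ) *ᶜ eval (toℂ[x] (H (d ∸ℕ 1))) m
    +ᶜ ratᶜ (+ ((d ∸ℕ 1) *ℕ (d +ℕ 1)) / (d *ℕ (d +ℕ 2)))
    *ᶜ eval (toℂ[x] (H (d ∸ℕ 2))) m) ×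
    (∀ d → 1 ≤ d →
    (∀ z → eval (toℂ[x] (H d)) z ≈ᶜ 0ᶜ → re z ≈ -½) ×
    InterlacedBy R (toℂ[x] (H (suc d))) (toℂ[x] (H d)))
mainTheorem5 H H₀ ehrhart =
  Ehrhart.P-recurrence H H₀ ehrhart ,
  λ d _ → Ehrhart.on-line H H₀ ehrhart d , Ehrhart.interlaced H H₀ ehrhart d
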